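{- Let $n$ be an integer with $1\leq n\leq 5$, and let $F_1,\ldots,F_n$ be linear forms in three variables in general position, defined over a number field $k$, with indices read in $\mathbb{Z}/n\mathbb{Z}$. Then there exists a ring of $S$-integers $\mathcal{O}_S$, for a finite set of places $S$ of $k$, such that the set of $(x,y,z)\in\mathcal{O}_S^3$ satisfying, for each $i\in\mathbb{Z}/n\mathbb{Z}$, the equality of ideals of $\mathcal{O}_S$ $$F_i(x,y,z)\cdot(x,y,z)=\big(F_{i-1}(x,y,z),F_i(x,y,z)\big)\cdot\big(F_i(x,y,z),F_{i+1}(x,y,z)\big)$$ is Zariski-dense (in $\mathbb{P}_2$ or, equivalently, in $\mathbb{A}^3$).
   Context: $S$ contains all the archimedean places of $k$. For $\alpha_1,\ldots,\alpha_h\in k$, $(\alpha_1,\ldots,\alpha_h)$ denotes the (fractional) ideal of $\mathcal{O}_S$ they generate. Linear forms in three variables are in general position if any three of them (or all of them, if there are fewer than three) are linearly independent. -}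

module Defs where

open import Level using (Level; _⊔_; suc)
open import Algebra.Apartness.Bundles using (HeytingField; HeytingCommutativeRing)
open import Algebra.Bundles using (CommutativeRing)
open import Algebra.Morphism.Structures using (module RingMorphisms)
open import Data.Fin.Base using (Fin; toℕ)
open import Data.Fin.Patterns using (0F; 1F; 2F)
open import Data.Integer.Base as ℤ using (ℤ; 0ℤ; 1ℤ)
open import Data.List.Base using (List)
open import Data.List.Relation.Unary.Any using (Any)
open import Data.Nat.Base as ℕ using (ℕ; NonZero)
open import Data.Nat.DivMod using (_mod_)
open import Data.Product.Base using (∃-syntax; Σ-syntax; _×_)
open import Data.Rational.Base using (ℚ; +-*-rawRing)
open import Data.Vec.Functional using (Vector; []; _∷_)
open import Function.Base using (_∘_)
open import Function.Definitions using (Injective)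
open import Relation.Binary.PropositionalEquality.Core using (_≡_; _≢_)
open import Relation.Nullary.Negation using (¬_)
open import Relation.Unary using (Pred; _∈_; _≐_)
import Algebra.Properties.CommutativeMonoid.Sum as Sum
import Algebra.Properties.Semiring.Exp as Exp

-- ℤ/nℤ is represented by Fin n; these are i ↦ i + 1 and i ↦ i - 1 modulo n.
next prev : ∀ {n} .{{_ : NonZero n}} → Fin n → Fin n
next {n} i = ℕ.suc (toℕ i) mod n
prev {n} i = (toℕ i ℕ.+ ℕ.pred n) mod n

-- A field of finite dimension over ℚ.
record NumberField (c ℓ₁ ℓ₂ : Level) : Set (suc (c ⊔ ℓ₁ ⊔ ℓ₂)) where
  field
    heytingField : HeytingField c ℓ₁ ℓ₂

  open HeytingField heytingField public

  commutativeRing : CommutativeRing c ℓ₁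
  commutativeRing = HeytingCommutativeRing.commutativeRing heytingCommutativeRing

  open CommutativeRing commutativeRing public
    using (rawRing; semiring; +-commutativeMonoid)
  open Sum +-commutativeMonoid public using (sum)
  open Exp semiring public using (_^_)
  open RingMorphisms +-*-rawRing rawRing using (IsRingHomomorphism)

  field
    ι              : ℚ → Carrier
    ι-homomorphism : IsRingHomomorphism ι
    finiteDim      : ∃[ d ] Σ[ e ∈ Vector Carrier d ] ∀ x →
                     Σ[ q ∈ Vector ℚ d ] x ≈ sum (λ i → ι (q i) * e i)

module _ {c ℓ₁ ℓ₂ : Level} (k : NumberField c ℓ₁ ℓ₂) where
  open NumberField k

  -- A non-archimedean place, as the unique valuation with value group exactly ℤ
  -- in its class. The valuation of 0 should be +∞, so the integer ord 0# is
  -- meaningless: ord is only ever constrained or used at nonzero elements.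
  record FinitePlace : Set (c ⊔ ℓ₁ ⊔ ℓ₂) where
    field
      ord        : Carrier → ℤ
      ord-cong   : ∀ {x y} → x # 0# → x ≈ y → ord x ≡ ord y
      ord-*      : ∀ {x y} → x # 0# → y # 0# → ord (x * y) ≡ ord x ℤ.+ ord y
      ord-+      : ∀ {x y} → x # 0# → y # 0# → (x + y) # 0# →
                   ord x ℤ.⊓ ord y ℤ.≤ ord (x + y)
      normalized : ∃[ x ] x # 0# × ord x ≡ 1ℤ

  open FinitePlace public

  _∼_ : FinitePlace → FinitePlace → Set (c ⊔ ℓ₂)
  v ∼ w = ∀ x → x # 0# → ord v x ≡ ord w x

  -- The list is the non-archimedean part of S; the archimedean places always
  -- belong to S and impose no condition on S-integers.
  𝒪 : List FinitePlace → Pred Carrier (c ⊔ ℓ₁ ⊔ ℓ₂)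
  𝒪 S x = ∀ v → ¬ Any (v ∼_) S → x # 0# → 0ℤ ℤ.≤ ord v x

  -- Fractional ideals of 𝒪 S are represented as subsets of k.
  Ideal : Set (suc (c ⊔ ℓ₁ ⊔ ℓ₂))
  Ideal = Pred Carrier (c ⊔ ℓ₁ ⊔ ℓ₂)

  generated : ∀ {h} → List FinitePlace → Vector Carrier h → Ideal
  generated {h} S α x =
    Σ[ a ∈ Vector Carrier h ] (∀ i → a i ∈ 𝒪 S) × x ≈ sum (λ i → a i * α i)

  scale : Carrier → Ideal → Ideal
  scale a I x = ∃[ y ] y ∈ I × x ≈ a * y

  _·_ : Ideal → Ideal → Ideal
  (I · J) x = ∃[ m ] Σ[ a ∈ Vector Carrier m ] Σ[ b ∈ Vector Carrier m ]
    (∀ i → a i ∈ I) × (∀ i → b i ∈ J) × x ≈ sum (λ i → a i * b i)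

  Point : Set c
  Point = Vector Carrier 3

  -- A linear form in three variables is given by its coefficients.
  LinearForm : Set c
  LinearForm = Vector Carrier 3

  apply : LinearForm → Point → Carrier
  apply f p = sum (λ j → f j * p j)

  LinearlyIndependent : ∀ {m} → Vector LinearForm m → Set (c ⊔ ℓ₁)
  LinearlyIndependent {m} F = (a : Vector Carrier m) →
    (∀ j → sum (λ i → a i * F i j) ≈ 0#) → ∀ i → a i ≈ 0#

  GeneralPosition : ∀ {n} → Vector LinearForm n → Set (c ⊔ ℓ₁)
  GeneralPosition {n} F =
    ((σ : Fin 3 → Fin n) → Injective _≡_ _≡_ σ → LinearlyIndependent (F ∘ σ)) ×
    (n ℕ.< 3 → LinearlyIndependent F)

  Solutions : ∀ {n} .{{_ : NonZero n}} → Vector LinearForm n →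
              List FinitePlace → Pred Point (c ⊔ ℓ₁ ⊔ ℓ₂)
  Solutions {n} F S p =
    (∀ j → p j ∈ 𝒪 S) ×
    (∀ i → scale (f i) (generated S p) ≐
           generated S (f (prev i) ∷ f i ∷ []) · generated S (f i ∷ f (next i) ∷ []))
    where
    f : Vector Carrier n
    f i = apply (F i) p

  -- P i j l is the coefficient of X^i Y^j Z^l; every exponent is less than d.
  Polynomial : ℕ → Set c
  Polynomial d = Fin d → Fin d → Fin d → Carrier

  eval : ∀ {d} → Polynomial d → Point → Carrier
  eval P p = sum λ i → sum λ j → sum λ l →
    P i j l * (p 0F ^ toℕ i * (p 1F ^ toℕ j * p 2F ^ toℕ l))

  IsZero : ∀ {d} → Polynomial d → Set ℓ₁
  IsZero P = ∀ i j l → P i j l ≈ 0#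

  Homogeneous : ∀ {d} → ℕ → Polynomial d → Set ℓ₁
  Homogeneous e P = ∀ i j l → toℕ i ℕ.+ toℕ j ℕ.+ toℕ l ≢ e → P i j l ≈ 0#

  DenseIn𝔸³ : ∀ {a} → Pred Point a → Set (a ⊔ c ⊔ ℓ₁)
  DenseIn𝔸³ X = ∀ {d} (P : Polynomial d) →
    (∀ p → p ∈ X → eval P p ≈ 0#) → IsZero P

  -- For a set of vectors X, this is the density of the set of points of ℙ²
  -- represented by the nonzero elements of X.
  DenseInℙ² : ∀ {a} → Pred Point a → Set (a ⊔ c ⊔ ℓ₁ ⊔ ℓ₂)
  DenseInℙ² X = ∀ {d} e (P : Polynomial d) → Homogeneous e P →
    (∀ p → p ∈ X → (∃[ j ] p j # 0#) → eval P p ≈ 0#) → IsZero P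

-- For large S finitely many given elements are S-integral: an element of k has
-- poles only above the primes in the denominators of a monic relation, and the
-- places above one prime are bounded in number by [k : ℚ], since by weak
-- approximation they give independent elements. So 2 and all constants below
-- may be taken to be S-units, and the powers of 2 are Zariski-dense.
--
-- If F_{i-1}(p) F_{i+1}(p) = F_i(p) g with g in the ideal (p), and p lies in the
-- ideal (F_{i-1}(p), F_i(p), F_{i+1}(p)), as it does for n ≥ 3, then the equality
-- of ideals at i holds. For n ≤ 3 one takes the values of three independent
-- forms to be powers of 2. For n = 4 the divisibility holds on the conics
-- F₀F₂ = t F₁F₃, t a unit, and these are parametrized explicitly.
--
-- For n = 5, the plane blown up at the vertices L_i ∩ L_{i+1} and contracted along
-- the conic through them is a quintic del Pezzo surface in which the lines
-- become a pentagon; the complement of the pentagon has coordinates z_i with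
-- z_i z_{i+1} = z_{i+3} + 1, the A₂ cluster relations, hence many integral points
-- with two of the z_i arbitrary units. The conic contracts to a point ε, and
-- F_i is proportional to (z_i - ε_i)(z_{i+1} - ε_{i+1}).
module Submission where

open import Defs
open import Level using (Level; _⊔_; Lift; lift)
open import Axiom.ExcludedMiddle using (ExcludedMiddle)
open import Algebra.Bundles using (CommutativeRing)
open import Algebra.Morphism.Structures using (module RingMorphisms)
open import Data.Fin.Base using (Fin; zero; suc; toℕ; punchIn; punchOut)
open import Data.Fin.Patterns using (0F; 1F; 2F; 3F; 4F)
open import Data.Integer.Base as ℤ using (ℤ; +_; -[1+_]; 0ℤ; 1ℤ; +≤+; +<+; -<+)
open import Data.List.Base using (List; _++_; tabulate)
open import Data.List.Relation.Unary.All as All using (All)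
open import Data.List.Relation.Unary.Any using (Any)
open import Data.List.Relation.Binary.Subset.Propositional using (_⊆_)
open import Data.List.Relation.Binary.Subset.Propositional.Properties using (Any-resp-⊆; xs⊆xs++ys; xs⊆ys++xs; ⊆-trans)
open import Data.Nat.Base as ℕ using (ℕ; zero; suc; NonZero; _≤_)
open import Data.Nat.Coprimality using (coprime-Bézout; recompute)
open import Data.Nat.GCD using (module Bézout)
open import Data.Nat.Primality using (Prime; prime⇒irreducible; prime⇒nonZero; ¬prime[1])
open import Data.Nat.Primality.Factorisation using (factorise; PrimeFactorisation)
open import Data.Product.Base using (_×_; _,_; proj₁; proj₂; ∃; ∃-syntax; Σ-syntax)
open import Data.Rational.Base as ℚ using (ℚ; mkℚ; 0ℚ; 1ℚ; ↥_; ↧ₙ_)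
open import Data.Sum.Base using (_⊎_; inj₁; inj₂)
open import Data.Vec.Functional using (Vector; head; tail; removeAt; insertAt) renaming (_∷_ to _∷ᵛ_; [] to []ᵛ)
open import Data.Vec.Functional.Properties using (insertAt-lookup; insertAt-punchIn)
open import Function.Base using (_∘_)
open import Relation.Binary.Definitions using (tri<; tri≈; tri>)
open import Relation.Binary.PropositionalEquality.Core as ≡ using (_≡_; _≢_)
open import Relation.Nullary.Decidable using (yes; no; dec⇒maybe)
open import Relation.Nullary.Negation using (¬_; contradiction)
open import Relation.Unary using (_∈_; Pred; _≐_)
import Algebra.Properties.AbelianGroup
import Algebra.Properties.Ring
import Algebra.Properties.Semiring.Mult.TCOptimised
import Algebra.Properties.Semiring.Sum
import Algebra.Solver.Ring
import Algebra.Solver.Ring.AlmostCommutativeRing as ACR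
import Data.Fin.Properties as Fin
import Data.Integer.Properties as ℤ
import Data.List.Relation.Unary.All.Properties as All
import Data.List.Relation.Unary.Any.Properties as Any
import Data.Maybe.Base as Maybe
import Data.Nat.Divisibility as ℕ
import Data.Nat.ListAction as ℕ
import Data.Nat.Properties as ℕ
import Data.Rational.Literals as ℚ
import Data.Rational.Properties as ℚ
import Data.Rational.Unnormalised.Base as ℚᵘ
import Data.Rational.Unnormalised.Properties as ℚᵘ
import Relation.Binary.Reasoning.Setoid

-- For five forms, write e_i for z_i - ε_i. Subtracting the exchange relations at ε from those at z
-- shows that e_i e_{i+1} is linear in the e_j. The five products are thus hyperplane sections of
-- the quintic surface with a double point at ε. Such sections form a space of dimension three,
-- which is why the products can be proportional to forms in three variables; the conics z_i = ε_i
-- contract to the vertices, since F_{i-1} and F_i vanish on them. Five lines in general position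
-- have two moduli, as has ε, so ε and the factors of proportionality κ_i can be solved for.
--
-- The obstacle is the divisibility. If F_i = κ_i Λ e_i e_{i+1}, then F_{i-1} F_{i+1} / F_i is a
-- constant times Λ e_{i-1} e_{i+2}, whose two factors are not neighbours in the pentagon, so it is
-- not visibly in the ideal (p). The exchange relations express it through the values Λ e_j e_{j+1},
-- with S-integral coefficients that depend on z as well as on ε, after division by two of the ε_j,
-- which are units.

-- A ring solver with integer coefficients.

module IntegerSolver {a ℓ : Level} (R : CommutativeRing a ℓ) where
  open CommutativeRing R
  open Algebra.Properties.Ring ring
  open Algebra.Properties.Semiring.Mult.TCOptimised semiring renaming (_×_ to _×′_)
  open Relation.Binary.Reasoning.Setoid setoid

  -- With the optimised multiple, `ofℤ 1ℤ` is `1#` by definition, so that solver equations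
  -- containing `con 1ℤ` match goals containing `1#`.
  ofℤ : ℤ → Carrier
  ofℤ (+ n)      = n ×′ 1#
  ofℤ (-[1+ n ]) = - (suc n ×′ 1#)

  +-cancel-middle : ∀ x y z → (x + y) - (x + z) ≈ y - z
  +-cancel-middle x y z = begin
    (x + y) - (x + z)     ≈⟨ +-congˡ (-‿+-comm x z) ⟨
    (x + y) + (- x - z)   ≈⟨ +-congʳ (+-comm x y) ⟩
    (y + x) + (- x - z)   ≈⟨ +-assoc y x _ ⟩
    y + (x + (- x - z))   ≈⟨ +-congˡ (+-assoc x (- x) (- z)) ⟨
    y + ((x - x) - z)     ≈⟨ +-congˡ (+-congʳ (-‿inverseʳ x)) ⟩
    y + (0# - z)          ≈⟨ +-congˡ (+-identityˡ (- z)) ⟩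
    y - z                 ∎

  ofℤ-⊖ : ∀ m n → ofℤ (m ℤ.⊖ n) ≈ m ×′ 1# - n ×′ 1#
  ofℤ-⊖ m zero = begin
    m ×′ 1#             ≈⟨ +-identityʳ _ ⟨
    m ×′ 1# + 0#        ≈⟨ +-congˡ -0#≈0# ⟨
    m ×′ 1# - 0#        ∎
  ofℤ-⊖ zero (suc n) = sym (+-identityˡ _)
  ofℤ-⊖ (suc m) (suc n) = begin
    ofℤ (suc m ℤ.⊖ suc n)             ≡⟨ ≡.cong ofℤ (ℤ.[1+m]⊖[1+n]≡m⊖n m n) ⟩
    ofℤ (m ℤ.⊖ n)                     ≈⟨ ofℤ-⊖ m n ⟩
    m ×′ 1# - n ×′ 1#                 ≈⟨ +-cancel-middle 1# (m ×′ 1#) (n ×′ 1#) ⟨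
    (1# + m ×′ 1#) - (1# + n ×′ 1#)   ≈⟨ +-cong (1+× m 1#) (-‿cong (1+× n 1#)) ⟨
    suc m ×′ 1# - suc n ×′ 1#         ∎

  ofℤ-+ : ∀ i j → ofℤ (i ℤ.+ j) ≈ ofℤ (i) + ofℤ (j)
  ofℤ-+ (+ m)      (+ n)      = ×-homo-+ 1# m n
  ofℤ-+ (+ m)      -[1+ n ]   = ofℤ-⊖ m (suc n)
  ofℤ-+ -[1+ m ]   (+ n)      = trans (ofℤ-⊖ n (suc m)) (+-comm _ _)
  ofℤ-+ -[1+ m ]   -[1+ n ]   = begin
    - (suc (suc (m ℕ.+ n)) ×′ 1#)      ≡⟨ ≡.cong (λ l → - (suc l ×′ 1#)) (ℕ.+-suc m n) ⟨
    - ((suc m ℕ.+ suc n) ×′ 1#)        ≈⟨ -‿cong (×-homo-+ 1# (suc m) (suc n)) ⟩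
    - (suc m ×′ 1# + suc n ×′ 1#)       ≈⟨ -‿+-comm _ _ ⟨
    - (suc m ×′ 1#) - suc n ×′ 1#       ∎

  ofℤ-neg : ∀ i → ofℤ (ℤ.- i) ≈ - ofℤ (i)
  ofℤ-neg (+ zero)   = sym -0#≈0#
  ofℤ-neg (+ suc n)  = refl
  ofℤ-neg -[1+ n ]   = sym (-‿involutive _)

  ofℤ-*-pos : ∀ m j → ofℤ (+ m ℤ.* j) ≈ m ×′ 1# * ofℤ (j)
  ofℤ-*-pos zero    j = sym (zeroˡ _)
  ofℤ-*-pos (suc m) j = begin
    ofℤ (+ suc m ℤ.* j)              ≡⟨ ≡.cong ofℤ (ℤ.suc-* (+ m) j) ⟩
    ofℤ (j ℤ.+ + m ℤ.* j)            ≈⟨ ofℤ-+ j (+ m ℤ.* j) ⟩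
    ofℤ (j) + ofℤ (+ m ℤ.* j)          ≈⟨ +-cong (sym (*-identityˡ _)) (ofℤ-*-pos m j) ⟩
    1# * ofℤ (j) + m ×′ 1# * ofℤ (j)    ≈⟨ distribʳ _ _ _ ⟨
    (1# + m ×′ 1#) * ofℤ (j)          ≈⟨ *-congʳ (1+× m 1#) ⟨
    suc m ×′ 1# * ofℤ (j)             ∎

  ofℤ-* : ∀ i j → ofℤ (i ℤ.* j) ≈ ofℤ (i) * ofℤ (j)
  ofℤ-* (+ m)    j = ofℤ-*-pos m j
  ofℤ-* -[1+ m ] j = begin
    ofℤ (-[1+ m ] ℤ.* j)         ≡⟨ ≡.cong ofℤ (ℤ.neg-distribˡ-* (+ suc m) j) ⟨
    ofℤ (ℤ.- (+ suc m ℤ.* j))    ≈⟨ ofℤ-neg (+ suc m ℤ.* j) ⟩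
    - ofℤ (+ suc m ℤ.* j)        ≈⟨ -‿cong (ofℤ-*-pos (suc m) j) ⟩
    - (suc m ×′ 1# * ofℤ (j))     ≈⟨ -‿distribˡ-* _ _ ⟩
    - (suc m ×′ 1#) * ofℤ (j)     ∎

  -- The solver has to recognise when coefficients cancel. Equality in the ring cannot be tested,
  -- whereas in ℤ it is decidable.
  homomorphism : ℤ.+-*-rawRing ACR.-Raw-AlmostCommutative⟶ ACR.fromCommutativeRing R
  homomorphism = record
    { ⟦_⟧ = ofℤ ; +-homo = ofℤ-+ ; *-homo = ofℤ-* ; -‿homo = ofℤ-neg
    ; 0-homo = refl ; 1-homo = refl }

  open Algebra.Solver.Ring ℤ.+-*-rawRing (ACR.fromCommutativeRing R) homomorphism
    (λ i j → Maybe.map (λ eq → reflexive (≡.cong ofℤ eq)) (dec⇒maybe (i ℤ.≟ j)))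
    using (solve; _:=_; _:+_; _:*_; _:-_; :-_; con) public

-- Field arithmetic with a classical test for zero.

module Field {c ℓ₁ ℓ₂ : Level} (em : ExcludedMiddle (c ⊔ ℓ₁ ⊔ ℓ₂)) (k : NumberField c ℓ₁ ℓ₂) where
  open NumberField k hiding (zero)
  open CommutativeRing commutativeRing using (ring)
  open IntegerSolver commutativeRing
  open Algebra.Properties.Ring ring using (-0#≈0#) public

  -- Apartness is tight, so excluded middle decides between the two cases. `Lift` brings the
  -- question to the universe level at which excluded middle is assumed.
  zero-or-nonzero : ∀ x → x ≈ 0# ⊎ x # 0#
  zero-or-nonzero x with em {Lift (c ⊔ ℓ₁) (x # 0#)}
  ... | yes (lift x#0) = inj₂ x#0
  ... | no ¬x#0        = inj₁ (proj₁ (tight x 0#) (λ x#0 → ¬x#0 (lift x#0)))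

  nonzero⇒≉0 : ∀ {x} → x # 0# → ¬ x ≈ 0#
  nonzero⇒≉0 x#0 x≈0 = proj₂ (tight _ 0#) x≈0 x#0

  ≉0⇒nonzero : ∀ {x} → ¬ x ≈ 0# → x # 0#
  ≉0⇒nonzero {x} x≉0 with zero-or-nonzero x
  ... | inj₁ x≈0 = contradiction x≈0 x≉0
  ... | inj₂ x#0 = x#0

  nonzero-cong : ∀ {x y} → x ≈ y → x # 0# → y # 0#
  nonzero-cong x≈y x#0 = ≉0⇒nonzero (λ y≈0 → nonzero⇒≉0 x#0 (trans x≈y y≈0))

  infix 9 _⁻¹
  -- 0# ⁻¹ is 0#.
  _⁻¹ : Carrier → Carrier
  x ⁻¹ with zero-or-nonzero x
  ... | inj₁ _   = 0#
  ... | inj₂ x#0 = proj₁ (#⇒invertible x#0)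

  x-0≈x : ∀ x → x - 0# ≈ x
  x-0≈x x = trans (+-congˡ -0#≈0#) (+-identityʳ x)

  *-inverseʳ : ∀ {x} → x # 0# → x * x ⁻¹ ≈ 1#
  *-inverseʳ {x} x#0 with zero-or-nonzero x
  ... | inj₁ x≈0 = contradiction x≈0 (nonzero⇒≉0 x#0)
  ... | inj₂ p   = trans (*-congʳ (sym (x-0≈x x))) (proj₂ (proj₂ (#⇒invertible p)))

  *-inverseˡ : ∀ {x} → x # 0# → x ⁻¹ * x ≈ 1#
  *-inverseˡ x#0 = trans (*-comm _ _) (*-inverseʳ x#0)

  cancel-inverse : ∀ {x y} → x # 0# → x * (y * x ⁻¹) ≈ y
  cancel-inverse {x} {y} x#0 = trans (solve 3 (λ x y z → x :* (y :* z) := (x :* z) :* y) refl x y (x ⁻¹))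
    (trans (*-congʳ (*-inverseʳ x#0)) (*-identityˡ y))

  invertible⇒nonzero : ∀ {x y} → x * y ≈ 1# → x # 0#
  invertible⇒nonzero {x} {y} xy≈1 = invertible⇒#
    (y , trans (*-comm _ _) x′y≈1 , x′y≈1)
    where
    x′y≈1 : (x - 0#) * y ≈ 1#
    x′y≈1 = trans (*-congʳ (x-0≈x x)) xy≈1

  1-nonzero : 1# # 0#
  1-nonzero = invertible⇒nonzero (*-identityʳ 1#)

  ⁻¹-nonzero : ∀ {x} → x # 0# → x ⁻¹ # 0#
  ⁻¹-nonzero x#0 = invertible⇒nonzero (*-inverseˡ x#0)

  *-cancelˡ-nonzero : ∀ {x y z} → x # 0# → x * y ≈ x * z → y ≈ z
  *-cancelˡ-nonzero {x} {y} {z} x#0 xy≈xz = begin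
    y                ≈⟨ *-identityˡ y ⟨
    1# * y           ≈⟨ *-congʳ (*-inverseˡ x#0) ⟨
    (x ⁻¹ * x) * y   ≈⟨ *-assoc _ _ _ ⟩
    x ⁻¹ * (x * y)   ≈⟨ *-congˡ xy≈xz ⟩
    x ⁻¹ * (x * z)   ≈⟨ *-assoc _ _ _ ⟨
    (x ⁻¹ * x) * z   ≈⟨ *-congʳ (*-inverseˡ x#0) ⟩
    1# * z           ≈⟨ *-identityˡ z ⟩
    z                ∎
    where open Relation.Binary.Reasoning.Setoid setoid

  no-zero-divisors : ∀ {x y} → x # 0# → x * y ≈ 0# → y ≈ 0#
  no-zero-divisors x#0 xy≈0 = *-cancelˡ-nonzero x#0 (trans xy≈0 (sym (zeroʳ _)))

  *-nonzero : ∀ {x y} → x # 0# → y # 0# → x * y # 0#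
  *-nonzero x#0 y#0 = ≉0⇒nonzero (λ xy≈0 → nonzero⇒≉0 y#0 (no-zero-divisors x#0 xy≈0))

  *-nonzeroˡ : ∀ {x y} → x * y # 0# → x # 0#
  *-nonzeroˡ xy#0 = ≉0⇒nonzero (λ x≈0 → nonzero⇒≉0 xy#0 (trans (*-congʳ x≈0) (zeroˡ _)))

  *-nonzeroʳ : ∀ {x y} → x * y # 0# → y # 0#
  *-nonzeroʳ xy#0 = *-nonzeroˡ (nonzero-cong (*-comm _ _) xy#0)

  neg-nonzero : ∀ {x} → x # 0# → - x # 0#
  neg-nonzero {x} x#0 = ≉0⇒nonzero (λ -x≈0 → nonzero⇒≉0 x#0
    (trans (solve 1 (λ x → x := :- (:- x)) refl x) (trans (-‿cong -x≈0) -0#≈0#)))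

  ^-nonzero : ∀ {x} → x # 0# → ∀ n → x ^ n # 0#
  ^-nonzero x#0 zero    = 1-nonzero
  ^-nonzero x#0 (suc n) = *-nonzero x#0 (^-nonzero x#0 n)

-- Valuations and weak approximation.

module Places {c ℓ₁ ℓ₂ : Level} (em : ExcludedMiddle (c ⊔ ℓ₁ ⊔ ℓ₂)) (k : NumberField c ℓ₁ ℓ₂) where
  open import Data.List.Base using ([]; _∷_)
  open import Data.List.Relation.Unary.All using ([]; _∷_)
  open NumberField k hiding (zero)
  open IntegerSolver commutativeRing
  open Field em k
  module ℤ+ = Algebra.Properties.AbelianGroup ℤ.+-0-abelianGroup

  Place : Set (c ⊔ ℓ₁ ⊔ ℓ₂)
  Place = FinitePlace k

  -- Vacuous at 0#, whose valuation should be +∞.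
  AtLeast : Place → ℤ → Carrier → Set ℓ₂
  AtLeast v n x = x # 0# → n ℤ.≤ ord v x

  module _ (v : Place) where

    ord-1 : ord v 1# ≡ 0ℤ
    ord-1 = ≡.sym (ℤ+.∙-cancelˡ (ord v 1#) _ _ (≡.trans (ℤ.+-identityʳ _)
      (≡.trans (ord-cong v 1-nonzero (sym (*-identityˡ 1#))) (ord-* v 1-nonzero 1-nonzero))))

    ord-⁻¹ : ∀ {x} → x # 0# → ord v (x ⁻¹) ≡ ℤ.- ord v x
    ord-⁻¹ {x} x#0 = ℤ+.∙-cancelˡ (ord v x) _ _ (≡.trans (≡.sym (ord-* v x#0 (⁻¹-nonzero x#0)))
      (≡.trans (ord-cong v (*-nonzero x#0 (⁻¹-nonzero x#0)) (*-inverseʳ x#0))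
        (≡.trans ord-1 (≡.sym (ℤ.+-inverseʳ (ord v x))))))

    i+i≡0⇒i≡0 : ∀ i → i ℤ.+ i ≡ 0ℤ → i ≡ 0ℤ
    i+i≡0⇒i≡0 (+ zero) _ = ≡.refl

    -- The square of -1 is 1, and ℤ has no 2-torsion.
    ord-neg1 : ord v (- 1#) ≡ 0ℤ
    ord-neg1 = i+i≡0⇒i≡0 _ (≡.trans (≡.sym (ord-* v -1#0 -1#0))
      (≡.trans (ord-cong v (*-nonzero -1#0 -1#0)
        (solve 0 ((:- con 1ℤ) :* (:- con 1ℤ) := con 1ℤ) refl)) ord-1))
      where
      -1#0 : - 1# # 0#
      -1#0 = neg-nonzero 1-nonzero

    ord-neg : ∀ {x} → x # 0# → ord v (- x) ≡ ord v x
    ord-neg {x} x#0 = ≡.trans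
      (ord-cong v (neg-nonzero x#0) (solve 1 (λ x → :- x := (:- con 1ℤ) :* x) refl x))
      (≡.trans (ord-* v (neg-nonzero 1-nonzero) x#0)
        (≡.trans (≡.cong (ℤ._+ ord v x) ord-neg1) (ℤ.+-identityˡ _)))

    ord-^ : ∀ {x} → x # 0# → ∀ n → ord v (x ^ n) ≡ + n ℤ.* ord v x
    ord-^ x#0 zero = ord-1
    ord-^ {x} x#0 (suc n) = ≡.trans (ord-* v x#0 (^-nonzero x#0 n))
      (≡.trans (≡.cong (λ i → ord v x ℤ.+ i) (ord-^ x#0 n)) (≡.sym (ℤ.suc-* (+ n) (ord v x))))

    AtLeast-cong : ∀ {n x y} → x ≈ y → AtLeast v n x → AtLeast v n y
    AtLeast-cong x≈y x≥n y#0 =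
      ≡.subst (_ ℤ.≤_) (ord-cong v (nonzero-cong (sym x≈y) y#0) x≈y) (x≥n (nonzero-cong (sym x≈y) y#0))

    AtLeast-≤ : ∀ {m n x} → m ℤ.≤ n → AtLeast v n x → AtLeast v m x
    AtLeast-≤ m≤n x≥n x#0 = ℤ.≤-trans m≤n (x≥n x#0)

    AtLeast-0 : ∀ {n} → AtLeast v n 0#
    AtLeast-0 0#0 = contradiction refl (nonzero⇒≉0 0#0)

    AtLeast-1 : AtLeast v 0ℤ 1#
    AtLeast-1 _ = ℤ.≤-reflexive (≡.sym ord-1)

    AtLeast-neg : ∀ {n x} → AtLeast v n x → AtLeast v n (- x)
    AtLeast-neg {x = x} x≥n -x#0 = ≡.subst (_ ℤ.≤_) (≡.sym (ord-neg x#0)) (x≥n x#0)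
      where
      x#0 : x # 0#
      x#0 = nonzero-cong (solve 1 (λ x → :- (:- x) := x) refl x) (neg-nonzero -x#0)

    AtLeast-+ : ∀ {n x y} → AtLeast v n x → AtLeast v n y → AtLeast v n (x + y)
    AtLeast-+ {n} {x} {y} x≥n y≥n x+y#0 with zero-or-nonzero x | zero-or-nonzero y
    ... | inj₁ x≈0 | _ = AtLeast-cong (sym (trans (+-congʳ x≈0) (+-identityˡ y))) y≥n x+y#0
    ... | inj₂ _   | inj₁ y≈0 = AtLeast-cong (sym (trans (+-congˡ y≈0) (+-identityʳ x))) x≥n x+y#0
    ... | inj₂ x#0 | inj₂ y#0 = ℤ.≤-trans (ℤ.⊓-glb (x≥n x#0) (y≥n y#0)) (ord-+ v x#0 y#0 x+y#0)

    AtLeast-* : ∀ {m n x y} → AtLeast v m x → AtLeast v n y → AtLeast v (m ℤ.+ n) (x * y)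
    AtLeast-* x≥m y≥n xy#0 = ≡.subst (_ ℤ.≤_) (≡.sym (ord-* v (*-nonzeroˡ xy#0) (*-nonzeroʳ xy#0)))
      (ℤ.+-mono-≤ (x≥m (*-nonzeroˡ xy#0)) (y≥n (*-nonzeroʳ xy#0)))

    AtLeast-^ : ∀ {x} → AtLeast v 0ℤ x → ∀ n → AtLeast v 0ℤ (x ^ n)
    AtLeast-^ x≥0 zero    = AtLeast-1
    AtLeast-^ x≥0 (suc n) = AtLeast-* x≥0 (AtLeast-^ x≥0 n)

    AtLeast-sum : ∀ {n m} (x : Vector Carrier m) → (∀ i → AtLeast v n (x i)) → AtLeast v n (sum x)
    AtLeast-sum {m = zero}  x x≥n = AtLeast-0
    AtLeast-sum {m = suc m} x x≥n = AtLeast-+ (x≥n zero) (AtLeast-sum (x ∘ suc) (x≥n ∘ suc))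

    ord-≥ : ∀ {n x} → x # 0# → n ℤ.≤ ord v x → AtLeast v n x
    ord-≥ x#0 n≤ _ = n≤

    -- If the sum were zero or had larger order than `x`, then `x = (x + y) - y` would have order
    -- above `ord v x`.
    ord-dominant : ∀ {x y} → x # 0# → AtLeast v (ℤ.suc (ord v x)) y →
                   x + y # 0# × ord v (x + y) ≡ ord v x
    ord-dominant {x} {y} x#0 y> = x+y#0 , ℤ.≤-antisym upper lower′
      where
      too-small : ¬ AtLeast v (ℤ.suc (ord v x)) x
      too-small p = ℤ.<-irrefl ≡.refl (ℤ.<-≤-trans (ℤ.suc[i]≤j⇒i<j ℤ.≤-refl) (p x#0))
      x≈ : (x + y) - y ≈ x
      x≈ = solve 2 (λ x y → (x :+ y) :- y := x) refl x y
      x+y#0 : x + y # 0#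
      x+y#0 = ≉0⇒nonzero (λ x+y≈0 → too-small (AtLeast-cong x≈
        (AtLeast-+ (AtLeast-cong (sym x+y≈0) AtLeast-0) (AtLeast-neg y>))))
      upper : ord v (x + y) ℤ.≤ ord v x
      upper = ℤ.≮⇒≥ λ lt → too-small (AtLeast-cong x≈
        (AtLeast-+ (ord-≥ x+y#0 (ℤ.i<j⇒suc[i]≤j lt)) (AtLeast-neg y>)))
      lower′ : ord v x ℤ.≤ ord v (x + y)
      lower′ = AtLeast-+ (ord-≥ x#0 ℤ.≤-refl) (AtLeast-≤ (ℤ.<⇒≤ (ℤ.suc[i]≤j⇒i<j ℤ.≤-refl)) y>) x+y#0

  infix 4 _≈ₚ_
  _≈ₚ_ : Place → Place → Set (c ⊔ ℓ₂)
  _≈ₚ_ = _∼_ k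

  0≤i∧i*j≡1⇒i≡1 : ∀ i j → 0ℤ ℤ.≤ i → j ℤ.* i ≡ 1ℤ → i ≡ 1ℤ
  0≤i∧i*j≡1⇒i≡1 (+ m) j _ eq = ≡.cong +_ (ℕ.m*n≡1⇒n≡1 ℤ.∣ j ∣ m
    (≡.trans (≡.sym (ℤ.abs-* j (+ m))) (≡.cong ℤ.∣_∣ eq)))

  -- Comparing at a uniformizer π of v gives ord w = ord w π · ord v, and
  -- normalization of w forces ord w π = 1.
  same-integers⇒∼ : ∀ v w → (∀ x → x # 0# → 0ℤ ℤ.≤ ord v x → 0ℤ ℤ.≤ ord w x) → v ≈ₚ w
  same-integers⇒∼ v w v⇒w x x#0 = ≡.sym
    (≡.trans (proportional x x#0) (≡.trans (≡.cong (ord v x ℤ.*_) wπ≡1) (ℤ.*-identityʳ _)))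
    where
    π : Carrier
    π = proj₁ (normalized v)
    π#0 : π # 0#
    π#0 = proj₁ (proj₂ (normalized v))
    vπ≡1 : ord v π ≡ 1ℤ
    vπ≡1 = proj₂ (proj₂ (normalized v))

    unit : ∀ x → x # 0# → ord v x ≡ 0ℤ → ord w x ≡ 0ℤ
    unit x x#0 vx≡0 = ℤ.≤-antisym
      (≡.subst (ℤ._≤ 0ℤ) (ℤ.neg-involutive _) (ℤ.neg-mono-≤
        (≡.subst (0ℤ ℤ.≤_) (ord-⁻¹ w x#0) (v⇒w (x ⁻¹) (⁻¹-nonzero x#0)
          (ℤ.≤-reflexive (≡.sym (≡.trans (ord-⁻¹ v x#0) (≡.cong ℤ.-_ vx≡0))))))))
      (v⇒w x x#0 (ℤ.≤-reflexive (≡.sym vx≡0)))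

    -- The quotient of `x` by `π ^ n` is a unit at `v`, hence also at `w`.
    nonNeg : ∀ x → x # 0# → ∀ n → ord v x ≡ + n → ord w x ≡ + n ℤ.* ord w π
    nonNeg x x#0 n vx≡n = ℤ.i-j≡0⇒i≡j _ _ (≡.trans (≡.sym (ord-quotient w)) (unit _ y#0
      (≡.trans (ord-quotient v) (ℤ.i≡j⇒i-j≡0 (≡.trans vx≡n
        (≡.sym (≡.trans (≡.cong (+ n ℤ.*_) vπ≡1) (ℤ.*-identityʳ _))))))))
      where
      πⁿ#0 : π ^ n # 0#
      πⁿ#0 = ^-nonzero π#0 n
      y#0 : x * (π ^ n) ⁻¹ # 0#
      y#0 = *-nonzero x#0 (⁻¹-nonzero πⁿ#0)
      ord-quotient : ∀ u → ord u (x * (π ^ n) ⁻¹) ≡ ord u x ℤ.- + n ℤ.* ord u π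
      ord-quotient u = ≡.trans (ord-* u x#0 (⁻¹-nonzero πⁿ#0))
        (≡.cong (λ i → ord u x ℤ.+ i) (≡.trans (ord-⁻¹ u πⁿ#0) (≡.cong ℤ.-_ (ord-^ u π#0 n))))

    proportional : ∀ x → x # 0# → ord w x ≡ ord v x ℤ.* ord w π
    proportional x x#0 with ord v x in eq
    ... | + n      = nonNeg x x#0 n eq
    ... | -[1+ n ] = ℤ.neg-injective (≡.trans (≡.sym (ord-⁻¹ w x#0))
      (≡.trans (nonNeg (x ⁻¹) (⁻¹-nonzero x#0) (suc n) (≡.trans (ord-⁻¹ v x#0) (≡.cong ℤ.-_ eq)))
        (≡.sym (ℤ.neg-distribˡ-* -[1+ n ] (ord w π)))))

    wπ≡1 : ord w π ≡ 1ℤ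
    wπ≡1 = let (ρ , ρ#0 , wρ≡1) = normalized w in
      0≤i∧i*j≡1⇒i≡1 (ord w π) (ord v ρ)
        (v⇒w π π#0 (≡.subst (0ℤ ℤ.≤_) (≡.sym vπ≡1) (+≤+ ℕ.z≤n)))
        (≡.trans (≡.sym (proportional ρ ρ#0)) wρ≡1)

  ≉-sym : ∀ {v w} → ¬ v ≈ₚ w → ¬ w ≈ₚ v
  ≉-sym v≁w w∼v = v≁w (λ x x#0 → ≡.sym (w∼v x x#0))

  ∃-integral-at-one : ∀ v w → ¬ v ≈ₚ w → ∃[ x ] x # 0# × 0ℤ ℤ.≤ ord v x × ord w x ℤ.< 0ℤ
  ∃-integral-at-one v w v≁w
    with em {Lift ℓ₁ (∃[ x ] x # 0# × 0ℤ ℤ.≤ ord v x × ord w x ℤ.< 0ℤ)}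
  ... | yes (lift p) = p
  ... | no ¬p = contradiction (same-integers⇒∼ v w λ x x#0 vx≥0 → ℤ.≮⇒≥ λ wx<0 →
                  ¬p (lift (x , x#0 , vx≥0 , wx<0))) v≁w

  -- An element `y` integral at `v` with a pole at `w`, and an element `z` with the roles exchanged,
  -- give the quotient `z / y`, in which the two inequalities reinforce each other at both places.
  separate : ∀ v w → ¬ v ≈ₚ w → ∃[ x ] x # 0# × ord v x ℤ.< 0ℤ × 0ℤ ℤ.< ord w x
  separate v w v≁w =
    let (y , y#0 , vy≥0 , wy<0) = ∃-integral-at-one v w v≁w
        (z , z#0 , wz≥0 , vz<0) = ∃-integral-at-one w v (≉-sym {v} {w} v≁w)
        ord-z/y : ∀ u → ord u (z * y ⁻¹) ≡ ord u z ℤ.- ord u y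
        ord-z/y u = ≡.trans (ord-* u z#0 (⁻¹-nonzero y#0)) (≡.cong (λ i → ord u z ℤ.+ i) (ord-⁻¹ u y#0))
    in z * y ⁻¹ , *-nonzero z#0 (⁻¹-nonzero y#0)
     , ≡.subst (ℤ._< 0ℤ) (≡.sym (ord-z/y v)) (ℤ.+-mono-<-≤ vz<0 (ℤ.neg-mono-≤ vy≥0))
     , ≡.subst (0ℤ ℤ.<_) (≡.sym (ord-z/y w)) (ℤ.+-mono-≤-< wz≥0 (ℤ.neg-mono-< wy<0))

  0≤∣i∣+i : ∀ i → 0ℤ ℤ.≤ + ℤ.∣ i ∣ ℤ.+ i
  0≤∣i∣+i (+ n)    = +≤+ ℕ.z≤n
  0≤∣i∣+i -[1+ n ] = ℤ.≤-reflexive (≡.sym (ℤ.+-inverseʳ (+ suc n)))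

  -- The exponent for `approximate`: the `r`-th power of an element of order at least 1 on `L`
  -- outweighs all the poles of `x` there. Summing 1 plus the absolute value of each order gives one
  -- `r` for the whole list.
  pole-bound : ∀ (L : List Place) x → ∃[ r ] All (λ u → 0ℤ ℤ.< + r ℤ.+ ord u x) L
  pole-bound [] x = 0 , []
  pole-bound (u ∷ L) x with pole-bound L x
  ... | r , r>0 = suc ℤ.∣ ord u x ∣ ℕ.+ r
      , ℤ.<-≤-trans (+<+ (ℕ.s≤s ℕ.z≤n)) (≡.subst (1ℤ ℤ.≤_) (shuffle r (ord u x))
          (ℤ.+-mono-≤ (+≤+ (ℕ.s≤s (ℕ.z≤n {r}))) (0≤∣i∣+i (ord u x))))
      ∷ All.map (λ {w} 0<r+w → ℤ.<-≤-trans 0<r+w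
          (ℤ.+-monoˡ-≤ (ord w x) (+≤+ (ℕ.m≤n+m r (suc ℤ.∣ ord u x ∣))))) r>0
    where
    shuffle : ∀ r i → + suc r ℤ.+ (+ ℤ.∣ i ∣ ℤ.+ i) ≡ + (suc ℤ.∣ i ∣ ℕ.+ r) ℤ.+ i
    shuffle r i = ≡.trans (≡.sym (ℤ.+-assoc (+ suc r) (+ ℤ.∣ i ∣) i))
      (≡.cong (λ n → + suc n ℤ.+ i) (ℕ.+-comm r ℤ.∣ i ∣))

  n*nonPos≤0 : ∀ (n : ℕ) {i} → i ℤ.≤ 0ℤ → + n ℤ.* i ℤ.≤ 0ℤ
  n*nonPos≤0 n i≤0 = ≡.subst (+ n ℤ.* _ ℤ.≤_) (ℤ.*-zeroʳ (+ n)) (ℤ.*-monoˡ-≤-nonNeg (+ n) i≤0)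

  -- A single element having a pole at v and zeros at all the places in L. In the step, an
  -- element t for L is multiplied by an element s for w, after raising t (replaced by
  -- t / (1 + t) when it has a pole at w) to a power that beats the poles of s.
  approximate : ∀ v (L : List Place) → All (λ w → ¬ v ≈ₚ w) L →
                ∃[ t ] t # 0# × ord v t ℤ.< 0ℤ × All (λ w → 0ℤ ℤ.< ord w t) L
  approximate v [] [] =
    let (π , π#0 , vπ≡1) = normalized v in
    π ⁻¹ , ⁻¹-nonzero π#0 , ≡.subst (ℤ._< 0ℤ) (≡.sym (≡.trans (ord-⁻¹ v π#0) (≡.cong ℤ.-_ vπ≡1))) -<+ , []
  approximate v (w ∷ L) (v≁w ∷ v≁L)
    with approximate v L v≁L | separate v w v≁w
  ... | t , t#0 , vt<0 , Lt>0 | s , s#0 , vs<0 , ws>0 = combine choose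
    where
    Tamed : Carrier → Set (c ⊔ ℓ₁ ⊔ ℓ₂)
    Tamed t′ = t′ # 0# × ord v t′ ℤ.≤ 0ℤ × 0ℤ ℤ.≤ ord w t′ × All (λ u → 0ℤ ℤ.< ord u t′) L

    choose : ∃ Tamed
    choose with 0ℤ ℤ.≤? ord w t
    ... | yes wt≥0 = t , t#0 , ℤ.<⇒≤ vt<0 , wt≥0 , Lt>0
    -- At a pole of `t`, numerator and denominator have the same order; at a zero of `t`, the
    -- denominator is a unit. The pole at `v` is lost as well, but `s` will supply one.
    ... | no wt≱0 = t * (t + 1#) ⁻¹ , *-nonzero t#0 (⁻¹-nonzero t+1#0)
        , ℤ.≤-reflexive (at-pole v vt<0)
        , ℤ.≤-reflexive (≡.sym (at-pole w (ℤ.≰⇒> wt≱0)))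
        , All.map (λ {u} ut>0 → ≡.subst (0ℤ ℤ.<_) (≡.sym (at-zero u ut>0)) ut>0) Lt>0
      where
      t+1#0 : t + 1# # 0#
      t+1#0 = proj₁ (ord-dominant v t#0 (λ _ → ≡.subst (ℤ.suc (ord v t) ℤ.≤_) (≡.sym (ord-1 v)) (ℤ.i<j⇒suc[i]≤j vt<0)))
      ord-t/t+1 : ∀ u → ord u (t * (t + 1#) ⁻¹) ≡ ord u t ℤ.- ord u (t + 1#)
      ord-t/t+1 u = ≡.trans (ord-* u t#0 (⁻¹-nonzero t+1#0)) (≡.cong (λ i → ord u t ℤ.+ i) (ord-⁻¹ u t+1#0))
      at-pole : ∀ u → ord u t ℤ.< 0ℤ → ord u (t * (t + 1#) ⁻¹) ≡ 0ℤ
      at-pole u ut<0 = ≡.trans (ord-t/t+1 u) (ℤ.i≡j⇒i-j≡0 (≡.sym (proj₂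
        (ord-dominant u t#0 (λ _ → ≡.subst (ℤ.suc (ord u t) ℤ.≤_) (≡.sym (ord-1 u)) (ℤ.i<j⇒suc[i]≤j ut<0))))))
      at-zero : ∀ u → 0ℤ ℤ.< ord u t → ord u (t * (t + 1#) ⁻¹) ≡ ord u t
      at-zero u ut>0 = ≡.trans (ord-t/t+1 u) (≡.trans (≡.cong (λ i → ord u t ℤ.- i)
        (≡.trans (ord-cong u t+1#0 (+-comm t 1#)) (≡.trans (proj₂ (ord-dominant u 1-nonzero
          (λ _ → ≡.subst (λ i → ℤ.suc i ℤ.≤ ord u t) (≡.sym (ord-1 u)) (ℤ.i<j⇒suc[i]≤j ut>0)))) (ord-1 u))))
        (ℤ.+-identityʳ _))

    combine : ∃ Tamed → ∃[ t ] t # 0# × ord v t ℤ.< 0ℤ × All (λ u → 0ℤ ℤ.< ord u t) (w ∷ L)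
    combine (t′ , t′#0 , vt′≤0 , wt′≥0 , Lt′>0) with pole-bound L s
    ... | r , r+Ls>0 = t′ ^ r * s , *-nonzero (^-nonzero t′#0 r) s#0
        , ≡.subst (ℤ._< 0ℤ) (≡.sym (ord-product v)) (ℤ.+-mono-≤-< (n*nonPos≤0 r vt′≤0) vs<0)
        , ≡.subst (0ℤ ℤ.<_) (≡.sym (ord-product w)) (ℤ.+-mono-≤-<
            (≡.subst (ℤ._≤ + r ℤ.* ord w t′) (ℤ.*-zeroʳ (+ r)) (ℤ.*-monoˡ-≤-nonNeg (+ r) wt′≥0)) ws>0)
        ∷ All.zipWith (λ { {u} (ut′>0 , r+us>0) → ≡.subst (0ℤ ℤ.<_) (≡.sym (ord-product u))
            (ℤ.<-≤-trans r+us>0 (ℤ.+-monoˡ-≤ (ord u s)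
              (≡.subst (ℤ._≤ + r ℤ.* ord u t′) (ℤ.*-identityʳ (+ r))
                (ℤ.*-monoˡ-≤-nonNeg (+ r) (ℤ.i<j⇒suc[i]≤j ut′>0))))) }) (Lt′>0 , r+Ls>0)
      where
      ord-product : ∀ u → ord u (t′ ^ r * s) ≡ + r ℤ.* ord u t′ ℤ.+ ord u s
      ord-product u = ≡.trans (ord-* u (^-nonzero t′#0 r) s#0) (≡.cong (ℤ._+ ord u s) (ord-^ u t′#0 r))

-- Denominators and linear dependence over the rationals.

fromℤ-suc : ∀ n → ℚ.fromℤ (+ suc n) ≡ 1ℚ ℚ.+ ℚ.fromℤ (+ n)
fromℤ-suc n = ℚ.toℚᵘ-injective (ℚᵘ.≃-trans (ℚᵘ.*≡* (≡.cong (ℤ._* 1ℤ) eq))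
  (ℚᵘ.≃-sym (ℚ.toℚᵘ-homo-+ 1ℚ (ℚ.fromℤ (+ n)))))
  where
  eq : + suc n ≡ 1ℤ ℤ.* 1ℤ ℤ.+ + n ℤ.* 1ℤ
  eq = ≡.cong (λ i → 1ℤ ℤ.+ i) (≡.sym (ℤ.*-identityʳ (+ n)))

*-denominator : ∀ q → q ℚ.* ℚ.fromℤ (+ ↧ₙ q) ≡ ℚ.fromℤ (↥ q)
*-denominator q@(mkℚ n d-1 _) = ℚ.toℚᵘ-injective
  (ℚᵘ.≃-trans (ℚ.toℚᵘ-homo-* q (ℚ.fromℤ (+ suc d-1)))
    (ℚᵘ.*≡* (≡.trans (ℤ.*-identityʳ _) (≡.cong (λ d → n ℤ.* (+ suc d)) (≡.sym (ℕ.*-identityʳ d-1))))))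

module RationalDependence {c ℓ₁ ℓ₂ : Level} (em : ExcludedMiddle (c ⊔ ℓ₁ ⊔ ℓ₂)) (k : NumberField c ℓ₁ ℓ₂) where
  open NumberField k hiding (zero)
  open IntegerSolver commutativeRing
  open Field em k
  open Places em k
  open RingMorphisms ℚ.+-*-rawRing rawRing using (module IsRingHomomorphism)
  open IsRingHomomorphism ι-homomorphism using ()
    renaming (+-homo to ι-+; *-homo to ι-*; -‿homo to ι-neg; 0#-homo to ι-0; 1#-homo to ι-1)
  open Algebra.Properties.Semiring.Sum semiring
    using (sum-cong-≋; sum-remove; ∑-distrib-+; *-distribˡ-sum; *-distribʳ-sum; sum-replicate-zero)

  ι-nonzero : ∀ {q} → q ≢ 0ℚ → ι q # 0#
  ι-nonzero {q} q≢0 = invertible⇒nonzero (trans (sym (ι-* q (ℚ.1/ q)))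
    (trans (reflexive (≡.cong ι (ℚ.*-inverseʳ q))) ι-1))
    where
    instance
      q-nonZero : ℚ.NonZero q
      q-nonZero = ℚ.≢-nonZero q≢0

  ι-fromℕ : ∀ n → ι (ℚ.fromℤ (+ n)) ≈ ofℤ (+ n)
  ι-fromℕ zero    = ι-0
  ι-fromℕ (suc n) = trans (reflexive (≡.cong ι (fromℤ-suc n)))
    (trans (ι-+ _ _) (trans (+-cong ι-1 (ι-fromℕ n)) (sym (ofℤ-+ 1ℤ (+ n)))))

  ι-fromℤ : ∀ z → ι (ℚ.fromℤ z) ≈ ofℤ z
  ι-fromℤ (+ n)    = ι-fromℕ n
  ι-fromℤ -[1+ n ] = trans (ι-neg (ℚ.fromℤ (+ suc n))) (-‿cong (ι-fromℕ (suc n)))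

  ofℤ-nonzero : ∀ {z} → z ≢ 0ℤ → ofℤ z # 0#
  ofℤ-nonzero {z} z≢0 = nonzero-cong (ι-fromℤ z) (ι-nonzero (z≢0 ∘ ≡.cong ↥_))

  ι-*-denominator : ∀ q → ι q * ofℤ (+ ↧ₙ q) ≈ ofℤ (↥ q)
  ι-*-denominator q = begin
    ι q * ofℤ (+ ↧ₙ q)              ≈⟨ *-congˡ (ι-fromℤ (+ ↧ₙ q)) ⟨
    ι q * ι (ℚ.fromℤ (+ ↧ₙ q))      ≈⟨ ι-* _ _ ⟨
    ι (q ℚ.* ℚ.fromℤ (+ ↧ₙ q))      ≡⟨ ≡.cong ι (*-denominator q) ⟩
    ι (ℚ.fromℤ (↥ q))               ≈⟨ ι-fromℤ (↥ q) ⟩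
    ofℤ (↥ q)                       ∎
    where open Relation.Binary.Reasoning.Setoid setoid

  denominator-nonzero : ∀ q → ofℤ (+ ↧ₙ q) # 0#
  denominator-nonzero (mkℚ _ d-1 _) = ofℤ-nonzero {+ suc d-1} λ ()

  InSpan : ∀ {d} → Vector Carrier d → Carrier → Set ℓ₁
  InSpan {d} e x = Σ[ q ∈ Vector ℚ d ] x ≈ sum (λ i → ι (q i) * e i)

  Dependent : ∀ {m} → Vector Carrier m → Set (ℓ₁ ⊔ ℓ₂)
  Dependent {m} x = Σ[ r ∈ Vector ℚ m ] (∃[ i ] ι (r i) # 0#) × sum (λ i → ι (r i) * x i) ≈ 0#

  private
    all-zero? : ∀ {m} (q : Vector ℚ m) → (∀ i → q i ≡ 0ℚ) ⊎ (∃[ i ] q i ≢ 0ℚ)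
    all-zero? q with Fin.all? (λ i → q i ℚ.≟ 0ℚ)
    ... | yes q≡0 = inj₁ q≡0
    ... | no ¬q≡0 = inj₂ (Fin.¬∀⟶∃¬ _ _ (λ i → q i ℚ.≟ 0ℚ) ¬q≡0)

  eliminate : ∀ {d} (e : Vector Carrier (suc d)) {x y} ((q , _) : InSpan e x) ((p , _) : InSpan e y) →
              ∀ a → head p ≡ a ℚ.* head q → InSpan (tail e) (y + - (ι a * x))
  eliminate e {x} {y} (q , x≈) (p , y≈) a p₀≡aq₀ = (λ i → tail p i ℚ.+ ℚ.- (a ℚ.* tail q i)) , (begin
    y + - (ι a * x)                                  ≈⟨ +-cong y≈ (-‿cong (*-congˡ x≈)) ⟩
    (ι (head p) * e₀ + ∑p) + - (ι a * (ι (head q) * e₀ + ∑q))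
                                                     ≈⟨ +-congʳ (+-congʳ (*-congʳ (trans (reflexive (≡.cong ι p₀≡aq₀)) (ι-* _ _)))) ⟩
    ((ι a * ι (head q)) * e₀ + ∑p) + - (ι a * (ι (head q) * e₀ + ∑q))
      ≈⟨ solve 5 (λ a q e s t → ((a :* q) :* e :+ s) :+ (:- (a :* (q :* e :+ t))) := s :+ (:- a) :* t)
           refl (ι a) (ι (head q)) e₀ ∑p ∑q ⟩
    ∑p + - ι a * ∑q                                   ≈⟨ +-congˡ (*-distribˡ-sum (- ι a) (λ i → ι (tail q i) * tail e i)) ⟩
    ∑p + sum (λ i → - ι a * (ι (tail q i) * tail e i)) ≈⟨ ∑-distrib-+ (λ i → ι (tail p i) * tail e i) (λ i → - ι a * (ι (tail q i) * tail e i)) ⟨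
    sum (λ i → ι (tail p i) * tail e i + - ι a * (ι (tail q i) * tail e i)) ≈⟨ sum-cong-≋ term ⟩
    sum (λ i → ι (tail p i ℚ.+ ℚ.- (a ℚ.* tail q i)) * tail e i) ∎)
    where
    open Relation.Binary.Reasoning.Setoid setoid
    e₀ ∑p ∑q : Carrier
    e₀ = head e
    ∑p = sum (λ i → ι (tail p i) * tail e i)
    ∑q = sum (λ i → ι (tail q i) * tail e i)
    term : ∀ i → ι (tail p i) * tail e i + - ι a * (ι (tail q i) * tail e i)
               ≈ ι (tail p i ℚ.+ ℚ.- (a ℚ.* tail q i)) * tail e i
    term i = begin
      ι (tail p i) * tail e i + - ι a * (ι (tail q i) * tail e i)
        ≈⟨ solve 4 (λ p a q e → p :* e :+ (:- a) :* (q :* e) := (p :+ (:- (a :* q))) :* e) refl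
             (ι (tail p i)) (ι a) (ι (tail q i)) (tail e i) ⟩
      (ι (tail p i) + - (ι a * ι (tail q i))) * tail e i
        ≈⟨ *-congʳ (+-congˡ (-‿cong (ι-* a (tail q i)))) ⟨
      (ι (tail p i) + - ι (a ℚ.* tail q i)) * tail e i
        ≈⟨ *-congʳ (+-congˡ (ι-neg (a ℚ.* tail q i))) ⟨
      (ι (tail p i) + ι (ℚ.- (a ℚ.* tail q i))) * tail e i
        ≈⟨ *-congʳ (ι-+ (tail p i) (ℚ.- (a ℚ.* tail q i))) ⟨
      ι (tail p i ℚ.+ ℚ.- (a ℚ.* tail q i)) * tail e i ∎

  tail-span : ∀ {d} (e : Vector Carrier (suc d)) {x} ((q , _) : InSpan e x) → head q ≡ 0ℚ → InSpan (tail e) x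
  tail-span e (q , x≈) q₀≡0 = tail q , trans x≈ (trans (+-congʳ
    (trans (*-congʳ (trans (reflexive (≡.cong ι q₀≡0)) ι-0)) (zeroˡ (head e)))) (+-identityˡ _))

  -- Gaussian elimination on the coordinates with respect to `e`: a nonzero first coordinate serves
  -- as pivot, and otherwise the head of `e` is dropped. Looking for the pivot is constructive,
  -- since the coordinates are rational.
  dependent : ∀ {d m} (e : Vector Carrier d) (x : Vector Carrier m) → d ℕ.< m →
              (∀ i → InSpan e (x i)) → Dependent x
  dependent {zero} {suc m} e x _ x∈ = (λ _ → 1ℚ) , (zero , ι-nonzero λ ()) ,
    trans (sum-cong-≋ {suc m} (λ i → trans (*-congˡ (proj₂ (x∈ i))) (zeroʳ (ι 1ℚ)))) (sum-replicate-zero (suc m))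
  dependent {suc d} {suc m} e x (ℕ.s≤s d<m) x∈ with all-zero? (λ i → head (proj₁ (x∈ i)))
  ... | inj₁ all≡0 = dependent (tail e) x (ℕ.m<n⇒m<1+n d<m) (λ i → tail-span e (x∈ i) (all≡0 i))
  ... | inj₂ (i₀ , q₀≢0) = extend (dependent (tail e) x′ d<m x′∈)
    where
    open Relation.Binary.Reasoning.Setoid setoid
    q₀ : ℚ
    q₀ = head (proj₁ (x∈ i₀))
    instance
      q₀-nonZero : ℚ.NonZero q₀
      q₀-nonZero = ℚ.≢-nonZero q₀≢0
    a : Vector ℚ m
    a j = head (proj₁ (x∈ (punchIn i₀ j))) ℚ.* ℚ.1/ q₀
    x′ : Vector Carrier m
    x′ j = x (punchIn i₀ j) + - (ι (a j) * x i₀)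
    x′∈ : ∀ j → InSpan (tail e) (x′ j)
    x′∈ j = eliminate e (x∈ i₀) (x∈ (punchIn i₀ j)) (a j) (≡.sym (≡.trans (ℚ.*-assoc (head (proj₁ (x∈ (punchIn i₀ j)))) (ℚ.1/ q₀) q₀)
      (≡.trans (≡.cong (λ t → head (proj₁ (x∈ (punchIn i₀ j))) ℚ.* t) (ℚ.*-inverseˡ q₀)) (ℚ.*-identityʳ _))))
    ∑ℚ : ∀ {m} → Vector ℚ m → ℚ
    ∑ℚ {zero}  r = 0ℚ
    ∑ℚ {suc m} r = head r ℚ.+ ∑ℚ (tail r)
    ι-∑ : ∀ {m} (r : Vector ℚ m) → ι (∑ℚ r) ≈ sum (ι ∘ r)
    ι-∑ {zero}  r = ι-0
    ι-∑ {suc m} r = trans (ι-+ _ _) (+-congˡ (ι-∑ (tail r)))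
    extend : Dependent x′ → Dependent x
    extend (r′ , (j , r′j#0) , ∑≈0) = r , (punchIn i₀ j , nonzero-cong (reflexive (≡.cong ι (≡.sym (r-punchIn j)))) r′j#0) , (begin
      sum (λ i → ι (r i) * x i)                          ≈⟨ sum-remove {i = i₀} (λ i → ι (r i) * x i) ⟩
      ι (r i₀) * x i₀ + sum (λ j → ι (r (punchIn i₀ j)) * x (punchIn i₀ j))
        ≈⟨ +-cong (*-congʳ r-pivot) (sum-cong-≋ (λ j → *-congʳ (reflexive (≡.cong ι (r-punchIn j))))) ⟩
      sum (λ j → ι (ℚ.- (r′ j ℚ.* a j))) * x i₀ + sum (λ j → ι (r′ j) * x (punchIn i₀ j))
        ≈⟨ +-congʳ (*-distribʳ-sum (x i₀) (λ j → ι (ℚ.- (r′ j ℚ.* a j)))) ⟩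
      sum (λ j → ι (ℚ.- (r′ j ℚ.* a j)) * x i₀) + sum (λ j → ι (r′ j) * x (punchIn i₀ j))
        ≈⟨ ∑-distrib-+ (λ j → ι (ℚ.- (r′ j ℚ.* a j)) * x i₀) (λ j → ι (r′ j) * x (punchIn i₀ j)) ⟨
      sum (λ j → ι (ℚ.- (r′ j ℚ.* a j)) * x i₀ + ι (r′ j) * x (punchIn i₀ j))
        ≈⟨ sum-cong-≋ term ⟩
      sum (λ j → ι (r′ j) * x′ j)                        ≈⟨ ∑≈0 ⟩
      0#                                                 ∎)
      where
      -- Each `x′ j` contains `x i₀` with coefficient `- a j`; the coefficient at the pivot collects
      -- these contributions.
      s : ℚ
      s = ∑ℚ (λ j → ℚ.- (r′ j ℚ.* a j))
      r : Vector ℚ (suc m)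
      r = insertAt r′ i₀ s
      r-pivot : ι (r i₀) ≈ sum (λ j → ι (ℚ.- (r′ j ℚ.* a j)))
      r-pivot = trans (reflexive (≡.cong ι (insertAt-lookup r′ i₀ s))) (ι-∑ (λ j → ℚ.- (r′ j ℚ.* a j)))
      r-punchIn : ∀ j → r (punchIn i₀ j) ≡ r′ j
      r-punchIn = insertAt-punchIn r′ i₀ s
      term : ∀ j → ι (ℚ.- (r′ j ℚ.* a j)) * x i₀ + ι (r′ j) * x (punchIn i₀ j) ≈ ι (r′ j) * x′ j
      term j = trans (+-congʳ (*-congʳ (trans (ι-neg _) (-‿cong (ι-* _ _)))))
        (solve 4 (λ r a x y → (:- (r :* a)) :* x :+ r :* y := r :* (y :+ (:- (a :* x)))) refl
          (ι (r′ j)) (ι (a j)) (x i₀) (x (punchIn i₀ j)))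

-- Finitely many places above a prime, and integrality for large S.

module Support {c ℓ₁ ℓ₂ : Level} (em : ExcludedMiddle (c ⊔ ℓ₁ ⊔ ℓ₂)) (k : NumberField c ℓ₁ ℓ₂) where
  open import Data.List.Base using ([]; _∷_)
  open import Data.List.Relation.Unary.All using ([]; _∷_)
  open NumberField k hiding (zero)
  open IntegerSolver commutativeRing
  open Field em k
  open Places em k
  open RationalDependence em k
  open RingMorphisms ℚ.+-*-rawRing rawRing using (module IsRingHomomorphism)
  open IsRingHomomorphism ι-homomorphism using () renaming (*-homo to ι-*; 0#-homo to ι-0; 1#-homo to ι-1)
  open Algebra.Properties.Semiring.Sum semiring
    using (sum-cong-≋; sum-remove; *-distribˡ-sum)

  ofℕ-integral : ∀ v n → AtLeast v 0ℤ (ofℤ (+ n))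
  ofℕ-integral v zero    = AtLeast-0 v
  ofℕ-integral v (suc n) = AtLeast-cong v (sym (ofℤ-+ 1ℤ (+ n))) (AtLeast-+ v (AtLeast-1 v) (ofℕ-integral v n))

  ofℤ-integral : ∀ v z → AtLeast v 0ℤ (ofℤ z)
  ofℤ-integral v (+ n)    = ofℕ-integral v n
  ofℤ-integral v -[1+ n ] = AtLeast-neg v (ofℕ-integral v (suc n))

  infix 4 _above_
  _above_ : Place → ℕ → Set
  v above p = 0ℤ ℤ.< ord v (ofℤ (+ p))

  prime-nonzero : ∀ {p} → Prime p → ofℤ (+ p) # 0#
  prime-nonzero {p} pr = ofℤ-nonzero (ℕ.≢-nonZero⁻¹ p {{prime⇒nonZero pr}} ∘ ℤ.+-injective)

  multiple-positive : ∀ v {p} → v above p → ∀ {n} → p ℕ.∣ n → AtLeast v 1ℤ (ofℤ (+ n))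
  multiple-positive v {p} v∣p (ℕ.divides q ≡.refl) =
    AtLeast-cong v (trans (sym (ofℤ-* (+ q) (+ p))) (reflexive (≡.cong ofℤ (≡.sym (ℤ.pos-* q p)))))
      (AtLeast-* v (ofℤ-integral v (+ q)) (λ _ → ℤ.i<j⇒suc[i]≤j v∣p))

  not-1 : ∀ v {x} → AtLeast v 1ℤ x → ¬ x ≈ 1#
  not-1 v x≥1 x≈1 = ℤ.<-irrefl (≡.sym (ord-1 v))
    (ℤ.suc[i]≤j⇒i<j (AtLeast-cong v x≈1 x≥1 1-nonzero))

  -- Here `n` and `p` are coprime. By Bézout, if both had positive order at `v`, so would 1.
  not-multiple-unit : ∀ v {p} → Prime p → v above p → ∀ {n} → ¬ p ℕ.∣ n →
                      ¬ AtLeast v 1ℤ (ofℤ (+ n))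
  not-multiple-unit v {p} pr v∣p {n} p∤n n≥1 = contra (coprime-Bézout coprime)
    where
    coprime : ∀ {d} → d ℕ.∣ n × d ℕ.∣ p → d ≡ 1
    coprime (d∣n , d∣p) with prime⇒irreducible pr d∣p
    ... | inj₁ d≡1 = d≡1
    ... | inj₂ ≡.refl = contradiction d∣n p∤n
    times : ∀ q {m} → AtLeast v 1ℤ (ofℤ (+ m)) → AtLeast v 1ℤ (ofℤ (+ (q ℕ.* m)))
    times q {m} m≥1 = AtLeast-cong v (trans (sym (ofℤ-* (+ q) (+ m))) (reflexive (≡.cong ofℤ (≡.sym (ℤ.pos-* q m)))))
      (AtLeast-* v (ofℤ-integral v (+ q)) m≥1)
    difference : ∀ a b → 1 ℕ.+ a ≡ b → ofℤ (+ b) + - ofℤ (+ a) ≈ 1#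
    difference a b ≡.refl = trans (+-congʳ (ofℤ-+ 1ℤ (+ a)))
      (solve 1 (λ a → (con 1ℤ :+ a) :+ (:- a) := con 1ℤ) refl (ofℤ (+ a)))
    p≥1 : AtLeast v 1ℤ (ofℤ (+ p))
    p≥1 = multiple-positive v {p} v∣p ℕ.∣-refl
    contra : ¬ Bézout.Identity 1 n p
    contra (Bézout.+- x y eq) = not-1 v (AtLeast-+ v (times x n≥1) (AtLeast-neg v (times y {p} p≥1)))
      (difference (y ℕ.* p) (x ℕ.* n) eq)
    contra (Bézout.-+ x y eq) = not-1 v (AtLeast-+ v (times y {p} p≥1) (AtLeast-neg v (times x n≥1)))
      (difference (x ℕ.* n) (y ℕ.* p) eq)

  -- In lowest terms, integrality at a place above p only means that p does
  -- not divide the denominator.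
  rational-integral : ∀ {p} → Prime p → ∀ v w → v above p → w above p → ∀ q →
                      AtLeast v 0ℤ (ι q) → AtLeast w 0ℤ (ι q)
  rational-integral {p} pr v w v∣p w∣p q@(mkℚ n d-1 n⊥d) q≥0 with p ℕ.∣? suc d-1
  -- With `p` in the denominator, integrality at `v` would give the numerator positive order,
  -- although `p` does not divide it in lowest terms.
  ... | yes p∣d = contradiction (numerator≥1 n ≡.refl) (not-multiple-unit v pr v∣p p∤n)
    where
    p∤n : ¬ p ℕ.∣ ℤ.∣ n ∣
    p∤n p∣n = ¬prime[1] (≡.subst Prime (recompute n⊥d (p∣n , p∣d)) pr)
    n≥1 : AtLeast v 1ℤ (ofℤ n)
    n≥1 = AtLeast-cong v (ι-*-denominator q) (AtLeast-* v q≥0 (multiple-positive v {p} v∣p p∣d))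
    numerator≥1 : ∀ m → n ≡ m → AtLeast v 1ℤ (ofℤ (+ ℤ.∣ n ∣))
    numerator≥1 (+ m)    ≡.refl = n≥1
    numerator≥1 -[1+ m ] ≡.refl = AtLeast-cong v (solve 1 (λ x → :- (:- x) := x) refl _) (AtLeast-neg v n≥1)
  ... | no p∤d = λ q#0 → ℤ.≤-trans
    (≡.subst (0ℤ ℤ.≤_) (≡.trans (≡.sym (ord-cong w (*-nonzero q#0 (denominator-nonzero q)) (ι-*-denominator q)))
        (ord-* w q#0 (denominator-nonzero q)))
      (ofℤ-integral w n (nonzero-cong (ι-*-denominator q) (*-nonzero q#0 (denominator-nonzero q)))))
    (≡.subst (ord w (ι q) ℤ.+ ord w (ofℤ (+ suc d-1)) ℤ.≤_) (ℤ.+-identityʳ _) (ℤ.+-monoʳ-≤ (ord w (ι q)) d≤0))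
    where
    d≤0 : ord w (ofℤ (+ suc d-1)) ℤ.≤ 0ℤ
    d≤0 = ℤ.≮⇒≥ λ d>0 → not-multiple-unit w pr w∣p p∤d (λ _ → ℤ.i<j⇒suc[i]≤j d>0)

  any-nonzero? : ∀ {m} (x : Vector Carrier m) → (∃[ i ] x i # 0#) ⊎ (∀ i → x i ≈ 0#)
  any-nonzero? {zero} x = inj₂ λ ()
  any-nonzero? {suc m} x with zero-or-nonzero (head x) | any-nonzero? (tail x)
  ... | inj₂ x₀#0 | _ = inj₁ (zero , x₀#0)
  ... | inj₁ _    | inj₁ (i , xᵢ#0) = inj₁ (suc i , xᵢ#0)
  ... | inj₁ x₀≈0 | inj₂ x≈0 = inj₂ λ { zero → x₀≈0 ; (suc i) → x≈0 i }

  minimal-ord : ∀ v {m} (x : Vector Carrier m) → ∃[ i ] x i # 0# →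
                ∃[ i ] x i # 0# × ∀ j → AtLeast v (ord v (x i)) (x j)
  minimal-ord v {suc m} x (i , xᵢ#0) with any-nonzero? (tail x)
  ... | inj₂ x≈0 = zero , head#0 i xᵢ#0 , λ
      { zero _ → ℤ.≤-refl ; (suc j) xⱼ#0 → contradiction (x≈0 j) (nonzero⇒≉0 xⱼ#0) }
    where
    head#0 : ∀ i → x i # 0# → head x # 0#
    head#0 zero x#0 = x#0
    head#0 (suc i) x#0 = contradiction (x≈0 i) (nonzero⇒≉0 x#0)
  ... | inj₁ nonzero with minimal-ord v (tail x) nonzero
  ... | j , xⱼ#0 , xⱼ≤ with zero-or-nonzero (head x)
  ... | inj₁ x₀≈0 = suc j , xⱼ#0 , λ
      { zero x₀#0 → contradiction x₀≈0 (nonzero⇒≉0 x₀#0) ; (suc l) → xⱼ≤ l }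
  ... | inj₂ x₀#0 with ord v (head x) ℤ.≤? ord v (tail x j)
  ... | yes x₀≤xⱼ = zero , x₀#0 , λ
      { zero _ → ℤ.≤-refl ; (suc l) xₗ#0 → ℤ.≤-trans x₀≤xⱼ (xⱼ≤ l xₗ#0) }
  ... | no x₀≰xⱼ = suc j , xⱼ#0 , λ
      { zero _ → ℤ.<⇒≤ (ℤ.≰⇒> x₀≰xⱼ) ; (suc l) → xⱼ≤ l }

  -- The division is carried out in ℚ, so that the new coefficients are again images of rationals,
  -- as `rational-integral` and `rational-eventually-integral` require.
  normalize-at : ∀ {m} (r : Vector ℚ m) (x : Vector Carrier m) i → ι (r i) # 0# → sum (λ j → ι (r j) * x j) ≈ 0# →
                 Σ[ s ∈ Vector ℚ m ] (∀ j → ι (s j) ≈ ι (r j) * ι (r i) ⁻¹) × sum (λ j → ι (s j) * x j) ≈ 0# × ι (s i) ≈ 1#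
  normalize-at r x i rᵢ#0 ∑≈0 = s , s≈ , ∑s≈0 , trans (s≈ i) (*-inverseʳ rᵢ#0)
    where
    open Relation.Binary.Reasoning.Setoid setoid
    rᵢ≢0 : r i ≢ 0ℚ
    rᵢ≢0 eq = nonzero⇒≉0 rᵢ#0 (trans (reflexive (≡.cong ι eq)) ι-0)
    instance
      rᵢ-nonZero : ℚ.NonZero (r i)
      rᵢ-nonZero = ℚ.≢-nonZero rᵢ≢0
    s : Vector ℚ _
    s j = r j ℚ.* ℚ.1/ (r i)
    ι-1/ : ι (ℚ.1/ (r i)) ≈ ι (r i) ⁻¹
    ι-1/ = *-cancelˡ-nonzero rᵢ#0 (trans (sym (ι-* _ _))
      (trans (reflexive (≡.cong ι (ℚ.*-inverseʳ (r i)))) (trans ι-1 (sym (*-inverseʳ rᵢ#0)))))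
    s≈ : ∀ j → ι (s j) ≈ ι (r j) * ι (r i) ⁻¹
    s≈ j = trans (ι-* (r j) (ℚ.1/ (r i))) (*-congˡ ι-1/)
    ∑s≈0 : sum (λ j → ι (s j) * x j) ≈ 0#
    ∑s≈0 = begin
      sum (λ j → ι (s j) * x j)                    ≈⟨ sum-cong-≋ (λ j → trans (*-congʳ (s≈ j))
        (solve 3 (λ r t x → (r :* t) :* x := t :* (r :* x)) refl (ι (r j)) (ι (r i) ⁻¹) (x j))) ⟩
      sum (λ j → ι (r i) ⁻¹ * (ι (r j) * x j))     ≈⟨ *-distribˡ-sum (ι (r i) ⁻¹) (λ j → ι (r j) * x j) ⟨
      ι (r i) ⁻¹ * sum (λ j → ι (r j) * x j)       ≈⟨ trans (*-congˡ ∑≈0) (zeroʳ _) ⟩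
      0#                                           ∎

  -- The entry `x i` is minus the sum of the others.
  isolate : ∀ {m} (x : Vector Carrier m) i → sum x ≈ 0# → ∀ v {n} →
            (∀ j → j ≢ i → AtLeast v n (x j)) → AtLeast v n (x i)
  isolate {suc m} x i ∑≈0 v x≥n = AtLeast-cong v xᵢ≈ (AtLeast-neg v
    (AtLeast-sum v (removeAt x i) (λ j → x≥n (punchIn i j) (Fin.punchInᵢ≢i i j))))
    where
    xᵢ≈ : - sum (removeAt x i) ≈ x i
    xᵢ≈ = trans (solve 2 (λ a b → :- b := a :+ (:- (a :+ b))) refl (x i) (sum (removeAt x i)))
      (trans (+-congˡ (trans (-‿cong (trans (sym (sum-remove {i = i} x)) ∑≈0)) -0#≈0#)) (+-identityʳ (x i)))

  Distinct : ∀ {m} → Vector Place m → Set (c ⊔ ℓ₂)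
  Distinct v = ∀ i j → i ≢ j → ¬ v i ≈ₚ v j

  dimension : ℕ
  dimension = proj₁ finiteDim

  -- Elements t i with a pole at v i and zeros at the other places are linearly
  -- independent: in a relation, divided by a coefficient of least valuation
  -- at v i₀, a coefficient 1 would force a pole.
  places-above-bound : ∀ {p} → Prime p → ∀ {m} (v : Vector Place m) → Distinct v →
                       (∀ i → v i above p) → ¬ dimension ℕ.< m
  places-above-bound {p} pr {suc m} v distinct v∣p d<m =
    let (r , rᵢ#0 , ∑≈0) = dependent (proj₁ (proj₂ finiteDim)) t d<m (λ i → proj₂ (proj₂ finiteDim) (t i))
        (i , rᵢ#0 , rᵢ≤) = minimal-ord (v zero) (ι ∘ r) rᵢ#0
        (s , s≈ , ∑s≈0 , sᵢ≈1) = normalize-at r t i rᵢ#0 ∑≈0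
        s≥0 : ∀ j → AtLeast (v zero) 0ℤ (ι (s j))
        s≥0 j = AtLeast-cong (v zero) (sym (s≈ j)) (≡.subst (λ n → AtLeast (v zero) n (ι (r j) * ι (r i) ⁻¹)) (ℤ.+-inverseʳ (ord (v zero) (ι (r i))))
          (AtLeast-* (v zero) (rᵢ≤ j) (ord-≥ (v zero) (⁻¹-nonzero rᵢ#0) (ℤ.≤-reflexive (≡.sym (ord-⁻¹ (v zero) rᵢ#0))))))
        -- The coefficients are rational, so their integrality at the first place carries over to
        -- `v i`, which lies above the same prime.
        term≥0 : ∀ j → j ≢ i → AtLeast (v i) 0ℤ (ι (s j) * t j)
        term≥0 j j≢i = AtLeast-* (v i) (rational-integral pr (v zero) (v i) (v∣p zero) (v∣p i) (s j) (s≥0 j))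
          (λ _ → ℤ.<⇒≤ (zero-at j i j≢i))
        tᵢ≥0 : AtLeast (v i) 0ℤ (t i)
        tᵢ≥0 = AtLeast-cong (v i) (trans (*-congʳ sᵢ≈1) (*-identityˡ _)) (isolate (λ j → ι (s j) * t j) i ∑s≈0 (v i) term≥0)
    in contradiction (tᵢ≥0 (t-nonzero i)) (ℤ.<⇒≱ (pole-at i))
    where
    others : ∀ i → All (λ w → ¬ v i ≈ₚ w) (tabulate (removeAt v i))
    others i = All.tabulate⁺ λ j → distinct i (punchIn i j) (Fin.punchInᵢ≢i i j ∘ ≡.sym)
    element : ∀ i → ∃[ t ] t # 0# × ord (v i) t ℤ.< 0ℤ × All (λ w → 0ℤ ℤ.< ord w t) (tabulate (removeAt v i))
    element i = approximate (v i) (tabulate (removeAt v i)) (others i)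
    t : Vector Carrier (suc m)
    t i = proj₁ (element i)
    t-nonzero : ∀ i → t i # 0#
    t-nonzero i = proj₁ (proj₂ (element i))
    pole-at : ∀ i → ord (v i) (t i) ℤ.< 0ℤ
    pole-at i = proj₁ (proj₂ (proj₂ (element i)))
    zero-at : ∀ j i → j ≢ i → 0ℤ ℤ.< ord (v i) (t j)
    zero-at j i j≢i = ≡.subst (λ l → 0ℤ ℤ.< ord (v l) (t j)) (Fin.punchIn-punchOut j≢i)
      (All.tabulate⁻ (proj₂ (proj₂ (proj₂ (element j)))) (punchOut j≢i))

  Listed : Place → List Place → Set (c ⊔ ℓ₁ ⊔ ℓ₂)
  Listed v S = Any (v ≈ₚ_) S

  -- Inequivalent places are collected until none is left. The invariant of the search says that
  -- once the fuel is spent, more than `dimension` places have been found, which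
  -- `places-above-bound` excludes.
  places-above : ∀ {p} → Prime p → ∃[ S ] ∀ v → v above p → Listed v S
  places-above {p} pr = search (suc dimension) []ᵛ (λ ()) (λ ()) (ℕ.≤-reflexive (≡.sym (ℕ.+-identityʳ _)))
    where
    search : ∀ fuel {m} (v : Vector Place m) → Distinct v → (∀ i → v i above p) →
             suc dimension ℕ.≤ fuel ℕ.+ m → ∃[ S ] ∀ v → v above p → Listed v S
    search zero v distinct v∣p d<m = contradiction d<m (places-above-bound pr v distinct v∣p)
    search (suc fuel) {m} v distinct v∣p d<m
      with em {Lift ℓ₁ (∃[ w ] w above p × ∀ i → ¬ w ≈ₚ v i)}
    ... | yes (lift (w , w∣p , w≁v)) = search fuel (w ∷ᵛ v) distinct′ (λ { zero → w∣p ; (suc i) → v∣p i })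
            (≡.subst (suc dimension ℕ.≤_) (≡.sym (ℕ.+-suc fuel m)) d<m)
      where
      distinct′ : Distinct (w ∷ᵛ v)
      distinct′ zero    zero    i≢i = contradiction ≡.refl i≢i
      distinct′ zero    (suc j) _   = w≁v j
      distinct′ (suc i) zero    _   = ≉-sym {w} {v i} (w≁v i)
      distinct′ (suc i) (suc j) i≢j = distinct i j (i≢j ∘ ≡.cong suc)
    ... | no none = tabulate v , listed
      where
      listed : ∀ w → w above p → Listed w (tabulate v)
      listed w w∣p with em {Listed w (tabulate v)}
      ... | yes w∈ = w∈
      ... | no w∉ = contradiction (lift (w , w∣p , λ i w∼vᵢ → w∉ (Any.tabulate⁺ i w∼vᵢ))) none

  -- Conditions on S are imposed one after the other by enlarging S.
  Eventually : ∀ {a} → Pred (List Place) a → Set (c ⊔ ℓ₁ ⊔ ℓ₂ ⊔ a)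
  Eventually P = ∃[ S₀ ] ∀ S → S₀ ⊆ S → P S

  eventually-map : ∀ {a b} {P : Pred (List Place) a} {Q : Pred (List Place) b} →
                   (∀ S → P S → Q S) → Eventually P → Eventually Q
  eventually-map f (S₀ , p) = S₀ , λ S S₀⊆S → f S (p S S₀⊆S)

  eventually-× : ∀ {a b} {P : Pred (List Place) a} {Q : Pred (List Place) b} →
                 Eventually P → Eventually Q → Eventually (λ S → P S × Q S)
  eventually-× (S₀ , p) (S₁ , q) = S₀ ++ S₁ , λ S ⊆S →
    p S (⊆-trans (xs⊆xs++ys S₀ S₁) ⊆S) , q S (⊆-trans (xs⊆ys++xs S₁ S₀) ⊆S)

  eventually-∀ : ∀ {a m} {P : Fin m → Pred (List Place) a} →
                 (∀ i → Eventually (P i)) → Eventually (λ S → ∀ i → P i S)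
  eventually-∀ {m = zero} _ = [] , λ S _ ()
  eventually-∀ {m = suc m} p = eventually-map (λ { S (p₀ , ps) zero → p₀ ; S (p₀ , ps) (suc i) → ps i })
    (eventually-× (p zero) (eventually-∀ (p ∘ suc)))

  prime⁻¹-integral : ∀ {p} → Prime p → Eventually (λ S → ofℤ (+ p) ⁻¹ ∈ 𝒪 k S)
  prime⁻¹-integral {p} pr = let (S₀ , listed) = places-above pr in
    S₀ , λ S S₀⊆S v v∉S _ → ≡.subst (0ℤ ℤ.≤_) (≡.sym (ord-⁻¹ v (prime-nonzero pr)))
      (ℤ.neg-mono-≤ (ℤ.≮⇒≥ (λ v∣p → v∉S (Any-resp-⊆ S₀⊆S (listed v v∣p)))))

  𝒪-* : ∀ {S x y} → x ∈ 𝒪 k S → y ∈ 𝒪 k S → x * y ∈ 𝒪 k S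
  𝒪-* x∈ y∈ v v∉S = AtLeast-* v (x∈ v v∉S) (y∈ v v∉S)

  𝒪-cong : ∀ {S x y} → x ≈ y → x ∈ 𝒪 k S → y ∈ 𝒪 k S
  𝒪-cong x≈y x∈ v v∉S = AtLeast-cong v x≈y (x∈ v v∉S)

  product⁻¹-integral : ∀ ps → All Prime ps → Eventually (λ S → ∃[ y ] y ∈ 𝒪 k S × ofℤ (+ ℕ.product ps) * y ≈ 1#)
  product⁻¹-integral [] [] = [] , λ S _ → 1# , (λ v _ → AtLeast-1 v) , *-identityʳ 1#
  product⁻¹-integral (p ∷ ps) (pr ∷ prs) = eventually-map
    (λ { S (p⁻¹∈ , y , y∈ , eq) → ofℤ (+ p) ⁻¹ * y , 𝒪-* {S} p⁻¹∈ y∈ ,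
      trans (*-congʳ (trans (reflexive (≡.cong ofℤ (ℤ.pos-* p (ℕ.product ps)))) (ofℤ-* (+ p) (+ ℕ.product ps))))
        (trans (solve 4 (λ a b c d → (a :* b) :* (c :* d) := (a :* c) :* (b :* d)) refl (ofℤ (+ p)) (ofℤ (+ ℕ.product ps)) (ofℤ (+ p) ⁻¹) y)
          (trans (*-cong (*-inverseʳ (prime-nonzero pr)) eq) (*-identityʳ 1#))) })
    (eventually-× (prime⁻¹-integral pr) (product⁻¹-integral ps prs))

  -- The denominator is a product of primes, and the inverses of these are integral for large S.
  rational-eventually-integral : ∀ q → Eventually (λ S → ι q ∈ 𝒪 k S)
  rational-eventually-integral q = eventually-map
    (λ { S (y , y∈ , eq) → 𝒪-cong {S} (begin
      ofℤ (↥ q) * y                    ≈⟨ *-congʳ (ι-*-denominator q) ⟨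
      (ι q * ofℤ (+ ↧ₙ q)) * y         ≈⟨ *-assoc _ _ _ ⟩
      ι q * (ofℤ (+ ↧ₙ q) * y)         ≈⟨ *-congˡ (*-congʳ (reflexive (≡.cong (λ n → ofℤ (+ n)) isFactorisation))) ⟩
      ι q * (ofℤ (+ ℕ.product factors) * y) ≈⟨ *-congˡ eq ⟩
      ι q * 1#                         ≈⟨ *-identityʳ _ ⟩
      ι q                              ∎) (𝒪-* {S} (λ v _ → ofℤ-integral v (↥ q)) y∈) })
    (product⁻¹-integral factors factorsPrime)
    where
    open Relation.Binary.Reasoning.Setoid setoid
    open PrimeFactorisation (factorise (↧ₙ q))

  -- For a relation among the powers of an element, the index found is the degree; dividing by the
  -- coefficient there makes the relation monic.
  last-nonzero : ∀ {m} (x : Vector Carrier m) → ∃[ i ] x i # 0# →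
                 ∃[ i ] x i # 0# × ∀ j → toℕ i ℕ.< toℕ j → x j ≈ 0#
  last-nonzero {suc m} x (i , xᵢ#0) with any-nonzero? (tail x)
  ... | inj₁ nonzero = let (j , xⱼ#0 , after) = last-nonzero (tail x) nonzero in
      suc j , xⱼ#0 , λ { (suc l) (ℕ.s≤s j<l) → after l j<l }
  ... | inj₂ x≈0 = zero , head#0 i xᵢ#0 , λ { (suc l) _ → x≈0 l }
    where
    head#0 : ∀ i → x i # 0# → head x # 0#
    head#0 zero x#0 = x#0
    head#0 (suc i) x#0 = contradiction (x≈0 i) (nonzero⇒≉0 x#0)

  -- If `x` had a pole at `v`, the leading power would have strictly smaller order than every other
  -- term, yet it is minus their sum.
  integral-over : ∀ v {m} (s : Vector ℚ m) x i → sum (λ j → ι (s j) * x ^ toℕ j) ≈ 0# → ι (s i) ≈ 1# →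
                  (∀ j → toℕ i ℕ.< toℕ j → ι (s j) ≈ 0#) → (∀ j → AtLeast v 0ℤ (ι (s j))) → AtLeast v 0ℤ x
  integral-over v s x i ∑≈0 sᵢ≈1 after s≥0 x#0 = ℤ.≮⇒≥ λ x<0 →
    ℤ.<-irrefl ≡.refl (ℤ.<-≤-trans (ℤ.suc[i]≤j⇒i<j ℤ.≤-refl) (AtLeast-cong v (trans (*-congʳ sᵢ≈1) (*-identityˡ _))
      (isolate (λ j → ι (s j) * x ^ toℕ j) i ∑≈0 v {ℤ.suc (ord v (x ^ toℕ i))} (lower-terms x<0)) (^-nonzero x#0 (toℕ i))))
    where
    lower-terms : ord v x ℤ.< 0ℤ → ∀ j → j ≢ i → AtLeast v (ℤ.suc (ord v (x ^ toℕ i))) (ι (s j) * x ^ toℕ j)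
    lower-terms x<0 j j≢i with ℕ.<-cmp (toℕ i) (toℕ j)
    ... | tri< i<j _ _ = AtLeast-cong v (sym (trans (*-congʳ (after j i<j)) (zeroˡ _))) (AtLeast-0 v)
    ... | tri≈ _ i≡j _ = contradiction (≡.sym (Fin.toℕ-injective i≡j)) j≢i
    ... | tri> _ _ j<i = ≡.subst (λ n → AtLeast v n (ι (s j) * x ^ toℕ j)) (ℤ.+-identityˡ _)
      (AtLeast-* v (s≥0 j) (ord-≥ v (^-nonzero x#0 (toℕ j))
        (≡.subst₂ (λ a b → ℤ.suc a ℤ.≤ b) (≡.sym (ord-^ v x#0 (toℕ i))) (≡.sym (ord-^ v x#0 (toℕ j)))
          (ℤ.i<j⇒suc[i]≤j (power-decreases j<i x<0)))))
      where
      power-decreases : ∀ {m n i} → m ℕ.< n → i ℤ.< 0ℤ → + n ℤ.* i ℤ.< + m ℤ.* i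
      power-decreases {i = i@(-[1+ _ ])} m<n -<+ = ℤ.*-monoʳ-<-neg i (+<+ m<n)

  -- x is a root of a monic polynomial with rational coefficients, so its
  -- poles are among those of the coefficients.
  eventually-integral : ∀ x → Eventually (λ S → x ∈ 𝒪 k S)
  eventually-integral x =
    let (r , rᵢ#0 , ∑≈0) = dependent (proj₁ (proj₂ finiteDim)) powers (ℕ.≤-refl {suc dimension}) (λ i → proj₂ (proj₂ finiteDim) (powers i))
        (i , rᵢ#0 , after) = last-nonzero (ι ∘ r) rᵢ#0
        (s , s≈ , ∑s≈0 , sᵢ≈1) = normalize-at r powers i rᵢ#0 ∑≈0
    in eventually-map (λ S s∈ v v∉S → integral-over v s x i ∑s≈0 sᵢ≈1
         (λ j i<j → trans (s≈ j) (trans (*-congʳ (after j i<j)) (zeroˡ _))) (λ j → s∈ j v v∉S))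
       (eventually-∀ (λ j → rational-eventually-integral (s j)))
    where
    powers : Vector Carrier (suc dimension)
    powers i = x ^ toℕ i

-- Polynomial functions and a criterion for Zariski density.

module Density {c ℓ₁ ℓ₂ : Level} (em : ExcludedMiddle (c ⊔ ℓ₁ ⊔ ℓ₂)) (k : NumberField c ℓ₁ ℓ₂) where
  open import Data.Vec.Functional using ([]; _∷_)
  open NumberField k hiding (zero)
  open IntegerSolver commutativeRing
  open Field em k
  open RationalDependence em k using (ofℤ-nonzero)
  open Algebra.Properties.Semiring.Sum semiring
    using (sum-cong-≋; *-distribˡ-sum; *-distribʳ-sum)
  open Relation.Binary.Reasoning.Setoid setoid

  -- A function that is polynomial of degree below `n`, in Horner form. The predicate speaks of
  -- functions, so no operations on coefficient lists have to be matched with evaluation.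
  IsPoly : ℕ → (Carrier → Carrier) → Set (c ⊔ ℓ₁)
  IsPoly zero    f = Lift c (∀ t → f t ≈ 0#)
  IsPoly (suc n) f = ∃[ a ] Σ[ g ∈ (Carrier → Carrier) ] IsPoly n g × ∀ t → f t ≈ a + t * g t

  Poly : (Carrier → Carrier) → Set (c ⊔ ℓ₁)
  Poly f = ∃[ n ] IsPoly n f

  isPoly-cong : ∀ {n f g} → (∀ t → f t ≈ g t) → IsPoly n f → IsPoly n g
  isPoly-cong {zero}  f≈g (lift f≈0) = lift λ t → trans (sym (f≈g t)) (f≈0 t)
  isPoly-cong {suc n} f≈g (a , h , h-poly , f≈) = a , h , h-poly , λ t → trans (sym (f≈g t)) (f≈ t)

  isPoly-suc : ∀ {n f} → IsPoly n f → IsPoly (suc n) f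
  isPoly-suc {zero} (lift f≈0) = 0# , (λ _ → 0#) , lift (λ _ → refl) , λ t →
    trans (f≈0 t) (solve 1 (λ t → con 0ℤ := con 0ℤ :+ t :* con 0ℤ) refl t)
  isPoly-suc {suc n} (a , g , g-poly , f≈) = a , g , isPoly-suc g-poly , f≈

  isPoly-+ : ∀ {n f g} → IsPoly n f → IsPoly n g → IsPoly n (λ t → f t + g t)
  isPoly-+ {zero} (lift f≈0) (lift g≈0) = lift λ t → trans (+-cong (f≈0 t) (g≈0 t)) (+-identityʳ 0#)
  isPoly-+ {suc n} (a , f′ , f′-poly , f≈) (b , g′ , g′-poly , g≈) =
    a + b , (λ t → f′ t + g′ t) , isPoly-+ f′-poly g′-poly , λ t → trans (+-cong (f≈ t) (g≈ t))
      (solve 5 (λ a b t x y → (a :+ t :* x) :+ (b :+ t :* y) := (a :+ b) :+ t :* (x :+ y)) refl a b t (f′ t) (g′ t))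

  isPoly-scale : ∀ {n f} b → IsPoly n f → IsPoly n (λ t → b * f t)
  isPoly-scale {zero} b (lift f≈0) = lift λ t → trans (*-congˡ (f≈0 t)) (zeroʳ b)
  isPoly-scale {suc n} b (a , g , g-poly , f≈) = b * a , (λ t → b * g t) , isPoly-scale b g-poly , λ t →
    trans (*-congˡ (f≈ t)) (solve 4 (λ b a t x → b :* (a :+ t :* x) := b :* a :+ t :* (b :* x)) refl b a t (g t))

  isPoly-raise : ∀ m {n f} → IsPoly n f → IsPoly (m ℕ.+ n) f
  isPoly-raise zero    f-poly = f-poly
  isPoly-raise (suc m) f-poly = isPoly-suc (isPoly-raise m f-poly)

  poly-cong : ∀ {f g} → (∀ t → f t ≈ g t) → Poly f → Poly g
  poly-cong f≈g (n , f-poly) = n , isPoly-cong f≈g f-poly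

  poly-const : ∀ a → Poly (λ _ → a)
  poly-const a = 1 , a , (λ _ → 0#) , lift (λ _ → refl) , λ t →
    solve 2 (λ a t → a := a :+ t :* con 0ℤ) refl a t

  poly-id : Poly (λ t → t)
  poly-id = 2 , 0# , (λ _ → 1#) , proj₂ (poly-const 1#) , λ t →
    solve 1 (λ t → t := con 0ℤ :+ t :* con 1ℤ) refl t

  poly-+ : ∀ {f g} → Poly f → Poly g → Poly (λ t → f t + g t)
  poly-+ {g = g} (m , f-poly) (n , g-poly) = n ℕ.+ m , isPoly-+ (isPoly-raise n f-poly)
    (≡.subst (λ l → IsPoly l g) (ℕ.+-comm m n) (isPoly-raise m g-poly))

  poly-scale : ∀ {f} b → Poly f → Poly (λ t → b * f t)
  poly-scale b (n , f-poly) = n , isPoly-scale b f-poly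

  poly-shift : ∀ {f} → Poly f → Poly (λ t → t * f t)
  poly-shift {f} (n , f-poly) = suc n , 0# , f , f-poly , λ t → sym (+-identityˡ _)

  poly-* : ∀ {f g} → Poly f → Poly g → Poly (λ t → f t * g t)
  poly-* {f} {g} (zero , lift f≈0) g-poly = 0 , lift λ t → trans (*-congʳ (f≈0 t)) (zeroˡ (g t))
  poly-* {f} {g} (suc m , a , h , h-poly , f≈) g-poly = poly-cong
    (λ t → trans (solve 4 (λ a g t h → a :* g :+ t :* (h :* g) := (a :+ t :* h) :* g) refl a (g t) t (h t)) (*-congʳ (sym (f≈ t))))
    (poly-+ (poly-scale a g-poly) (poly-shift (poly-* {h} {g} (m , h-poly) g-poly)))

  poly-neg : ∀ {f} → Poly f → Poly (λ t → - f t)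
  poly-neg {f} f-poly = poly-cong (λ t → solve 1 (λ x → (:- con 1ℤ) :* x := :- x) refl (f t)) (poly-scale (- 1#) f-poly)

  poly-^ : ∀ {f} → Poly f → ∀ n → Poly (λ t → f t ^ n)
  poly-^ f-poly zero    = poly-const 1#
  poly-^ f-poly (suc n) = poly-* f-poly (poly-^ f-poly n)

  poly-sum : ∀ {m} {f : Fin m → Carrier → Carrier} → (∀ i → Poly (f i)) → Poly (λ t → sum (λ i → f i t))
  poly-sum {zero}  f-poly = poly-const 0#
  poly-sum {suc m} f-poly = poly-+ (f-poly zero) (poly-sum (λ i → f-poly (suc i)))

  -- Synthetic division: if `g t` is `g b + (t - b) * h t`, then dividing `a + t * g t` by `t - b`
  -- gives the quotient `g t + b * h t`.
  factor : ∀ {n f} → IsPoly (suc n) f → ∀ b → Σ[ h ∈ (Carrier → Carrier) ] IsPoly n h × ∀ t → f t ≈ f b + (t - b) * h t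
  factor {zero} (a , g , lift g≈0 , f≈) b = (λ _ → 0#) , lift (λ _ → refl) , λ t → trans (constant t)
    (trans (sym (constant b)) (solve 3 (λ x t b → x := x :+ (t :- b) :* con 0ℤ) refl _ t b))
    where
    constant : ∀ t → _ ≈ a
    constant t = trans (f≈ t) (trans (+-congˡ (trans (*-congˡ (g≈0 t)) (zeroʳ t))) (+-identityʳ a))
  factor {suc n} {f} (a , g , g-poly , f≈) b with factor g-poly b
  ... | h , h-poly , g≈ = (λ t → g t + b * h t) , isPoly-+ g-poly (isPoly-scale b (isPoly-suc h-poly)) , λ t → begin
      f t                                              ≈⟨ f≈ t ⟩
      a + t * g t                                      ≈⟨ solve 4 (λ a t b x → a :+ t :* x := (a :+ (t :- b) :* x) :+ b :* x) refl a t b (g t) ⟩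
      (a + (t - b) * g t) + b * g t                    ≈⟨ +-congˡ (*-congˡ (g≈ t)) ⟩
      (a + (t - b) * g t) + b * (g b + (t - b) * h t)  ≈⟨ solve 6 (λ a t b x y z → (a :+ (t :- b) :* x) :+ b :* (y :+ (t :- b) :* z)
                                                            := (a :+ b :* y) :+ (t :- b) :* (x :+ b :* z)) refl a t b (g t) (g b) (h t) ⟩
      (a + b * g b) + (t - b) * (g t + b * h t)        ≈⟨ +-congʳ (f≈ b) ⟨
      f b + (t - b) * (g t + b * h t)                  ∎

  two : Carrier
  two = ofℤ (+ 2)

  ofℤ-injective : ∀ {i j} → ofℤ i ≈ ofℤ j → i ≡ j
  ofℤ-injective {i} {j} eq with i ℤ.≟ j
  ... | yes i≡j = i≡j
  ... | no i≢j = contradiction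
    (trans (ofℤ-+ i (ℤ.- j)) (trans (+-cong eq (ofℤ-neg j)) (-‿inverseʳ (ofℤ j))))
    (nonzero⇒≉0 (ofℤ-nonzero (i≢j ∘ ℤ.i-j≡0⇒i≡j i j)))

  two-^ : ∀ n → two ^ n ≈ ofℤ (+ (2 ℕ.^ n))
  two-^ zero    = refl
  two-^ (suc n) = trans (*-congˡ (two-^ n)) (trans (sym (ofℤ-* (+ 2) (+ (2 ℕ.^ n))))
    (reflexive (≡.cong ofℤ (≡.sym (ℤ.pos-* 2 (2 ℕ.^ n))))))

  two-^-injective : ∀ {i j} → two ^ i ≈ two ^ j → i ≡ j
  two-^-injective {i} {j} eq with ℕ.<-cmp i j | ℤ.+-injective (ofℤ-injective (trans (sym (two-^ i)) (trans eq (two-^ j))))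
  ... | tri< i<j _ _ | eq′ = contradiction eq′ (ℕ.<⇒≢ (ℕ.^-monoʳ-< 2 (ℕ.s≤s (ℕ.s≤s ℕ.z≤n)) i<j))
  ... | tri≈ _ i≡j _ | _   = i≡j
  ... | tri> _ _ j<i | eq′ = contradiction (≡.sym eq′) (ℕ.<⇒≢ (ℕ.^-monoʳ-< 2 (ℕ.s≤s (ℕ.s≤s ℕ.z≤n)) j<i))

  -‿nonzero : ∀ {x y} → ¬ x ≈ y → x - y # 0#
  -‿nonzero {x} {y} x≉y = ≉0⇒nonzero λ x-y≈0 → x≉y
    (trans (solve 2 (λ x y → x := (x :- y) :+ y) refl x y) (trans (+-congʳ x-y≈0) (+-identityˡ y)))

  -- A root `two ^ i` is divided out, which lowers the degree bound. The powers of 2 are distinct in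
  -- characteristic zero, so the factor removed does not vanish at later powers.
  finitely-many-roots : ∀ n {f} → IsPoly n f → (∀ t → f t ≈ 0#) ⊎ (∃[ N ] ∀ i → N ℕ.≤ i → f (two ^ i) # 0#)
  finitely-many-roots zero (lift f≈0) = inj₁ f≈0
  finitely-many-roots (suc n) {f} f-poly with em {Lift (c ⊔ ℓ₂) (∃[ i ] f (two ^ i) ≈ 0#)}
  ... | no no-root = inj₂ (0 , λ i _ → ≉0⇒nonzero (λ eq → no-root (lift (i , eq))))
  ... | yes (lift (i , root)) with factor f-poly (two ^ i)
  ... | h , h-poly , f≈ with finitely-many-roots n h-poly
  ... | inj₁ h≈0 = inj₁ λ t → trans (f≈ t) (trans (+-cong root (trans (*-congˡ (h≈0 t)) (zeroʳ _))) (+-identityʳ 0#))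
  ... | inj₂ (N , h-nonzero) = inj₂ (N ℕ.+ suc i , λ j N+1+i≤j →
    nonzero-cong (sym (trans (f≈ (two ^ j)) (trans (+-congʳ root) (+-identityˡ _))))
      (*-nonzero (-‿nonzero λ eq → ℕ.<⇒≢ (ℕ.m+n≤o⇒n≤o N N+1+i≤j) (≡.sym (two-^-injective eq)))
        (h-nonzero j (ℕ.m+n≤o⇒m≤o N N+1+i≤j))))

  vanishing-on-powers : ∀ {f} → Poly f → (∀ i → f (two ^ i) ≈ 0#) → ∀ t → f t ≈ 0#
  vanishing-on-powers (n , f-poly) roots with finitely-many-roots n f-poly
  ... | inj₁ f≈0 = f≈0
  ... | inj₂ (N , nonzero) = contradiction (roots N) (nonzero⇒≉0 (nonzero N ℕ.≤-refl))

  eventually-nonzero : ∀ {f} → Poly f → ∃[ t ] f t # 0# → ∃[ N ] ∀ i → N ℕ.≤ i → f (two ^ i) # 0#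
  eventually-nonzero (n , f-poly) (t , ft#0) with finitely-many-roots n f-poly
  ... | inj₁ f≈0 = contradiction (f≈0 t) (nonzero⇒≉0 ft#0)
  ... | inj₂ r   = r

  infix 4 _≈ᵥ_
  _≈ᵥ_ : Point k → Point k → Set ℓ₁
  x ≈ᵥ y = ∀ j → x j ≈ y j

  line : Point k → Point k → Carrier → Point k
  line x y t j = x j + t * (y j - x j)

  line-0 : ∀ x y → line x y 0# ≈ᵥ x
  line-0 x y j = solve 2 (λ x y → x :+ con 0ℤ :* (y :- x) := x) refl (x j) (y j)

  line-1 : ∀ x y → line x y 1# ≈ᵥ y
  line-1 x y j = solve 2 (λ x y → x :+ con 1ℤ :* (y :- x) := y) refl (x j) (y j)

  -- A stand-in for polynomial functions in three variables: their vanishing is studied only along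
  -- lines, where one variable suffices.
  record Regular (g : Point k → Carrier) : Set (c ⊔ ℓ₁) where
    field
      respects : ∀ {x y} → x ≈ᵥ y → g x ≈ g y
      poly-along : ∀ x y → Poly (λ t → g (line x y t))
  open Regular

  Generic : (Point k → Carrier) → Set (c ⊔ ℓ₁ ⊔ ℓ₂)
  Generic g = Regular g × ∃[ x ] g x # 0#

  regular-const : ∀ a → Regular (λ _ → a)
  regular-const a = record { respects = λ _ → refl ; poly-along = λ _ _ → poly-const a }

  regular-coordinate : ∀ j → Regular (λ x → x j)
  regular-coordinate j = record
    { respects = λ x≈y → x≈y j
    ; poly-along = λ x y → poly-+ (poly-const (x j)) (poly-* poly-id (poly-const (y j - x j))) }

  regular-+ : ∀ {f g} → Regular f → Regular g → Regular (λ x → f x + g x)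
  regular-+ F G = record
    { respects = λ x≈y → +-cong (respects F x≈y) (respects G x≈y)
    ; poly-along = λ x y → poly-+ (poly-along F x y) (poly-along G x y) }

  regular-* : ∀ {f g} → Regular f → Regular g → Regular (λ x → f x * g x)
  regular-* F G = record
    { respects = λ x≈y → *-cong (respects F x≈y) (respects G x≈y)
    ; poly-along = λ x y → poly-* (poly-along F x y) (poly-along G x y) }

  regular-neg : ∀ {f} → Regular f → Regular (λ x → - f x)
  regular-neg F = record
    { respects = λ x≈y → -‿cong (respects F x≈y)
    ; poly-along = λ x y → poly-neg (poly-along F x y) }

  regular-sum : ∀ {m} {f : Fin m → Point k → Carrier} → (∀ i → Regular (f i)) → Regular (λ x → sum (λ i → f i x))
  regular-sum {zero}  F = regular-const 0#
  regular-sum {suc m} F = regular-+ (F zero) (regular-sum (λ i → F (suc i)))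

  regular-^ : ∀ {f} → Regular f → ∀ n → Regular (λ x → f x ^ n)
  regular-^ F zero    = regular-const 1#
  regular-^ F (suc n) = regular-* F (regular-^ F n)

  regular-apply : ∀ L → Regular (apply k L)
  regular-apply L = regular-sum (λ j → regular-* (regular-const (L j)) (regular-coordinate j))

  regular-eval : ∀ {d} (P : Polynomial k d) → Regular (eval k P)
  regular-eval P = regular-sum λ i → regular-sum λ j → regular-sum λ l →
    regular-* (regular-const (P i j l)) (regular-* (regular-^ (regular-coordinate 0F) (toℕ i))
      (regular-* (regular-^ (regular-coordinate 1F) (toℕ j)) (regular-^ (regular-coordinate 2F) (toℕ l))))

  -- Irreducibility of affine space. On the line joining a point where `f` is nonzero to one where
  -- `g` is, both restrict to nonzero polynomials, and so both are nonzero at a large enough power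
  -- of 2.
  generic-* : ∀ {f g} → Generic f → Generic g → Generic (λ x → f x * g x)
  generic-* {f} {g} (F , x , fx#0) (G , y , gy#0) =
    let (M , f#0) = eventually-nonzero (poly-along F x y) (0# , nonzero-cong (sym (respects F (line-0 x y))) fx#0)
        (N , g#0) = eventually-nonzero (poly-along G x y) (1# , nonzero-cong (sym (respects G (line-1 x y))) gy#0)
    in regular-* F G , line x y (two ^ (M ℕ.+ N))
     , *-nonzero (f#0 (M ℕ.+ N) (ℕ.m≤m+n M N)) (g#0 (M ℕ.+ N) (ℕ.m≤n+m N M))

  -- If `f` were nonzero anywhere, the product of `f` and `g` would be nonzero at some point,
  -- contrary to the assumption there.
  vanishing-generically : ∀ {f g} → Regular f → Generic g → (∀ x → g x # 0# → f x ≈ 0#) → ∀ x → f x ≈ 0#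
  vanishing-generically {f} {g} F G f≈0 x with zero-or-nonzero (f x)
  ... | inj₁ fx≈0 = fx≈0
  ... | inj₂ fx#0 = let (_ , y , fgy#0) = generic-* (F , x , fx#0) G in
    contradiction (f≈0 y (*-nonzeroʳ fgy#0)) (nonzero⇒≉0 (*-nonzeroˡ fgy#0))

  -- Setting `t` to zero kills the head. In what remains a factor `t` can be cancelled at nonzero
  -- `t` only; vanishing at the powers of 2 is enough to continue.
  coefficients-zero : ∀ {d} (a : Vector Carrier d) → (∀ t → sum (λ i → a i * t ^ toℕ i) ≈ 0#) → ∀ i → a i ≈ 0#
  coefficients-zero {suc d} a ∑≈0 = λ { zero → a₀≈0 ; (suc i) → coefficients-zero (tail a) tail≈0 i }
    where
    rest : Carrier → Carrier
    rest t = sum (λ i → tail a i * t ^ toℕ i)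
    horner : ∀ t → sum (λ i → a i * t ^ toℕ i) ≈ head a + t * rest t
    horner t = +-cong (*-identityʳ (head a)) (trans (sum-cong-≋ (λ i →
      solve 3 (λ a t s → a :* (t :* s) := t :* (a :* s)) refl (tail a i) t (t ^ toℕ i)))
      (sym (*-distribˡ-sum t (λ i → tail a i * t ^ toℕ i))))
    a₀≈0 : head a ≈ 0#
    a₀≈0 = trans (trans (sym (+-identityʳ _)) (+-congˡ (sym (zeroˡ _)))) (trans (sym (horner 0#)) (∑≈0 0#))
    tail≈0 : ∀ t → rest t ≈ 0#
    tail≈0 = vanishing-on-powers (poly-sum (λ i → poly-* (poly-const (tail a i)) (poly-^ poly-id (toℕ i)))) λ i →
      no-zero-divisors (^-nonzero (ofℤ-nonzero {+ 2} λ ()) i) (trans (trans (sym (+-identityˡ _)) (+-congʳ (sym a₀≈0)))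
        (trans (sym (horner (two ^ i))) (∑≈0 (two ^ i))))

  vanishing-polynomial : ∀ {d} (P : Polynomial k d) → (∀ x → eval k P x ≈ 0#) → IsZero k P
  vanishing-polynomial P P≈0 i j l =
    coefficients-zero (λ l → P i j l) (λ z →
    coefficients-zero (λ j → sum (λ l → P i j l * z ^ toℕ l)) (λ y →
    coefficients-zero (λ i → sum (λ j → sum (λ l → P i j l * z ^ toℕ l) * y ^ toℕ j)) (λ x →
      trans (sum-cong-≋ (λ i → regroup-x x y z i)) (P≈0 (x ∷ y ∷ z ∷ []))) i) j) l
    where
    regroup-y : ∀ x y z i j → (sum (λ l → P i j l * z ^ toℕ l) * y ^ toℕ j) * x ^ toℕ i
              ≈ sum (λ l → P i j l * (x ^ toℕ i * (y ^ toℕ j * z ^ toℕ l)))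
    regroup-y x y z i j = trans (*-assoc _ _ _) (trans (*-distribʳ-sum _ (λ l → P i j l * z ^ toℕ l))
      (sum-cong-≋ (λ l → solve 4 (λ p x y z → (p :* z) :* (y :* x) := p :* (x :* (y :* z))) refl (P i j l) (x ^ toℕ i) (y ^ toℕ j) (z ^ toℕ l))))
    regroup-x : ∀ x y z i → sum (λ j → sum (λ l → P i j l * z ^ toℕ l) * y ^ toℕ j) * x ^ toℕ i
              ≈ sum (λ j → sum (λ l → P i j l * (x ^ toℕ i * (y ^ toℕ j * z ^ toℕ l))))
    regroup-x x y z i = trans (*-distribʳ-sum (x ^ toℕ i) (λ j → sum (λ l → P i j l * z ^ toℕ l) * y ^ toℕ j))
      (sum-cong-≋ (regroup-y x y z i))

  PolyFamily : (Carrier → Point k) → Set (c ⊔ ℓ₁)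
  PolyFamily p = ∀ j → Poly (λ t → p t j)

  poly-eval : ∀ {d} (P : Polynomial k d) {p} → PolyFamily p → Poly (λ t → eval k P (p t))
  poly-eval P p-poly = poly-sum λ i → poly-sum λ j → poly-sum λ l →
    poly-* (poly-const (P i j l)) (poly-* (poly-^ (p-poly 0F) (toℕ i))
      (poly-* (poly-^ (p-poly 1F) (toℕ j)) (poly-^ (p-poly 2F) (toℕ l))))

  -- The image contains the nonempty open set where `locus` is nonzero. Polynomiality is demanded in
  -- each parameter separately, because the parameters are freed one at a time.
  record Dominant (p : Carrier → Carrier → Carrier → Point k) : Set (c ⊔ ℓ₁ ⊔ ℓ₂) where
    field
      poly₁ : ∀ b c → PolyFamily (λ a → p a b c)
      poly₂ : ∀ a c → PolyFamily (λ b → p a b c)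
      poly₃ : ∀ a b → PolyFamily (λ c → p a b c)
      locus : Point k → Carrier
      locus-generic : Generic locus
      preimage : ∀ x → locus x # 0# → ∃[ a ] ∃[ b ] ∃[ c ] p a b c ≈ᵥ x

  -- Multiplying P by a coordinate makes it vanish also at the members of the
  -- family that are zero and hence represent no point of ℙ².
  dominant⇒dense : ∀ {a} {X : Pred (Point k) a} p → Dominant p →
                   (∀ a b c → p (two ^ a) (two ^ b) (two ^ c) ∈ X) → DenseInℙ² k X × DenseIn𝔸³ k X
  dominant⇒dense {X = X} p D p∈X =
      (λ _ P _ P≈0 → vanishing P P≈0) , (λ P P≈0 → vanishing P (λ x x∈X _ → P≈0 x x∈X))
    where
    open Dominant D
    vanishing : ∀ {d} (P : Polynomial k d) → (∀ x → x ∈ X → ∃[ j ] x j # 0# → eval k P x ≈ 0#) → IsZero k P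
    vanishing P P≈0 = vanishing-polynomial P (vanishing-generically (regular-eval P)
      -- The factor `x 0F` in the locus allows the coordinate multiplied into `P` to be cancelled
      -- again.
      (generic-* (regular-coordinate 0F , (λ _ → 1#) , 1-nonzero) locus-generic)
      λ x x₀G#0 → let (a , b , c , eq) = preimage x (*-nonzeroʳ x₀G#0) in
        no-zero-divisors (*-nonzeroˡ x₀G#0) (trans (*-cong (sym (eq 0F)) (respects (regular-eval P) (λ j → sym (eq j)))) (everywhere a b c)))
      where
      product : Carrier → Carrier → Carrier → Carrier
      product a b c = p a b c 0F * eval k P (p a b c)
      at-powers : ∀ a b c → product (two ^ a) (two ^ b) (two ^ c) ≈ 0#
      at-powers a b c with zero-or-nonzero (p (two ^ a) (two ^ b) (two ^ c) 0F)
      ... | inj₁ p₀≈0 = trans (*-congʳ p₀≈0) (zeroˡ _)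
      ... | inj₂ p₀#0 = trans (*-congˡ (P≈0 _ (p∈X a b c) (0F , p₀#0))) (zeroʳ _)
      everywhere : ∀ a b c → product a b c ≈ 0#
      -- Vanishing at powers of 2 extends to all `c`, then to all `b`, then to all `a`.
      everywhere a b c = vanishing-on-powers (poly-* (poly₁ b c 0F) (poly-eval P (poly₁ b c))) (λ i →
        vanishing-on-powers (poly-* (poly₂ (two ^ i) c 0F) (poly-eval P (poly₂ (two ^ i) c))) (λ j →
        vanishing-on-powers (poly-* (poly₃ (two ^ i) (two ^ j) 0F) (poly-eval P (poly₃ (two ^ i) (two ^ j)))) (at-powers i j) c) b) a

-- Dual bases of forms in general position.

module LinearForms {c ℓ₁ ℓ₂ : Level} (em : ExcludedMiddle (c ⊔ ℓ₁ ⊔ ℓ₂)) (k : NumberField c ℓ₁ ℓ₂) where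
  open import Data.Vec.Functional using ([]; _∷_)
  open NumberField k hiding (zero)
  open IntegerSolver commutativeRing
  open Field em k
  open Relation.Binary.Reasoning.Setoid setoid

  -- The basis dual to three independent forms; geometrically, the vertices of the triangle formed
  -- by the three lines.
  record Dual (f g h : LinearForm k) : Set (c ⊔ ℓ₁) where
    field
      u v w : Point k
      fu≈1 : apply k f u ≈ 1#
      fv≈0 : apply k f v ≈ 0#
      fw≈0 : apply k f w ≈ 0#
      gu≈0 : apply k g u ≈ 0#
      gv≈1 : apply k g v ≈ 1#
      gw≈0 : apply k g w ≈ 0#
      hu≈0 : apply k h u ≈ 0#
      hv≈0 : apply k h v ≈ 0#
      hw≈1 : apply k h w ≈ 1#
      decompose : ∀ x l → x l ≈ u l * apply k f x + v l * apply k g x + w l * apply k h x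

  cross : Point k → Point k → Point k
  cross b c = b 1F * c 2F - b 2F * c 1F ∷ b 2F * c 0F - b 0F * c 2F ∷ b 0F * c 1F - b 1F * c 0F ∷ []

  det : Point k → Point k → Point k → Carrier
  det a b c = apply k a (cross b c)

  scaled : Carrier → Point k → Point k
  scaled t x j = x j * t

  apply-scaled : ∀ f t x → apply k f (scaled t x) ≈ apply k f x * t
  apply-scaled f t x = solve 7 (λ f₀ f₁ f₂ x₀ x₁ x₂ t →
    f₀ :* (x₀ :* t) :+ (f₁ :* (x₁ :* t) :+ (f₂ :* (x₂ :* t) :+ con 0ℤ)) := (f₀ :* x₀ :+ (f₁ :* x₁ :+ (f₂ :* x₂ :+ con 0ℤ))) :* t)
    refl (f 0F) (f 1F) (f 2F) (x 0F) (x 1F) (x 2F) t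

  apply-cong : ∀ f {x y} → (∀ j → x j ≈ y j) → apply k f x ≈ apply k f y
  apply-cong f x≈y = +-cong (*-congˡ (x≈y 0F)) (+-cong (*-congˡ (x≈y 1F)) (+-congʳ (*-congˡ (x≈y 2F))))

  basis-vector : Fin 3 → Point k
  basis-vector 0F = 1# ∷ 0# ∷ 0# ∷ []
  basis-vector 1F = 0# ∷ 1# ∷ 0# ∷ []
  basis-vector 2F = 0# ∷ 0# ∷ 1# ∷ []

  apply-basis-vector : ∀ f j → apply k f (basis-vector j) ≈ f j
  apply-basis-vector f 0F = solve 3 (λ x y z → x :* con 1ℤ :+ (y :* con 0ℤ :+ (z :* con 0ℤ :+ con 0ℤ)) := x) refl (f 0F) (f 1F) (f 2F)
  apply-basis-vector f 1F = solve 3 (λ x y z → x :* con 0ℤ :+ (y :* con 1ℤ :+ (z :* con 0ℤ :+ con 0ℤ)) := y) refl (f 0F) (f 1F) (f 2F)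
  apply-basis-vector f 2F = solve 3 (λ x y z → x :* con 0ℤ :+ (y :* con 0ℤ :+ (z :* con 1ℤ :+ con 0ℤ)) := z) refl (f 0F) (f 1F) (f 2F)

  det-rotate : ∀ a b c → det b c a ≈ det a b c
  det-rotate a b c = solve 9 (λ a₀ a₁ a₂ b₀ b₁ b₂ c₀ c₁ c₂ →
    b₀ :* (c₁ :* a₂ :- c₂ :* a₁) :+ (b₁ :* (c₂ :* a₀ :- c₀ :* a₂) :+ (b₂ :* (c₀ :* a₁ :- c₁ :* a₀) :+ con 0ℤ))
    := a₀ :* (b₁ :* c₂ :- b₂ :* c₁) :+ (a₁ :* (b₂ :* c₀ :- b₀ :* c₂) :+ (a₂ :* (b₀ :* c₁ :- b₁ :* c₀) :+ con 0ℤ)))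
    refl (a 0F) (a 1F) (a 2F) (b 0F) (b 1F) (b 2F) (c 0F) (c 1F) (c 2F)

  det-repeat : ∀ a b → det a a b ≈ 0#
  det-repeat a b = solve 6 (λ a₀ a₁ a₂ b₀ b₁ b₂ →
    a₀ :* (a₁ :* b₂ :- a₂ :* b₁) :+ (a₁ :* (a₂ :* b₀ :- a₀ :* b₂) :+ (a₂ :* (a₀ :* b₁ :- a₁ :* b₀) :+ con 0ℤ)) := con 0ℤ)
    refl (a 0F) (a 1F) (a 2F) (b 0F) (b 1F) (b 2F)

  det-repeat′ : ∀ a b → det a b a ≈ 0#
  det-repeat′ a b = trans (sym (det-rotate a b a)) (trans (sym (det-rotate b a a)) (det-repeat a b))

  -- The cross products are the columns of the adjugate of the matrix with rows `a`, `b`, `c`; this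
  -- is adjugate times matrix, applied to `x`.
  cramer : ∀ a b c x l → cross b c l * apply k a x + cross c a l * apply k b x + cross a b l * apply k c x ≈ det a b c * x l
  cramer a b c x 0F = solve 12 (λ a₀ a₁ a₂ b₀ b₁ b₂ c₀ c₁ c₂ x₀ x₁ x₂ →
    (b₁ :* c₂ :- b₂ :* c₁) :* (a₀ :* x₀ :+ (a₁ :* x₁ :+ (a₂ :* x₂ :+ con 0ℤ))) :+
    (c₁ :* a₂ :- c₂ :* a₁) :* (b₀ :* x₀ :+ (b₁ :* x₁ :+ (b₂ :* x₂ :+ con 0ℤ))) :+
    (a₁ :* b₂ :- a₂ :* b₁) :* (c₀ :* x₀ :+ (c₁ :* x₁ :+ (c₂ :* x₂ :+ con 0ℤ))) :=
    (a₀ :* (b₁ :* c₂ :- b₂ :* c₁) :+ (a₁ :* (b₂ :* c₀ :- b₀ :* c₂) :+ (a₂ :* (b₀ :* c₁ :- b₁ :* c₀) :+ con 0ℤ))) :* x₀)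
    refl (a 0F) (a 1F) (a 2F) (b 0F) (b 1F) (b 2F) (c 0F) (c 1F) (c 2F) (x 0F) (x 1F) (x 2F)
  cramer a b c x 1F = solve 12 (λ a₀ a₁ a₂ b₀ b₁ b₂ c₀ c₁ c₂ x₀ x₁ x₂ →
    (b₂ :* c₀ :- b₀ :* c₂) :* (a₀ :* x₀ :+ (a₁ :* x₁ :+ (a₂ :* x₂ :+ con 0ℤ))) :+
    (c₂ :* a₀ :- c₀ :* a₂) :* (b₀ :* x₀ :+ (b₁ :* x₁ :+ (b₂ :* x₂ :+ con 0ℤ))) :+
    (a₂ :* b₀ :- a₀ :* b₂) :* (c₀ :* x₀ :+ (c₁ :* x₁ :+ (c₂ :* x₂ :+ con 0ℤ))) :=
    (a₀ :* (b₁ :* c₂ :- b₂ :* c₁) :+ (a₁ :* (b₂ :* c₀ :- b₀ :* c₂) :+ (a₂ :* (b₀ :* c₁ :- b₁ :* c₀) :+ con 0ℤ))) :* x₁)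
    refl (a 0F) (a 1F) (a 2F) (b 0F) (b 1F) (b 2F) (c 0F) (c 1F) (c 2F) (x 0F) (x 1F) (x 2F)
  cramer a b c x 2F = solve 12 (λ a₀ a₁ a₂ b₀ b₁ b₂ c₀ c₁ c₂ x₀ x₁ x₂ →
    (b₀ :* c₁ :- b₁ :* c₀) :* (a₀ :* x₀ :+ (a₁ :* x₁ :+ (a₂ :* x₂ :+ con 0ℤ))) :+
    (c₀ :* a₁ :- c₁ :* a₀) :* (b₀ :* x₀ :+ (b₁ :* x₁ :+ (b₂ :* x₂ :+ con 0ℤ))) :+
    (a₀ :* b₁ :- a₁ :* b₀) :* (c₀ :* x₀ :+ (c₁ :* x₁ :+ (c₂ :* x₂ :+ con 0ℤ))) :=
    (a₀ :* (b₁ :* c₂ :- b₂ :* c₁) :+ (a₁ :* (b₂ :* c₀ :- b₀ :* c₂) :+ (a₂ :* (b₀ :* c₁ :- b₁ :* c₀) :+ con 0ℤ))) :* x₂)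
    refl (a 0F) (a 1F) (a 2F) (b 0F) (b 1F) (b 2F) (c 0F) (c 1F) (c 2F) (x 0F) (x 1F) (x 2F)

  det-nonzero⇒dual : ∀ {f g h} → det f g h # 0# → Dual f g h
  det-nonzero⇒dual {f} {g} {h} D#0 = record
    { u = scaled D⁻¹ (cross g h) ; v = scaled D⁻¹ (cross h f) ; w = scaled D⁻¹ (cross f g)
    ; fu≈1 = one f (cross g h) refl
    ; fv≈0 = vanish f (cross h f) (det-repeat′ f h)
    ; fw≈0 = vanish f (cross f g) (det-repeat f g)
    ; gu≈0 = vanish g (cross g h) (det-repeat g h)
    ; gv≈1 = one g (cross h f) (det-rotate f g h)
    ; gw≈0 = vanish g (cross f g) (det-repeat′ g f)
    ; hu≈0 = vanish h (cross g h) (det-repeat′ h g)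
    ; hv≈0 = vanish h (cross h f) (det-repeat h f)
    ; hw≈1 = one h (cross f g) (trans (det-rotate g h f) (det-rotate f g h))
    ; decompose = λ x l → sym (begin
        cross g h l * D⁻¹ * apply k f x + cross h f l * D⁻¹ * apply k g x + cross f g l * D⁻¹ * apply k h x
          ≈⟨ solve 7 (λ a b c x y z d → a :* d :* x :+ b :* d :* y :+ c :* d :* z := d :* (a :* x :+ b :* y :+ c :* z)) refl
               (cross g h l) (cross h f l) (cross f g l) (apply k f x) (apply k g x) (apply k h x) D⁻¹ ⟩
        D⁻¹ * (cross g h l * apply k f x + cross h f l * apply k g x + cross f g l * apply k h x) ≈⟨ *-congˡ (cramer f g h x l) ⟩
        D⁻¹ * (det f g h * x l)    ≈⟨ *-assoc _ _ _ ⟨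
        D⁻¹ * det f g h * x l      ≈⟨ *-congʳ (*-inverseˡ D#0) ⟩
        1# * x l                   ≈⟨ *-identityˡ _ ⟩
        x l                        ∎) }
    where
    D⁻¹ : Carrier
    D⁻¹ = det f g h ⁻¹
    vanish : ∀ e x → apply k e x ≈ 0# → apply k e (scaled D⁻¹ x) ≈ 0#
    vanish e x ex≈0 = trans (apply-scaled e D⁻¹ x) (trans (*-congʳ ex≈0) (zeroˡ _))
    one : ∀ e x → apply k e x ≈ det f g h → apply k e (scaled D⁻¹ x) ≈ 1#
    one e x ex≈D = trans (apply-scaled e D⁻¹ x) (trans (*-congʳ ex≈D) (*-inverseʳ D#0))

  ∃-nonzero-coordinate : ∀ (x : Point k) → ¬ (∀ j → x j ≈ 0#) → ∃[ j ] x j # 0#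
  ∃-nonzero-coordinate x x≉0 with zero-or-nonzero (x 0F) | zero-or-nonzero (x 1F) | zero-or-nonzero (x 2F)
  ... | inj₂ x₀#0 | _         | _         = 0F , x₀#0
  ... | inj₁ _    | inj₂ x₁#0 | _         = 1F , x₁#0
  ... | inj₁ _    | inj₁ _    | inj₂ x₂#0 = 2F , x₂#0
  ... | inj₁ x₀≈0 | inj₁ x₁≈0 | inj₁ x₂≈0 = contradiction (λ { 0F → x₀≈0 ; 1F → x₁≈0 ; 2F → x₂≈0 }) x≉0

  cross-zero⇒proportional : ∀ b c → (∀ l → cross b c l ≈ 0#) → ∀ i j → b i * c j ≈ c i * b j
  cross-zero⇒proportional b c bc≈0 = λ
    { 0F 0F → *-comm _ _ ; 0F 1F → trans (equal (bc≈0 2F)) (*-comm _ _) ; 0F 2F → trans (sym (equal (bc≈0 1F))) (*-comm _ _)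
    ; 1F 0F → trans (sym (equal (bc≈0 2F))) (*-comm _ _) ; 1F 1F → *-comm _ _ ; 1F 2F → trans (equal (bc≈0 0F)) (*-comm _ _)
    ; 2F 0F → trans (equal (bc≈0 1F)) (*-comm _ _) ; 2F 1F → trans (sym (equal (bc≈0 0F))) (*-comm _ _) ; 2F 2F → *-comm _ _ }
    where
    equal : ∀ {x y} → x - y ≈ 0# → x ≈ y
    equal {x} {y} eq = trans (solve 2 (λ x y → x := (x :- y) :+ y) refl x y) (trans (+-congʳ eq) (+-identityˡ y))

  -- If the cross product vanished, every `c i` would be a coefficient in a relation between `b` and
  -- `c`, hence zero; but then `c` itself would be zero.
  pair⇒cross-nonzero : ∀ b c → (∀ s t → (∀ j → s * b j + t * c j ≈ 0#) → s ≈ 0# × t ≈ 0#) → ∃[ l ] cross b c l # 0#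
  pair⇒cross-nonzero b c independent = ∃-nonzero-coordinate (cross b c) λ bc≈0 →
    let c≈0 : ∀ i → c i ≈ 0#
        c≈0 i = trans (solve 1 (λ x → x := :- (:- x)) refl (c i)) (trans (-‿cong
          (proj₁ (independent (- c i) (b i) λ j → trans
            (+-congˡ (cross-zero⇒proportional b c bc≈0 i j))
            (solve 2 (λ x y → (:- x) :* y :+ x :* y := con 0ℤ) refl (c i) (b j))))) -0#≈0#)
    in nonzero⇒≉0 1-nonzero (proj₂ (independent 0# 1# λ j →
         trans (+-cong (zeroˡ _) (trans (*-identityˡ _) (c≈0 j))) (+-identityʳ 0#)))

  -- If the determinant were zero, `cramer` at the basis vectors would be a relation between the
  -- forms. Its coefficients are coordinates of cross products, and `l` is chosen so that the first
  -- one is nonzero.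
  independent⇒dual : (E : Vector (LinearForm k) 3) → LinearlyIndependent k E → Dual (E 0F) (E 1F) (E 2F)
  independent⇒dual E independent = det-nonzero⇒dual (≉0⇒nonzero λ D≈0 →
    let (l , e₁e₂#0) = pair⇒cross-nonzero e₁ e₂ pair
    in nonzero⇒≉0 e₁e₂#0 (independent (cross e₁ e₂ l ∷ cross e₂ e₀ l ∷ cross e₀ e₁ l ∷ []) (relation D≈0 l) 0F))
    where
    e₀ e₁ e₂ : Point k
    e₀ = E 0F
    e₁ = E 1F
    e₂ = E 2F
    pair : ∀ s t → (∀ j → s * e₁ j + t * e₂ j ≈ 0#) → s ≈ 0# × t ≈ 0#
    pair s t eq = coefficients 1F , coefficients 2F
      where
      coefficients : ∀ i → (0# ∷ s ∷ t ∷ []) i ≈ 0#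
      coefficients = independent (0# ∷ s ∷ t ∷ []) λ j → trans
        (solve 5 (λ s t x y z → con 0ℤ :* x :+ (s :* y :+ (t :* z :+ con 0ℤ)) := s :* y :+ t :* z) refl s t (e₀ j) (e₁ j) (e₂ j)) (eq j)
    relation : det e₀ e₁ e₂ ≈ 0# → ∀ l j → cross e₁ e₂ l * e₀ j + (cross e₂ e₀ l * e₁ j + (cross e₀ e₁ l * e₂ j + 0#)) ≈ 0#
    relation D≈0 l j = trans (trans (trans (trans (+-congˡ (+-congˡ (+-identityʳ _))) (sym (+-assoc _ _ _)))
      (sym (+-cong (+-cong (*-congˡ (apply-basis-vector e₀ j)) (*-congˡ (apply-basis-vector e₁ j))) (*-congˡ (apply-basis-vector e₂ j)))))
      (cramer e₀ e₁ e₂ (basis-vector j) l)) (trans (*-congʳ D≈0) (zeroˡ _))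

  distinct⇒dual : ∀ {n} (F : Vector (LinearForm k) n) → GeneralPosition k F → ∀ {a b c} →
                  a ≢ b → a ≢ c → b ≢ c → Dual (F a) (F b) (F c)
  distinct⇒dual F (position , _) {a} {b} {c} a≢b a≢c b≢c = independent⇒dual (F ∘ (a ∷ b ∷ c ∷ [])) (position (a ∷ b ∷ c ∷ []) injective)
    where
    injective : ∀ {i j} → (a ∷ b ∷ c ∷ []) i ≡ (a ∷ b ∷ c ∷ []) j → i ≡ j
    injective {0F} {0F} _ = ≡.refl
    injective {0F} {1F} eq = contradiction eq a≢b
    injective {0F} {2F} eq = contradiction eq a≢c
    injective {1F} {0F} eq = contradiction (≡.sym eq) a≢b
    injective {1F} {1F} _ = ≡.refl
    injective {1F} {2F} eq = contradiction eq b≢c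
    injective {2F} {0F} eq = contradiction (≡.sym eq) a≢c
    injective {2F} {1F} eq = contradiction (≡.sym eq) b≢c
    injective {2F} {2F} _ = ≡.refl

  -- The determinant of `f`, `g` and the `l`-th basis vector is the `l`-th coordinate of their cross
  -- product.
  complete-pair : ∀ f g → ∃[ l ] cross f g l # 0# → ∃[ h ] Dual f g h
  complete-pair f g (l , fg#0) = basis-vector l , det-nonzero⇒dual (nonzero-cong (sym
    (trans (sym (det-rotate f g (basis-vector l))) (trans (sym (det-rotate g (basis-vector l) f)) (extract l)))) fg#0)
    where
    extract : ∀ l → det (basis-vector l) f g ≈ cross f g l
    extract 0F = solve 3 (λ x y z → con 1ℤ :* x :+ (con 0ℤ :* y :+ (con 0ℤ :* z :+ con 0ℤ)) := x) refl (cross f g 0F) (cross f g 1F) (cross f g 2F)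
    extract 1F = solve 3 (λ x y z → con 0ℤ :* x :+ (con 1ℤ :* y :+ (con 0ℤ :* z :+ con 0ℤ)) := y) refl (cross f g 0F) (cross f g 1F) (cross f g 2F)
    extract 2F = solve 3 (λ x y z → con 0ℤ :* x :+ (con 0ℤ :* y :+ (con 1ℤ :* z :+ con 0ℤ)) := z) refl (cross f g 0F) (cross f g 1F) (cross f g 2F)

  complete-one : ∀ f → ∃[ l ] f l # 0# → ∃[ g ] ∃[ h ] Dual f g h
  complete-one f (0F , f₀#0) = basis-vector 1F , complete-pair f (basis-vector 1F) (2F , nonzero-cong
    (solve 2 (λ x y → x := x :* con 1ℤ :- y :* con 0ℤ) refl (f 0F) (f 1F)) f₀#0)
  complete-one f (1F , f₁#0) = basis-vector 2F , complete-pair f (basis-vector 2F) (0F , nonzero-cong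
    (solve 2 (λ x y → x := x :* con 1ℤ :- y :* con 0ℤ) refl (f 1F) (f 2F)) f₁#0)
  complete-one f (2F , f₂#0) = basis-vector 0F , complete-pair f (basis-vector 0F) (1F , nonzero-cong
    (solve 2 (λ x y → x := x :* con 1ℤ :- y :* con 0ℤ) refl (f 2F) (f 0F)) f₂#0)

  module _ {f g h : LinearForm k} (D : Dual f g h) where
    open Dual D

    point : Carrier → Carrier → Carrier → Point k
    point a b c j = u j * a + v j * b + w j * c

    apply-point : ∀ e a b c → apply k e (point a b c) ≈ apply k e u * a + apply k e v * b + apply k e w * c
    apply-point e a b c =
      solve 15 (λ e₀ e₁ e₂ u₀ u₁ u₂ v₀ v₁ v₂ w₀ w₁ w₂ a b c →
        e₀ :* (u₀ :* a :+ v₀ :* b :+ w₀ :* c) :+ (e₁ :* (u₁ :* a :+ v₁ :* b :+ w₁ :* c) :+ (e₂ :* (u₂ :* a :+ v₂ :* b :+ w₂ :* c) :+ con 0ℤ)) :=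
        (e₀ :* u₀ :+ (e₁ :* u₁ :+ (e₂ :* u₂ :+ con 0ℤ))) :* a :+ (e₀ :* v₀ :+ (e₁ :* v₁ :+ (e₂ :* v₂ :+ con 0ℤ))) :* b
          :+ (e₀ :* w₀ :+ (e₁ :* w₁ :+ (e₂ :* w₂ :+ con 0ℤ))) :* c)
        refl (e 0F) (e 1F) (e 2F) (u 0F) (u 1F) (u 2F) (v 0F) (v 1F) (v 2F) (w 0F) (w 1F) (w 2F) a b c

    expand : ∀ e x → apply k e x ≈ apply k e u * apply k f x + apply k e v * apply k g x + apply k e w * apply k h x
    expand e x = trans (apply-cong e (decompose x)) (apply-point e _ _ _)

    common-zero : ∀ e x → apply k f x ≈ 0# → apply k g x ≈ 0# → apply k h x ≈ 0# → apply k e x ≈ 0#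
    common-zero e x fx gx hx = trans (expand e x)
      (trans (+-cong (+-cong (trans (*-congˡ fx) (zeroʳ _)) (trans (*-congˡ gx) (zeroʳ _))) (trans (*-congˡ hx) (zeroʳ _)))
        (trans (+-identityʳ _) (+-identityʳ _)))

    -- Three independent forms have no common zero but the origin. The form `e` only certifies that
    -- `x` is not the origin.
    nonzero-on-meet : ∀ e x → apply k g x ≈ 0# → apply k h x ≈ 0# → apply k e x # 0# → apply k f x # 0#
    nonzero-on-meet e x gx hx ex#0 = ≉0⇒nonzero λ fx → nonzero⇒≉0 ex#0 (common-zero e x fx gx hx)

    f-point : ∀ a b c → apply k f (point a b c) ≈ a
    f-point a b c = trans (apply-point f a b c) (trans (+-cong (+-cong (*-congʳ fu≈1) (*-congʳ fv≈0)) (*-congʳ fw≈0))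
      (solve 3 (λ a b c → con 1ℤ :* a :+ con 0ℤ :* b :+ con 0ℤ :* c := a) refl a b c))

    g-point : ∀ a b c → apply k g (point a b c) ≈ b
    g-point a b c = trans (apply-point g a b c) (trans (+-cong (+-cong (*-congʳ gu≈0) (*-congʳ gv≈1)) (*-congʳ gw≈0))
      (solve 3 (λ a b c → con 0ℤ :* a :+ con 1ℤ :* b :+ con 0ℤ :* c := b) refl a b c))

    h-point : ∀ a b c → apply k h (point a b c) ≈ c
    h-point a b c = trans (apply-point h a b c) (trans (+-cong (+-cong (*-congʳ hu≈0) (*-congʳ hv≈0)) (*-congʳ hw≈1))
      (solve 3 (λ a b c → con 0ℤ :* a :+ con 0ℤ :* b :+ con 1ℤ :* c := c) refl a b c))

-- S-integers, units and the equality of ideals.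

module Ideals {c ℓ₁ ℓ₂ : Level} (em : ExcludedMiddle (c ⊔ ℓ₁ ⊔ ℓ₂)) (k : NumberField c ℓ₁ ℓ₂) where
  open import Data.Vec.Functional using ([]; _∷_)
  open NumberField k hiding (zero)
  open IntegerSolver commutativeRing
  open Field em k
  open Places em k
  open RationalDependence em k using (ofℤ-nonzero)
  open Support em k
  open Density em k
  open LinearForms em k
  open Algebra.Properties.Semiring.Sum semiring using (sum-cong-≋; *-distribˡ-sum; ∑-distrib-+)
  open Relation.Binary.Reasoning.Setoid setoid

  module _ {S : List Place} where

    𝒪-0 : 0# ∈ 𝒪 k S
    𝒪-0 v _ = AtLeast-0 v

    𝒪-1 : 1# ∈ 𝒪 k S
    𝒪-1 v _ = AtLeast-1 v

    𝒪-+ : ∀ {x y} → x ∈ 𝒪 k S → y ∈ 𝒪 k S → x + y ∈ 𝒪 k S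
    𝒪-+ x∈ y∈ v v∉S = AtLeast-+ v (x∈ v v∉S) (y∈ v v∉S)

    𝒪-neg : ∀ {x} → x ∈ 𝒪 k S → - x ∈ 𝒪 k S
    𝒪-neg x∈ v v∉S = AtLeast-neg v (x∈ v v∉S)

    𝒪-^ : ∀ {x} → x ∈ 𝒪 k S → ∀ n → x ^ n ∈ 𝒪 k S
    𝒪-^ x∈ n v v∉S = AtLeast-^ v (x∈ v v∉S) n

    𝒪-apply : ∀ {f x} → (∀ j → f j ∈ 𝒪 k S) → (∀ j → x j ∈ 𝒪 k S) → apply k f x ∈ 𝒪 k S
    𝒪-apply {f} {x} f∈ x∈ v v∉S = AtLeast-sum v (λ j → f j * x j) (λ j → 𝒪-* {S} (f∈ j) (x∈ j) v v∉S)

    module _ {h : ℕ} (α : Vector Carrier h) where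

      gen-cong : ∀ {x y} → x ≈ y → x ∈ generated k S α → y ∈ generated k S α
      gen-cong x≈y (a , a∈ , x≈) = a , a∈ , trans (sym x≈y) x≈

      gen-0 : 0# ∈ generated k S α
      gen-0 = (λ _ → 0#) , (λ _ → 𝒪-0) , sym (trans (sym (*-distribˡ-sum 0# α)) (zeroˡ _))

      gen-+ : ∀ {x y} → x ∈ generated k S α → y ∈ generated k S α → x + y ∈ generated k S α
      gen-+ (a , a∈ , x≈) (b , b∈ , y≈) = (λ i → a i + b i) , (λ i → 𝒪-+ {a i} {b i} (a∈ i) (b∈ i)) ,
        trans (+-cong x≈ y≈) (trans (sym (∑-distrib-+ (λ i → a i * α i) (λ i → b i * α i)))
          (sum-cong-≋ (λ i → sym (distribʳ (α i) (a i) (b i)))))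

      gen-* : ∀ {r x} → r ∈ 𝒪 k S → x ∈ generated k S α → r * x ∈ generated k S α
      gen-* {r} r∈ (a , a∈ , x≈) = (λ i → r * a i) , (λ i → 𝒪-* {S} r∈ (a∈ i)) ,
        trans (*-congˡ x≈) (trans (*-distribˡ-sum r (λ i → a i * α i)) (sum-cong-≋ (λ i → sym (*-assoc r (a i) (α i)))))

      gen-sum : ∀ {m} (x : Vector Carrier m) → (∀ i → x i ∈ generated k S α) → sum x ∈ generated k S α
      gen-sum {zero}  x x∈ = gen-0
      gen-sum {suc m} x x∈ = gen-+ (x∈ zero) (gen-sum (tail x) (x∈ ∘ suc))

    gen-pair : ∀ {r s x y} → r ∈ 𝒪 k S → s ∈ 𝒪 k S → r * x + s * y ∈ generated k S (x ∷ y ∷ [])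
    gen-pair {r} {s} {x} {y} r∈ s∈ = (r ∷ s ∷ []) , (λ { 0F → r∈ ; 1F → s∈ }) ,
      +-congˡ (sym (+-identityʳ _))

    gen-triple : ∀ {r s t x y z} → r ∈ 𝒪 k S → s ∈ 𝒪 k S → t ∈ 𝒪 k S →
                 r * x + s * y + t * z ∈ generated k S (x ∷ y ∷ z ∷ [])
    gen-triple r∈ s∈ t∈ = (_ ∷ _ ∷ _ ∷ []) , (λ { 0F → r∈ ; 1F → s∈ ; 2F → t∈ }) ,
      trans (+-assoc _ _ _) (+-congˡ (+-congˡ (sym (+-identityʳ _))))

    gen-apply : ∀ (f : LinearForm k) (p : Point k) → (∀ j → f j ∈ 𝒪 k S) → apply k f p ∈ generated k S p
    gen-apply f p f∈ = f , f∈ , refl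

    -- The product on the right is generated by ab, b², ac = bg and bc.
    ideal-equality : ∀ (p : Point k) {a b c g} →
      a ∈ generated k S p → b ∈ generated k S p → c ∈ generated k S p → g ∈ generated k S p → a * c ≈ b * g →
      (∀ j → p j ∈ generated k S (a ∷ b ∷ c ∷ [])) →
      scale k b (generated k S p) ≐ _·_ k (generated k S (a ∷ b ∷ [])) (generated k S (b ∷ c ∷ []))
    ideal-equality p {a} {b} {c} {g} a∈ b∈ c∈ g∈ ac≈bg p∈ = left , right
      where
      left : ∀ {x} → scale k b (generated k S p) x → _·_ k (generated k S (a ∷ b ∷ [])) (generated k S (b ∷ c ∷ [])) x
      left {x} (y , (r , r∈ , y≈) , x≈by) with gen-cong (a ∷ b ∷ c ∷ []) (sym y≈) (gen-sum (a ∷ b ∷ c ∷ []) (λ j → r j * p j) (λ j → gen-* (a ∷ b ∷ c ∷ []) (r∈ j) (p∈ j)))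
      -- From y = s₀a + s₁b + s₂c one gets by = a(s₀b) + b(s₁b + s₂c), a sum of two products.
      ... | s , s∈ , y≈s = 2
          , (1# * a + 0# * b ∷ 0# * a + 1# * b ∷ [])
          , (s 0F * b + 0# * c ∷ s 1F * b + s 2F * c ∷ [])
          , (λ { 0F → gen-pair 𝒪-1 𝒪-0 ; 1F → gen-pair 𝒪-0 𝒪-1 })
          , (λ { 0F → gen-pair (s∈ 0F) 𝒪-0 ; 1F → gen-pair (s∈ 1F) (s∈ 2F) })
          , trans x≈by (trans (*-congˡ y≈s) (solve 6 (λ a b c s₀ s₁ s₂ →
              b :* (s₀ :* a :+ (s₁ :* b :+ (s₂ :* c :+ con 0ℤ))) :=
              (con 1ℤ :* a :+ con 0ℤ :* b) :* (s₀ :* b :+ con 0ℤ :* c) :+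
              ((con 0ℤ :* a :+ con 1ℤ :* b) :* (s₁ :* b :+ s₂ :* c) :+ con 0ℤ)) refl a b c (s 0F) (s 1F) (s 2F)))
      right : ∀ {x} → _·_ k (generated k S (a ∷ b ∷ [])) (generated k S (b ∷ c ∷ [])) x → scale k b (generated k S p) x
      right (m , A , B , A∈ , B∈ , x≈) = sum y , gen-sum p y y∈ , trans x≈ (trans (sum-cong-≋ AB≈by) (sym (*-distribˡ-sum b y)))
        where
        divided : ∀ i → ∃[ y ] y ∈ generated k S p × A i * B i ≈ b * y
        divided i with A∈ i | B∈ i
        ... | r , r∈ , Aᵢ≈ | t , t∈ , Bᵢ≈ =
          r 0F * t 0F * a + r 0F * t 1F * g + r 1F * t 0F * b + r 1F * t 1F * c
          , gen-+ p (gen-+ p (gen-+ p (gen-* p (𝒪-* {S} (r∈ 0F) (t∈ 0F)) a∈) (gen-* p (𝒪-* {S} (r∈ 0F) (t∈ 1F)) g∈))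
              (gen-* p (𝒪-* {S} (r∈ 1F) (t∈ 0F)) b∈)) (gen-* p (𝒪-* {S} (r∈ 1F) (t∈ 1F)) c∈)
          , (begin
            A i * B i ≈⟨ *-cong Aᵢ≈ Bᵢ≈ ⟩
            (r 0F * a + (r 1F * b + 0#)) * (t 0F * b + (t 1F * c + 0#))
              ≈⟨ solve 7 (λ a b c r₀ r₁ t₀ t₁ → (r₀ :* a :+ (r₁ :* b :+ con 0ℤ)) :* (t₀ :* b :+ (t₁ :* c :+ con 0ℤ)) :=
                   b :* (r₀ :* t₀ :* a :+ r₁ :* t₀ :* b :+ r₁ :* t₁ :* c) :+ r₀ :* t₁ :* (a :* c)) refl a b c (r 0F) (r 1F) (t 0F) (t 1F) ⟩
            b * (r 0F * t 0F * a + r 1F * t 0F * b + r 1F * t 1F * c) + r 0F * t 1F * (a * c)  ≈⟨ +-congˡ (*-congˡ ac≈bg) ⟩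
            b * (r 0F * t 0F * a + r 1F * t 0F * b + r 1F * t 1F * c) + r 0F * t 1F * (b * g)
              ≈⟨ solve 8 (λ a b c g r₀ r₁ t₀ t₁ → b :* (r₀ :* t₀ :* a :+ r₁ :* t₀ :* b :+ r₁ :* t₁ :* c) :+ r₀ :* t₁ :* (b :* g) :=
                   b :* (r₀ :* t₀ :* a :+ r₀ :* t₁ :* g :+ r₁ :* t₀ :* b :+ r₁ :* t₁ :* c)) refl a b c g (r 0F) (r 1F) (t 0F) (t 1F) ⟩
            b * (r 0F * t 0F * a + r 0F * t 1F * g + r 1F * t 0F * b + r 1F * t 1F * c) ∎)
        y : Vector Carrier m
        y i = proj₁ (divided i)
        y∈ : ∀ i → y i ∈ generated k S p
        y∈ i = proj₁ (proj₂ (divided i))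
        AB≈by : ∀ i → A i * B i ≈ b * y i
        AB≈by i = proj₂ (proj₂ (divided i))

  IntegralPoint : List Place → Point k → Set (c ⊔ ℓ₁ ⊔ ℓ₂)
  IntegralPoint S x = ∀ j → x j ∈ 𝒪 k S

  IntegralDual : ∀ {f g h} → Dual f g h → List Place → Set (c ⊔ ℓ₁ ⊔ ℓ₂)
  IntegralDual D S = IntegralPoint S (Dual.u D) × IntegralPoint S (Dual.v D) × IntegralPoint S (Dual.w D)

  eventually-integralPoint : ∀ x → Eventually (λ S → IntegralPoint S x)
  eventually-integralPoint x = eventually-∀ (λ j → eventually-integral (x j))

  eventually-integralDual : ∀ {f g h} (D : Dual f g h) → Eventually (IntegralDual D)
  eventually-integralDual D = eventually-× (eventually-integralPoint (Dual.u D))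
    (eventually-× (eventually-integralPoint (Dual.v D)) (eventually-integralPoint (Dual.w D)))

  𝒪-point : ∀ {S f g h} (D : Dual f g h) → IntegralDual D S → ∀ {a b c} → a ∈ 𝒪 k S → b ∈ 𝒪 k S → c ∈ 𝒪 k S →
            IntegralPoint S (point D a b c)
  𝒪-point {S} D (u∈ , v∈ , w∈) a∈ b∈ c∈ j =
    𝒪-+ {S} (𝒪-+ {S} (𝒪-* {S} (u∈ j) a∈) (𝒪-* {S} (v∈ j) b∈)) (𝒪-* {S} (w∈ j) c∈)

  IsUnit : List Place → Carrier → Set (c ⊔ ℓ₁ ⊔ ℓ₂)
  IsUnit S x = x ∈ 𝒪 k S × ∃[ y ] y ∈ 𝒪 k S × x * y ≈ 1#

  eventually-unit : ∀ {x} → x # 0# → Eventually (λ S → IsUnit S x)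
  eventually-unit {x} x#0 = eventually-map (λ S (x∈ , x⁻¹∈) → x∈ , x ⁻¹ , x⁻¹∈ , *-inverseʳ x#0)
    (eventually-× (eventually-integral x) (eventually-integral (x ⁻¹)))

  isUnit-^ : ∀ {S x} → IsUnit S x → ∀ n → IsUnit S (x ^ n)
  isUnit-^ {S} {x} (x∈ , y , y∈ , xy≈1) n = 𝒪-^ {S} x∈ n , y ^ n , 𝒪-^ {S} y∈ n , power n
    where
    power : ∀ n → x ^ n * y ^ n ≈ 1#
    power zero    = *-identityʳ 1#
    power (suc n) = trans (solve 4 (λ x y a b → (x :* a) :* (y :* b) := (x :* y) :* (a :* b)) refl x y (x ^ n) (y ^ n))
      (trans (*-cong xy≈1 (power n)) (*-identityʳ 1#))

  two-nonzero : two # 0#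
  two-nonzero = ofℤ-nonzero {+ 2} λ ()

  Conclusion : ∀ {n} .{{_ : NonZero n}} → Vector (LinearForm k) n → Set _
  Conclusion F = Σ[ S ∈ List Place ] DenseInℙ² k (Solutions k F S) × DenseIn𝔸³ k (Solutions k F S)

  conclude : ∀ {n} .{{_ : NonZero n}} (F : Vector (LinearForm k) n) p → Dominant p →
             Eventually (λ S → ∀ a b c → p (two ^ a) (two ^ b) (two ^ c) ∈ Solutions k F S) → Conclusion F
  conclude F p D (S , solutions) = S , dominant⇒dense p D (solutions S (λ v∈S → v∈S))

  module Consecutive {n : ℕ} .{{_ : NonZero n}} (F : Vector (LinearForm k) n)
    (D : ∀ i → Dual (F (prev i)) (F i) (F (next i))) where

    Good : List Place → Set (c ⊔ ℓ₁ ⊔ ℓ₂)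
    Good S = (∀ i → IntegralPoint S (F i)) × (∀ i → IntegralDual (D i) S)

    eventually-good : Eventually Good
    eventually-good = eventually-× (eventually-∀ (λ i → eventually-integralPoint (F i)))
      (eventually-∀ (λ i → eventually-integralDual (D i)))

    solution : ∀ {S p} → Good S → IntegralPoint S p →
      (∀ i → ∃[ g ] g ∈ generated k S p × apply k (F (prev i)) p * apply k (F (next i)) p ≈ apply k (F i) p * g) →
      p ∈ Solutions k F S
    solution {S} {p} (F∈ , D∈) p∈ quotient = p∈ , λ i → let (g , g∈ , eq) = quotient i in
      ideal-equality {S} p (gen-apply (F (prev i)) p (F∈ (prev i))) (gen-apply (F i) p (F∈ i)) (gen-apply (F (next i)) p (F∈ (next i))) g∈ eq
        λ j → gen-cong {S} (apply k (F (prev i)) p ∷ apply k (F i) p ∷ apply k (F (next i)) p ∷ []) (sym (Dual.decompose (D i) p j))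
          (gen-triple {S} (proj₁ (D∈ i) j) (proj₁ (proj₂ (D∈ i)) j) (proj₂ (proj₂ (D∈ i)) j))

-- At most three forms.

module UpToThree {c ℓ₁ ℓ₂ : Level} (em : ExcludedMiddle (c ⊔ ℓ₁ ⊔ ℓ₂)) (k : NumberField c ℓ₁ ℓ₂) where
  open import Data.Vec.Functional using ([]; _∷_)
  open NumberField k hiding (zero)
  open IntegerSolver commutativeRing
  open Field em k
  open Places em k
  open Support em k
  open Density em k
  open LinearForms em k
  open Ideals em k
  open Relation.Binary.Reasoning.Setoid setoid

  -- All values are `s` times a unit and `p` is `s` times an integral point, so (p) and both factors
  -- on the right are the ideal (s). The forms may coincide, as neighbours do for one or two forms.
  unit-values : ∀ {S} (p q : Point k) {s μ₁ μ₂ μ₃ x₁ x₂ x₃} → (∀ j → p j ≈ s * q j) → IntegralPoint S q →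
    IsUnit S μ₁ → IsUnit S μ₂ → IsUnit S μ₃ →
    x₁ ∈ generated k S p → x₂ ∈ generated k S p → x₃ ∈ generated k S p → x₁ ≈ s * μ₁ → x₂ ≈ s * μ₂ → x₃ ≈ s * μ₃ →
    scale k x₂ (generated k S p) ≐ _·_ k (generated k S (x₁ ∷ x₂ ∷ [])) (generated k S (x₂ ∷ x₃ ∷ []))
  unit-values {S} p q {s} {μ₁} {μ₂} {μ₃} {x₁} {x₂} {x₃} p≈sq q∈ (μ₁∈ , _) (_ , y , y∈ , μ₂y≈1) (μ₃∈ , _) x₁∈ x₂∈ x₃∈ x₁≈ x₂≈ x₃≈ =
    ideal-equality {S} p x₁∈ x₂∈ x₃∈ (gen-* {S} p (𝒪-* {S} (𝒪-* {S} μ₁∈ μ₃∈) (𝒪-* {S} y∈ y∈)) x₂∈)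
      (begin
        x₁ * x₃                                  ≈⟨ *-cong x₁≈ x₃≈ ⟩
        (s * μ₁) * (s * μ₃)                      ≈⟨ trans (sym (*-identityʳ _)) (*-congˡ (sym (trans (*-cong μ₂y≈1 μ₂y≈1) (*-identityʳ 1#)))) ⟩
        (s * μ₁) * (s * μ₃) * ((μ₂ * y) * (μ₂ * y))
          ≈⟨ solve 5 (λ s l r i y → (s :* l) :* (s :* r) :* ((i :* y) :* (i :* y)) := (s :* i) :* (((l :* r) :* (y :* y)) :* (s :* i)))
               refl s μ₁ μ₃ μ₂ y ⟩
        (s * μ₂) * (((μ₁ * μ₃) * (y * y)) * (s * μ₂)) ≈⟨ *-cong x₂≈ (*-congˡ x₂≈) ⟨
        x₂ * (((μ₁ * μ₃) * (y * y)) * x₂)        ∎)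
      λ j → gen-cong {S} (x₁ ∷ x₂ ∷ x₃ ∷ []) (combination j) (gen-triple {S} (𝒪-0 {S}) (𝒪-* {S} y∈ (q∈ j)) (𝒪-0 {S}))
    where
    combination : ∀ j → 0# * x₁ + (y * q j) * x₂ + 0# * x₃ ≈ p j
    combination j = begin
      0# * x₁ + (y * q j) * x₂ + 0# * x₃
        ≈⟨ solve 5 (λ a b c y q → con 0ℤ :* a :+ (y :* q) :* b :+ con 0ℤ :* c := (y :* b) :* q) refl x₁ x₂ x₃ y (q j) ⟩
      (y * x₂) * q j    ≈⟨ *-congʳ (trans (*-congˡ x₂≈) (trans
        (solve 3 (λ y s m → y :* (s :* m) := (m :* y) :* s) refl y s μ₂) (trans (*-congʳ μ₂y≈1) (*-identityˡ s)))) ⟩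
      s * q j           ≈⟨ p≈sq j ⟨
      p j               ∎

  module UnitValues {e₀ e₁ e₂ : LinearForm k} (D : Dual e₀ e₁ e₂) where
    open Dual D

    E : Vector (LinearForm k) 3
    E = e₀ ∷ e₁ ∷ e₂ ∷ []

    family : Carrier → Carrier → Carrier → Point k
    family s a b = point D s (s * a) (s * b)

    dominant : Dominant family
    dominant = record
      { poly₁ = λ a b j → poly-+ (poly-+ (poly-* (poly-const (u j)) poly-id)
          (poly-* (poly-const (v j)) (poly-* poly-id (poly-const a)))) (poly-* (poly-const (w j)) (poly-* poly-id (poly-const b)))
      ; poly₂ = λ s b j → poly-+ (poly-+ (poly-const (u j * s))
          (poly-* (poly-const (v j)) (poly-* (poly-const s) poly-id))) (poly-const (w j * (s * b)))
      ; poly₃ = λ s a j → poly-+ (poly-const (u j * s + v j * (s * a))) (poly-* (poly-const (w j)) (poly-* (poly-const s) poly-id))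
      ; locus = apply k e₀
      ; locus-generic = regular-apply e₀ , u , nonzero-cong (sym fu≈1) 1-nonzero
      ; preimage = λ x x₀#0 → apply k e₀ x , apply k e₁ x * apply k e₀ x ⁻¹ , apply k e₂ x * apply k e₀ x ⁻¹ , λ j →
          trans (+-cong (+-congˡ (*-congˡ (cancel-inverse x₀#0))) (*-congˡ (cancel-inverse x₀#0))) (sym (decompose x j)) }

    conclusion : ∀ {n} .{{_ : NonZero n}} (F : Vector (LinearForm k) n) (τ : Fin n → Fin 3) →
                 (∀ i x → apply k (F i) x ≈ apply k (E (τ i)) x) → Conclusion F
    conclusion {n} F τ F≈E = conclude F family dominant (eventually-map (λ S (F∈ , D∈ , 2-unit) a b c →
        solutions S F∈ D∈ (isUnit-^ {S} 2-unit a) (isUnit-^ {S} 2-unit b) (isUnit-^ {S} 2-unit c))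
      (eventually-× (eventually-∀ (λ i → eventually-integralPoint (F i)))
        (eventually-× (eventually-integralDual D) (eventually-unit two-nonzero))))
      where
      solutions : ∀ S → (∀ i → IntegralPoint S (F i)) → IntegralDual D S →
                  ∀ {s a b} → IsUnit S s → IsUnit S a → IsUnit S b → family s a b ∈ Solutions k F S
      solutions S F∈ D∈ {s} {a} {b} s-unit a-unit b-unit = p∈ , λ i →
        unit-values p q p≈sq q∈ (μ-unit (τ (prev i))) (μ-unit (τ i)) (μ-unit (τ (next i)))
          (gen-apply (F (prev i)) p (F∈ (prev i))) (gen-apply (F i) p (F∈ i)) (gen-apply (F (next i)) p (F∈ (next i)))
          (value (prev i)) (value i) (value (next i))
        where
        p q : Point k
        p = family s a b
        q = point D 1# a b
        μ : Fin 3 → Carrier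
        μ = 1# ∷ a ∷ b ∷ []
        μ-unit : ∀ i → IsUnit S (μ i)
        μ-unit 0F = 𝒪-1 {S} , 1# , 𝒪-1 {S} , *-identityʳ 1#
        μ-unit 1F = a-unit
        μ-unit 2F = b-unit
        value-E : ∀ i → apply k (E i) p ≈ s * μ i
        value-E 0F = trans (f-point D _ _ _) (sym (*-identityʳ s))
        value-E 1F = g-point D _ _ _
        value-E 2F = h-point D _ _ _
        value : ∀ i → apply k (F i) p ≈ s * μ (τ i)
        value i = trans (F≈E i p) (value-E (τ i))
        p∈ : IntegralPoint S p
        p∈ = 𝒪-point {S} D D∈ (proj₁ s-unit) (𝒪-* {S} (proj₁ s-unit) (proj₁ a-unit)) (𝒪-* {S} (proj₁ s-unit) (proj₁ b-unit))
        q∈ : IntegralPoint S q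
        q∈ = 𝒪-point {S} D D∈ (𝒪-1 {S}) (proj₁ a-unit) (proj₁ b-unit)
        p≈sq : ∀ j → p j ≈ s * q j
        p≈sq j = solve 6 (λ s u v w a b → u :* s :+ v :* (s :* a) :+ w :* (s :* b) := s :* (u :* con 1ℤ :+ v :* a :+ w :* b))
          refl s (u j) (v j) (w j) a b

  one-form : (F : Vector (LinearForm k) 1) → GeneralPosition k F → Conclusion F
  one-form F (_ , independent) = finish (complete-one (F 0F) (∃-nonzero-coordinate (F 0F) nonzero))
    where
    nonzero : ¬ (∀ j → F 0F j ≈ 0#)
    nonzero F≈0 = nonzero⇒≉0 1-nonzero (independent (ℕ.s≤s (ℕ.s≤s ℕ.z≤n)) (λ _ → 1#)
      (λ j → trans (+-identityʳ _) (trans (*-identityˡ _) (F≈0 j))) 0F)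
    finish : ∃[ e₁ ] ∃[ e₂ ] Dual (F 0F) e₁ e₂ → Conclusion F
    finish (_ , _ , D) = UnitValues.conclusion D F (λ _ → 0F) (λ { 0F x → refl })

  two-forms : (F : Vector (LinearForm k) 2) → GeneralPosition k F → Conclusion F
  two-forms F (_ , independent) = finish (complete-pair (F 0F) (F 1F) (pair⇒cross-nonzero (F 0F) (F 1F) pair))
    where
    pair : ∀ s t → (∀ j → s * F 0F j + t * F 1F j ≈ 0#) → s ≈ 0# × t ≈ 0#
    pair s t eq = coefficients 0F , coefficients 1F
      where
      coefficients : ∀ i → (s ∷ t ∷ []) i ≈ 0#
      coefficients = independent (ℕ.s≤s (ℕ.s≤s (ℕ.s≤s ℕ.z≤n))) (s ∷ t ∷ []) (λ j → trans (+-congˡ (+-identityʳ _)) (eq j))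
    finish : ∃[ e₂ ] Dual (F 0F) (F 1F) e₂ → Conclusion F
    finish (_ , D) = UnitValues.conclusion D F (λ { 0F → 0F ; 1F → 1F }) (λ { 0F x → refl ; 1F x → refl })

  three-forms : (F : Vector (LinearForm k) 3) → GeneralPosition k F → Conclusion F
  three-forms F position = UnitValues.conclusion (distinct⇒dual F position {0F} {1F} {2F} (λ ()) (λ ()) (λ ())) F (λ i → i)
    (λ { 0F x → refl ; 1F x → refl ; 2F x → refl })

-- Four forms.

module Four {c ℓ₁ ℓ₂ : Level} (em : ExcludedMiddle (c ⊔ ℓ₁ ⊔ ℓ₂)) (k : NumberField c ℓ₁ ℓ₂) where
  open import Data.Vec.Functional using ([]; _∷_)
  open NumberField k hiding (zero)
  open IntegerSolver commutativeRing
  open Field em k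
  open Places em k
  open Support em k
  open Density em k
  open LinearForms em k
  open Ideals em k
  open Relation.Binary.Reasoning.Setoid setoid

  module FourForms (F : Vector (LinearForm k) 4) (position : GeneralPosition k F) where
    D : ∀ i → Dual (F (prev i)) (F i) (F (next i))
    D 0F = distinct⇒dual F position (λ ()) (λ ()) (λ ())
    D 1F = distinct⇒dual F position (λ ()) (λ ()) (λ ())
    D 2F = distinct⇒dual F position (λ ()) (λ ()) (λ ())
    D 3F = distinct⇒dual F position (λ ()) (λ ()) (λ ())
    open Consecutive F D
    open Dual (D 1F)

    value : Fin 4 → Point k → Carrier
    value i = apply k (F i)

    α β γ : Carrier
    α = value 3F u
    β = value 3F v
    γ = value 3F w

    α-nonzero : α # 0#
    α-nonzero = nonzero-on-meet (distinct⇒dual F position {3F} {1F} {2F} (λ ()) (λ ()) (λ ())) (F 0F) u gu≈0 hu≈0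
      (nonzero-cong (sym fu≈1) 1-nonzero)

    -- The line F₁ = m F₀ through one vertex and the line F₂ = c F₃ through the opposite one meet in
    -- a point of the conic F₀F₂ = (c / m) F₁F₃. The coordinates come from inserting F₃ = α F₀ + β
    -- F₁ + γ F₂ into the second equation; `s` scales them.
    family : Carrier → Carrier → Carrier → Point k
    family s m c = point (D 1F) (s * (γ * c - 1#)) (s * m * (γ * c - 1#)) (- (s * c * (α + β * m)))

    dominant : Dominant family
    dominant = record
      { poly₁ = λ m c j → poly-+ (poly-+ (poly-* (poly-const (u j)) (poly-* poly-id (poly-const (γ * c - 1#))))
          (poly-* (poly-const (v j)) (poly-* (poly-* poly-id (poly-const m)) (poly-const (γ * c - 1#)))))
          (poly-* (poly-const (w j)) (poly-neg (poly-* (poly-* poly-id (poly-const c)) (poly-const (α + β * m)))))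
      ; poly₂ = λ s c j → poly-+ (poly-+ (poly-const (u j * (s * (γ * c - 1#))))
          (poly-* (poly-const (v j)) (poly-* (poly-* (poly-const s) poly-id) (poly-const (γ * c - 1#)))))
          (poly-* (poly-const (w j)) (poly-neg (poly-* (poly-const (s * c)) (poly-+ (poly-const α) (poly-* (poly-const β) poly-id)))))
      ; poly₃ = λ s m j → poly-+ (poly-+ (poly-* (poly-const (u j)) (poly-* (poly-const s) γc-1))
          (poly-* (poly-const (v j)) (poly-* (poly-const (s * m)) γc-1)))
          (poly-* (poly-const (w j)) (poly-neg (poly-* (poly-* (poly-const s) poly-id) (poly-const (α + β * m)))))
      ; locus = λ x → value 0F x * (value 3F x * (α * value 0F x + β * value 1F x))
      ; locus-generic = generic-* (regular-apply (F 0F) , u , nonzero-cong (sym fu≈1) 1-nonzero) (generic-*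
          (regular-apply (F 3F) , u , α-nonzero)
          (regular-+ (regular-* (regular-const α) (regular-apply (F 0F))) (regular-* (regular-const β) (regular-apply (F 1F)))
          , u , nonzero-cong (sym (trans (+-cong (*-congˡ fu≈1) (*-congˡ gu≈0))
              (solve 2 (λ a b → a :* con 1ℤ :+ b :* con 0ℤ := a) refl α β))) α-nonzero))
      ; preimage = λ x G#0 → preimage x (*-nonzeroˡ G#0) (*-nonzeroˡ (*-nonzeroʳ G#0)) (*-nonzeroʳ (*-nonzeroʳ G#0)) }
      where
      γc-1 : Poly (λ c → γ * c - 1#)
      γc-1 = poly-+ (poly-* (poly-const γ) poly-id) (poly-const (- 1#))
      preimage : ∀ x → value 0F x # 0# → value 3F x # 0# → α * value 0F x + β * value 1F x # 0# →
                 ∃[ s ] ∃[ m ] ∃[ c ] family s m c ≈ᵥ x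
      preimage x f₀#0 f₃#0 d#0 = s , m , n , λ j → trans
          (+-cong (+-cong (*-congˡ sb≈f₀) (*-congˡ (begin
            s * m * (γ * n - 1#)    ≈⟨ solve 3 (λ s m b → s :* m :* b := m :* (s :* b)) refl s m (γ * n - 1#) ⟩
            m * (s * (γ * n - 1#))  ≈⟨ *-congˡ sb≈f₀ ⟩
            f₁ * i₀ * f₀            ≈⟨ solve 3 (λ x y z → x :* y :* z := (z :* y) :* x) refl f₁ i₀ f₀ ⟩
            f₀ * i₀ * f₁            ≈⟨ *-congʳ (*-inverseʳ f₀#0) ⟩
            1# * f₁                 ≈⟨ *-identityˡ f₁ ⟩
            f₁                      ∎))) (*-congˡ (begin
            - (s * n * (α + β * m)) ≈⟨ solve 8 (λ f₀ i₀ f₁ f₂ f₃ i₃ e ab →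
                                         :- ((:- (f₃ :* f₀ :* e)) :* (f₂ :* i₃) :* ab) := (f₃ :* i₃) :* (e :* (f₀ :* ab)) :* f₂)
                                         refl f₀ i₀ f₁ f₂ f₃ i₃ (d ⁻¹) (α + β * m) ⟩
            (f₃ * i₃) * (d ⁻¹ * (f₀ * (α + β * m))) * f₂ ≈⟨ *-congʳ (*-cong (*-inverseʳ f₃#0) (*-congˡ f₀ab≈d)) ⟩
            1# * (d ⁻¹ * d) * f₂    ≈⟨ *-congʳ (*-congˡ (*-inverseˡ d#0)) ⟩
            1# * 1# * f₂            ≈⟨ trans (*-congʳ (*-identityʳ 1#)) (*-identityˡ f₂) ⟩
            f₂                      ∎)))
          (sym (decompose x j))
        where
        f₀ f₁ f₂ f₃ i₀ i₃ d s m n : Carrier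
        f₀ = value 0F x
        f₁ = value 1F x
        f₂ = value 2F x
        f₃ = value 3F x
        i₀ = f₀ ⁻¹
        i₃ = f₃ ⁻¹
        d = α * f₀ + β * f₁
        -- Forced by `s * (γ * n - 1#)` being `f₀`, because `γ * f₂ - f₃` is `- d`.
        s = - (f₃ * f₀ * d ⁻¹)
        m = f₁ * i₀
        n = f₂ * i₃
        f₀ab≈d : f₀ * (α + β * m) ≈ d
        f₀ab≈d = trans (solve 5 (λ f₀ i₀ f₁ a b → f₀ :* (a :+ b :* (f₁ :* i₀)) := a :* f₀ :+ b :* f₁ :* (f₀ :* i₀)) refl f₀ i₀ f₁ α β)
          (+-congˡ (trans (*-congˡ (*-inverseʳ f₀#0)) (*-identityʳ _)))
        γf₂-f₃≈-d : γ * f₂ - f₃ ≈ - d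
        γf₂-f₃≈-d = trans (+-congˡ (-‿cong (expand (D 1F) (F 3F) x)))
          (solve 6 (λ a b g x y z → g :* z :- (a :* x :+ b :* y :+ g :* z) := :- (a :* x :+ b :* y)) refl α β γ f₀ f₁ f₂)
        sb≈f₀ : s * (γ * n - 1#) ≈ f₀
        sb≈f₀ = begin
          s * (γ * n - 1#)      ≈⟨ *-congˡ (+-congˡ (-‿cong (sym (*-inverseʳ f₃#0)))) ⟩
          s * (γ * n - f₃ * i₃) ≈⟨ solve 6 (λ f₃ f₀ e g f₂ i₃ → (:- (f₃ :* f₀ :* e)) :* (g :* (f₂ :* i₃) :- f₃ :* i₃) :=
                                     (f₃ :* i₃) :* (e :* (:- (g :* f₂ :- f₃))) :* f₀) refl f₃ f₀ (d ⁻¹) γ f₂ i₃ ⟩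
          (f₃ * i₃) * (d ⁻¹ * - (γ * f₂ - f₃)) * f₀ ≈⟨ *-congʳ (*-cong (*-inverseʳ f₃#0) (*-congˡ (trans (-‿cong γf₂-f₃≈-d) (solve 1 (λ d → :- (:- d) := d) refl d)))) ⟩
          1# * (d ⁻¹ * d) * f₀  ≈⟨ *-congʳ (*-congˡ (*-inverseˡ d#0)) ⟩
          1# * 1# * f₀          ≈⟨ trans (*-congʳ (*-identityʳ 1#)) (*-identityˡ f₀) ⟩
          f₀                    ∎

    conclusion : Conclusion F
    conclusion = conclude F family dominant (eventually-map (λ S (good , 2-unit) a b c →
        solutions S good (isUnit-^ {S} 2-unit a) (isUnit-^ {S} 2-unit b) (isUnit-^ {S} 2-unit c))
      (eventually-× eventually-good (eventually-unit two-nonzero)))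
      where
      solutions : ∀ S → Good S → ∀ {s m c} → IsUnit S s → IsUnit S m → IsUnit S c → family s m c ∈ Solutions k F S
      solutions S good@(F∈ , D∈) {s} {m} {c} (s∈ , _) (m∈ , m⁻¹ , m⁻¹∈ , mm⁻¹≈1) (c∈ , c⁻¹ , c⁻¹∈ , cc⁻¹≈1) =
        solution {S} {p} good p∈ λ
          -- Each form is a unit times one of its neighbours, so the quotient is a unit times the
          -- other neighbour.
          { 0F → _ , gen-* {S} p m∈ (gen-apply (F 3F) p (F∈ 3F)) , trans (*-congˡ f₁≈mf₀)
              (solve 3 (λ m x y → y :* (m :* x) := x :* (m :* y)) refl m (value 0F p) (value 3F p))
          ; 1F → _ , gen-* {S} p m⁻¹∈ (gen-apply (F 2F) p (F∈ 2F)) , sym (trans (*-congʳ f₁≈mf₀) (trans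
              (solve 4 (λ m i x y → (m :* x) :* (i :* y) := (m :* i) :* (x :* y)) refl m m⁻¹ (value 0F p) (value 2F p))
              (trans (*-congʳ mm⁻¹≈1) (*-identityˡ _))))
          ; 2F → _ , gen-* {S} p c⁻¹∈ (gen-apply (F 1F) p (F∈ 1F)) , sym (trans (*-congʳ f₂≈cf₃) (trans
              (solve 4 (λ m i x y → (m :* x) :* (i :* y) := (m :* i) :* (y :* x)) refl c c⁻¹ (value 3F p) (value 1F p))
              (trans (*-congʳ cc⁻¹≈1) (*-identityˡ _))))
          ; 3F → _ , gen-* {S} p c∈ (gen-apply (F 0F) p (F∈ 0F)) , trans (*-congʳ f₂≈cf₃)
              (solve 3 (λ c x y → (c :* x) :* y := x :* (c :* y)) refl c (value 3F p) (value 0F p)) }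
        where
        p : Point k
        p = family s m c
        α∈ : α ∈ 𝒪 k S
        α∈ = 𝒪-apply {S} (F∈ 3F) (proj₁ (D∈ 1F))
        β∈ : β ∈ 𝒪 k S
        β∈ = 𝒪-apply {S} (F∈ 3F) (proj₁ (proj₂ (D∈ 1F)))
        γ∈ : γ ∈ 𝒪 k S
        γ∈ = 𝒪-apply {S} (F∈ 3F) (proj₂ (proj₂ (D∈ 1F)))
        b∈ : γ * c - 1# ∈ 𝒪 k S
        b∈ = 𝒪-+ {S} (𝒪-* {S} γ∈ c∈) (𝒪-neg {S} (𝒪-1 {S}))
        p∈ : IntegralPoint S p
        p∈ = 𝒪-point {S} (D 1F) (D∈ 1F) (𝒪-* {S} s∈ b∈) (𝒪-* {S} (𝒪-* {S} s∈ m∈) b∈)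
          (𝒪-neg {S} (𝒪-* {S} (𝒪-* {S} s∈ c∈) (𝒪-+ {S} α∈ (𝒪-* {S} β∈ m∈))))
        f₁≈mf₀ : value 1F p ≈ m * value 0F p
        f₁≈mf₀ = trans (g-point (D 1F) _ _ _) (trans (solve 3 (λ s m b → s :* m :* b := m :* (s :* b)) refl s m (γ * c - 1#))
          (*-congˡ (sym (f-point (D 1F) _ _ _))))
        f₂≈cf₃ : value 2F p ≈ c * value 3F p
        f₂≈cf₃ = trans (h-point (D 1F) _ _ _) (trans
          (solve 6 (λ s m c a b g → :- (s :* c :* (a :+ b :* m)) :=
            c :* (a :* (s :* (g :* c :- con 1ℤ)) :+ b :* (s :* m :* (g :* c :- con 1ℤ)) :+ g :* (:- (s :* c :* (a :+ b :* m)))))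
            refl s m c α β γ)
          (*-congˡ (sym (apply-point (D 1F) (F 3F) _ _ _))))

-- The A₂ exchange relations and the conic through the vertices.

module Pentagon {c ℓ₁ ℓ₂ : Level} (em : ExcludedMiddle (c ⊔ ℓ₁ ⊔ ℓ₂)) (k : NumberField c ℓ₁ ℓ₂) where
  open import Data.Vec.Functional using ([]; _∷_)
  open NumberField k hiding (zero)
  open IntegerSolver commutativeRing
  open Field em k
  open Relation.Binary.Reasoning.Setoid setoid

  -- The exchange relations of the cluster algebra of type A₂, with the cluster
  -- variable y_j at index j / 2 modulo 5, so that the factors of each product are
  -- neighbours.
  Exchange : Vector Carrier 5 → Fin 5 → Set ℓ₁
  Exchange z i = z i * z (next i) ≈ z (prev (prev i)) + 1#

  -- This expansion takes one coefficient from each solution and so has no quadratic term. It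
  -- provides the first two hypotheses of `neighbours`.
  product-difference : ∀ {x y t x′ y′ t′} → x * y ≈ t + 1# → x′ * y′ ≈ t′ + 1# → t - t′ ≈ x * (y - y′) + y′ * (x - x′)
  product-difference {x} {y} {t} {x′} {y′} {t′} xy x′y′ = begin
    t - t′                           ≈⟨ solve 2 (λ t s → t :- s := (t :+ con 1ℤ) :- (s :+ con 1ℤ)) refl t t′ ⟩
    (t + 1#) - (t′ + 1#)             ≈⟨ +-cong xy (-‿cong x′y′) ⟨
    x * y - x′ * y′                  ≈⟨ solve 4 (λ x y z w → x :* y :- z :* w := x :* (y :- w) :+ w :* (x :- z)) refl x y x′ y′ ⟩
    x * (y - y′) + y′ * (x - x′)     ∎

  -- Expansion about the second solution leaves the product of the differences as the only quadratic
  -- term.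
  product-difference′ : ∀ {x y t x′ y′ t′} → x * y ≈ t + 1# → x′ * y′ ≈ t′ + 1# →
                        (x - x′) * (y - y′) ≈ (t - t′) - y′ * (x - x′) - x′ * (y - y′)
  product-difference′ {x} {y} {t} {x′} {y′} {t′} xy x′y′ = sym (begin
    (t - t′) - y′ * (x - x′) - x′ * (y - y′)
      ≈⟨ +-congʳ (+-congʳ (product-difference xy x′y′)) ⟩
    x * (y - y′) + y′ * (x - x′) - y′ * (x - x′) - x′ * (y - y′)
      ≈⟨ solve 4 (λ x y z w → x :* (y :- w) :+ w :* (x :- z) :- w :* (x :- z) :- z :* (y :- w) := (x :- z) :* (y :- w)) refl x y x′ y′ ⟩
    (x - x′) * (y - y′) ∎)

  -- In the order y₁, …, y₅ of the A₂ recursion, the product d₁d₂ of neighbours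
  -- is a combination of the products dⱼdⱼ₊₂: eliminate d₁² between
  -- d₁d₂ = q₃d₁² + y₁d₁d₃ and d₁² = q₂d₁d₅ + q₅d₁d₂ + d₁d₂d₅.
  neighbours : ∀ {d₁ d₂ d₃ d₄ d₅ y₁ q₁ q₂ q₃ q₄ q₅} →
    d₂ ≈ y₁ * d₃ + q₃ * d₁ → d₅ ≈ y₁ * d₄ + q₄ * d₁ → d₅ * d₂ ≈ d₁ - q₂ * d₅ - q₅ * d₂ →
    q₄ * q₁ ≈ q₅ + 1# → q₂ * q₄ ≈ q₃ + 1# →
    (q₁ * q₄) * (d₁ * d₂) ≈ (q₁ * q₄ * y₁ - q₅ * y₁) * (d₁ * d₃) - (q₂ * y₁) * (d₄ * d₁) - d₁ * (d₅ * d₂)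
  neighbours {d₁} {d₂} {d₃} {d₄} {d₅} {y₁} {q₁} {q₂} {q₃} {q₄} {q₅} d₂≈ d₅≈ d₅d₂≈ q₄q₁≈ q₂q₄≈ = sym (begin
    (q₁ * q₄ * y₁ - q₅ * y₁) * (d₁ * d₃) - (q₂ * y₁) * (d₄ * d₁) - d₁ * (d₅ * d₂)
      ≈⟨ +-congˡ (-‿cong (*-congˡ (trans d₅d₂≈ (+-cong (+-congˡ (-‿cong (*-congˡ d₅≈))) (-‿cong (*-congˡ d₂≈)))))) ⟩
    (q₁ * q₄ * y₁ - q₅ * y₁) * (d₁ * d₃) - (q₂ * y₁) * (d₄ * d₁)
      - d₁ * (d₁ - q₂ * (y₁ * d₄ + q₄ * d₁) - q₅ * (y₁ * d₃ + q₃ * d₁))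
      ≈⟨ solve 9 (λ d₁ d₃ d₄ y₁ r q₂ q₃ q₄ q₅ → (r :* y₁ :- q₅ :* y₁) :* (d₁ :* d₃) :- (q₂ :* y₁) :* (d₄ :* d₁)
           :- d₁ :* (d₁ :- q₂ :* (y₁ :* d₄ :+ q₄ :* d₁) :- q₅ :* (y₁ :* d₃ :+ q₃ :* d₁)) :=
           r :* (d₁ :* (y₁ :* d₃)) :+ (q₂ :* q₄ :+ q₃ :* q₅ :- con 1ℤ) :* (d₁ :* d₁)) refl d₁ d₃ d₄ y₁ (q₁ * q₄) q₂ q₃ q₄ q₅ ⟩
    (q₁ * q₄) * (d₁ * (y₁ * d₃)) + (q₂ * q₄ + q₃ * q₅ - 1#) * (d₁ * d₁)
      ≈⟨ +-congˡ (*-congʳ (trans (+-congʳ (+-congʳ q₂q₄≈)) (trans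
           (solve 2 (λ x y → x :+ con 1ℤ :+ x :* y :- con 1ℤ := x :* (y :+ con 1ℤ)) refl q₃ q₅) (*-congˡ (sym q₄q₁≈))))) ⟩
    (q₁ * q₄) * (d₁ * (y₁ * d₃)) + (q₃ * (q₄ * q₁)) * (d₁ * d₁)
      ≈⟨ solve 6 (λ d₁ d₃ y₁ q₁ q₃ q₄ → (q₁ :* q₄) :* (d₁ :* (y₁ :* d₃)) :+ (q₃ :* (q₄ :* q₁)) :* (d₁ :* d₁) :=
           (q₁ :* q₄) :* (d₁ :* (y₁ :* d₃ :+ q₃ :* d₁))) refl d₁ d₃ y₁ q₁ q₃ q₄ ⟩
    (q₁ * q₄) * (d₁ * (y₁ * d₃ + q₃ * d₁))   ≈⟨ *-congˡ (*-congˡ d₂≈) ⟨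
    (q₁ * q₄) * (d₁ * d₂)                    ∎)

  module Centred (ε : Vector Carrier 5) where

    offset : Vector Carrier 5 → Vector Carrier 5
    offset z i = z i - ε i

    linear : Vector Carrier 5 → Fin 5 → Carrier
    linear e i = e (prev (prev i)) - ε (next i) * e i - ε i * e (next i)

    product≈linear : ∀ {z} i → Exchange z i → Exchange ε i → offset z i * offset z (next i) ≈ linear (offset z) i
    product≈linear i = product-difference′

    -- uv z as polynomials in u = z 2 and v = z 4
    cleared : Carrier → Carrier → Vector Carrier 5
    cleared u v = u * (u + 1#) ∷ v * (v + 1#) ∷ u * u * v ∷ u + v + 1# ∷ u * v * v ∷ []

    form : Carrier → Carrier → Fin 5 → Carrier
    form u v = linear (λ i → cleared u v i - ε i * (u * v))

    -- The entries 2 and 4 form a cluster: the exchange relations 4, 1 and 3 yield the entries 0, 1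
    -- and 3 as Laurent polynomials in them, with denominators dividing their product.
    cleared≈ : ∀ {z} → Exchange z 1F → Exchange z 3F → Exchange z 4F → ∀ i → cleared (z 2F) (z 4F) i ≈ (z 2F * z 4F) * z i
    cleared≈ {z} x₁ x₃ x₄ 0F = trans (*-congˡ (sym x₄)) (solve 3 (λ u v z → u :* (v :* z) := u :* v :* z) refl (z 2F) (z 4F) (z 0F))
    cleared≈ {z} x₁ x₃ x₄ 1F = trans (*-congˡ (sym x₁)) (solve 3 (λ u v z → v :* (z :* u) := u :* v :* z) refl (z 2F) (z 4F) (z 1F))
    cleared≈ {z} x₁ x₃ x₄ 2F = solve 2 (λ u v → u :* u :* v := u :* v :* u) refl (z 2F) (z 4F)
    cleared≈ {z} x₁ x₃ x₄ 3F = sym (begin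
      (z 2F * z 4F) * z 3F        ≈⟨ solve 3 (λ u v z → u :* v :* z := u :* (z :* v)) refl (z 2F) (z 4F) (z 3F) ⟩
      z 2F * (z 3F * z 4F)        ≈⟨ *-congˡ x₃ ⟩
      z 2F * (z 1F + 1#)          ≈⟨ solve 2 (λ u z → u :* (z :+ con 1ℤ) := u :+ z :* u) refl (z 2F) (z 1F) ⟩
      z 2F + z 1F * z 2F          ≈⟨ +-congˡ x₁ ⟩
      z 2F + (z 4F + 1#)          ≈⟨ +-assoc _ _ _ ⟨
      z 2F + z 4F + 1#            ∎)
    cleared≈ {z} x₁ x₃ x₄ 4F = refl

    form≈ : ∀ {z} → Exchange z 1F → Exchange z 3F → Exchange z 4F → ∀ i → Exchange z i → Exchange ε i →
            form (z 2F) (z 4F) i ≈ (z 2F * z 4F) * (offset z i * offset z (next i))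
    form≈ {z} x₁ x₃ x₄ i xᵢ εᵢ = trans (+-cong (+-cong (e≈ (prev (prev i))) (-‿cong (*-congˡ (e≈ i)))) (-‿cong (*-congˡ (e≈ (next i)))))
      (trans (solve 6 (λ t e₃ ε′ e ε e′ → t :* e₃ :- ε′ :* (t :* e) :- ε :* (t :* e′) := t :* (e₃ :- ε′ :* e :- ε :* e′)) refl
        (z 2F * z 4F) (offset z (prev (prev i))) (ε (next i)) (offset z i) (ε i) (offset z (next i)))
      (*-congˡ (sym (product≈linear {z} i xᵢ εᵢ))))
      where
      e≈ : ∀ j → cleared (z 2F) (z 4F) j - ε j * (z 2F * z 4F) ≈ (z 2F * z 4F) * offset z j
      e≈ j = trans (+-congʳ (cleared≈ {z} x₁ x₃ x₄ j))
        (solve 3 (λ t z e → t :* z :- e :* t := t :* (z :- e)) refl (z 2F * z 4F) (z j) (ε j))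

    module _ {e : Vector Carrier 5} (ε-exchange : ∀ i → Exchange ε i) where

      -- Five forms in a space of dimension three satisfy two relations. This one and the next
      -- express the forms 0 and 2 through 1, 3 and 4, for an arbitrary vector `e`: its coefficients
      -- match by the exchange relations of `ε`.
      linear-relation₀ : linear e 1F - linear e 3F + ε 1F * linear e 4F ≈ ε 4F * linear e 0F
      linear-relation₀ = begin
        linear e 1F - linear e 3F + ε 1F * linear e 4F
          ≈⟨ solve 10 (λ e₀ e₁ e₂ e₃ e₄ q₀ q₁ q₂ q₃ q₄ →
               (e₄ :- q₂ :* e₁ :- q₁ :* e₂) :- (e₁ :- q₄ :* e₃ :- q₃ :* e₄) :+ q₁ :* (e₂ :- q₀ :* e₄ :- q₄ :* e₀) :=
               ((q₃ :+ con 1ℤ) :- q₀ :* q₁) :* e₄ :+ q₄ :* (e₃ :- q₁ :* e₀) :- (q₂ :+ con 1ℤ) :* e₁)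
               refl (e 0F) (e 1F) (e 2F) (e 3F) (e 4F) (ε 0F) (ε 1F) (ε 2F) (ε 3F) (ε 4F) ⟩
        ((ε 3F + 1#) - ε 0F * ε 1F) * e 4F + ε 4F * (e 3F - ε 1F * e 0F) - (ε 2F + 1#) * e 1F
          ≈⟨ +-cong (+-congʳ (*-congʳ (+-congʳ (sym (ε-exchange 0F))))) (-‿cong (*-congʳ (sym (ε-exchange 4F)))) ⟩
        (ε 0F * ε 1F - ε 0F * ε 1F) * e 4F + ε 4F * (e 3F - ε 1F * e 0F) - (ε 4F * ε 0F) * e 1F
          ≈⟨ solve 8 (λ p e₀ e₁ e₃ e₄ q₀ q₁ q₄ → (p :- p) :* e₄ :+ q₄ :* (e₃ :- q₁ :* e₀) :- (q₄ :* q₀) :* e₁ := q₄ :* (e₃ :- q₁ :* e₀ :- q₀ :* e₁))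
               refl (ε 0F * ε 1F) (e 0F) (e 1F) (e 3F) (e 4F) (ε 0F) (ε 1F) (ε 4F) ⟩
        ε 4F * linear e 0F ∎

      linear-relation₂ : linear e 1F + ε 2F * linear e 3F - linear e 4F ≈ ε 4F * linear e 2F
      linear-relation₂ = begin
        linear e 1F + ε 2F * linear e 3F - linear e 4F
          ≈⟨ solve 10 (λ e₀ e₁ e₂ e₃ e₄ q₀ q₁ q₂ q₃ q₄ →
               (e₄ :- q₂ :* e₁ :- q₁ :* e₂) :+ q₂ :* (e₁ :- q₄ :* e₃ :- q₃ :* e₄) :- (e₂ :- q₀ :* e₄ :- q₄ :* e₀) :=
               ((q₀ :+ con 1ℤ) :- q₂ :* q₃) :* e₄ :+ q₄ :* (e₀ :- q₂ :* e₃) :- (q₁ :+ con 1ℤ) :* e₂)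
               refl (e 0F) (e 1F) (e 2F) (e 3F) (e 4F) (ε 0F) (ε 1F) (ε 2F) (ε 3F) (ε 4F) ⟩
        ((ε 0F + 1#) - ε 2F * ε 3F) * e 4F + ε 4F * (e 0F - ε 2F * e 3F) - (ε 1F + 1#) * e 2F
          ≈⟨ +-cong (+-congʳ (*-congʳ (+-congʳ (sym (ε-exchange 2F))))) (-‿cong (*-congʳ (sym (ε-exchange 3F)))) ⟩
        (ε 2F * ε 3F - ε 2F * ε 3F) * e 4F + ε 4F * (e 0F - ε 2F * e 3F) - (ε 3F * ε 4F) * e 2F
          ≈⟨ solve 8 (λ p e₀ e₂ e₃ e₄ q₂ q₃ q₄ → (p :- p) :* e₄ :+ q₄ :* (e₀ :- q₂ :* e₃) :- (q₃ :* q₄) :* e₂ := q₄ :* (e₀ :- q₃ :* e₂ :- q₂ :* e₃))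
               refl (ε 2F * ε 3F) (e 0F) (e 2F) (e 3F) (e 4F) (ε 2F) (ε 3F) (ε 4F) ⟩
        ε 4F * linear e 2F ∎

    -- The conic through the points g i = g (i + 1) = 0; the linear relations between
    -- the g i make the equation independent of i.
    conic : Vector Carrier 5 → Fin 5 → Carrier
    conic g i = g i * g (prev i) - ε (next (next i)) * (g i * g (prev (prev i))) - ε (prev (prev i)) * (g (next i) * g (prev i))

    module _ {g : Vector Carrier 5} (ε-exchange : ∀ i → Exchange ε i) (ε₄#0 : ε 4F # 0#)
      (relation₀ : g 1F - g 3F + ε 1F * g 4F ≈ ε 4F * g 0F) (relation₂ : g 1F + ε 2F * g 3F - g 4F ≈ ε 4F * g 2F) where

      -- The difference is `g 1F` times a combination of the `g i` annihilated by the two relations.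
      -- The conics 1, 2 and 4 enter the reconstruction of the exchange relations 3, 4 and 1.
      conic-1≈2 : conic g 1F ≈ conic g 2F
      conic-1≈2 = begin
        conic g 1F
          ≈⟨ solve 8 (λ g₀ g₁ g₂ g₃ g₄ q₀ q₃ q₄ → g₁ :* g₀ :- q₃ :* (g₁ :* g₄) :- q₄ :* (g₂ :* g₀) :=
               (g₂ :* g₁ :- q₄ :* (g₂ :* g₀) :- q₀ :* (g₃ :* g₁)) :+ g₁ :* (g₀ :- q₃ :* g₄ :- g₂ :+ q₀ :* g₃))
               refl (g 0F) (g 1F) (g 2F) (g 3F) (g 4F) (ε 0F) (ε 3F) (ε 4F) ⟩
        conic g 2F + g 1F * (g 0F - ε 3F * g 4F - g 2F + ε 0F * g 3F) ≈⟨ +-congˡ (trans (*-congˡ vanishes) (zeroʳ _)) ⟩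
        conic g 2F + 0#  ≈⟨ +-identityʳ _ ⟩
        conic g 2F ∎
        where
        vanishes : g 0F - ε 3F * g 4F - g 2F + ε 0F * g 3F ≈ 0#
        vanishes = no-zero-divisors ε₄#0 (begin
          ε 4F * (g 0F - ε 3F * g 4F - g 2F + ε 0F * g 3F)
            ≈⟨ solve 7 (λ g₀ g₂ g₃ g₄ q₀ q₃ q₄ → q₄ :* (g₀ :- q₃ :* g₄ :- g₂ :+ q₀ :* g₃) :=
                 q₄ :* g₀ :- q₄ :* g₂ :- (q₃ :* q₄) :* g₄ :+ (q₄ :* q₀) :* g₃) refl (g 0F) (g 2F) (g 3F) (g 4F) (ε 0F) (ε 3F) (ε 4F) ⟩
          ε 4F * g 0F - ε 4F * g 2F - (ε 3F * ε 4F) * g 4F + (ε 4F * ε 0F) * g 3F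
            ≈⟨ +-cong (+-cong (+-cong (sym relation₀) (-‿cong (sym relation₂))) (-‿cong (*-congʳ (ε-exchange 3F)))) (*-congʳ (ε-exchange 4F)) ⟩
          (g 1F - g 3F + ε 1F * g 4F) - (g 1F + ε 2F * g 3F - g 4F) - (ε 1F + 1#) * g 4F + (ε 2F + 1#) * g 3F
            ≈⟨ solve 5 (λ g₁ g₃ g₄ q₁ q₂ → (g₁ :- g₃ :+ q₁ :* g₄) :- (g₁ :+ q₂ :* g₃ :- g₄) :- (q₁ :+ con 1ℤ) :* g₄ :+ (q₂ :+ con 1ℤ) :* g₃ := con 0ℤ)
                 refl (g 1F) (g 3F) (g 4F) (ε 1F) (ε 2F) ⟩
          0# ∎)

      conic-4≈1 : conic g 4F ≈ conic g 1F
      conic-4≈1 = begin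
        conic g 4F
          ≈⟨ solve 9 (λ g₀ g₁ g₂ g₃ g₄ q₁ q₂ q₃ q₄ → g₄ :* g₃ :- q₁ :* (g₄ :* g₂) :- q₂ :* (g₀ :* g₃) :=
               (g₁ :* g₀ :- q₃ :* (g₁ :* g₄) :- q₄ :* (g₂ :* g₀)) :+ (g₄ :* (g₃ :- q₁ :* g₂ :+ q₃ :* g₁ :- g₀)
                 :+ g₀ :* (q₄ :* g₂ :- (g₁ :+ q₂ :* g₃ :- g₄))))
               refl (g 0F) (g 1F) (g 2F) (g 3F) (g 4F) (ε 1F) (ε 2F) (ε 3F) (ε 4F) ⟩
        conic g 1F + (g 4F * (g 3F - ε 1F * g 2F + ε 3F * g 1F - g 0F) + g 0F * (ε 4F * g 2F - (g 1F + ε 2F * g 3F - g 4F)))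
          ≈⟨ +-congˡ (+-cong (trans (*-congˡ vanishes) (zeroʳ _)) (trans (*-congˡ (trans (+-congˡ (-‿cong relation₂)) (-‿inverseʳ _))) (zeroʳ _))) ⟩
        conic g 1F + (0# + 0#)  ≈⟨ trans (+-congˡ (+-identityʳ 0#)) (+-identityʳ _) ⟩
        conic g 1F ∎
        where
        vanishes : g 3F - ε 1F * g 2F + ε 3F * g 1F - g 0F ≈ 0#
        vanishes = no-zero-divisors ε₄#0 (begin
          ε 4F * (g 3F - ε 1F * g 2F + ε 3F * g 1F - g 0F)
            ≈⟨ solve 7 (λ g₀ g₁ g₂ g₃ q₁ q₃ q₄ → q₄ :* (g₃ :- q₁ :* g₂ :+ q₃ :* g₁ :- g₀) :=
                 (q₄ :* g₃ :- q₁ :* (q₄ :* g₂)) :+ (q₃ :* q₄) :* g₁ :- q₄ :* g₀) refl (g 0F) (g 1F) (g 2F) (g 3F) (ε 1F) (ε 3F) (ε 4F) ⟩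
          (ε 4F * g 3F - ε 1F * (ε 4F * g 2F)) + (ε 3F * ε 4F) * g 1F - ε 4F * g 0F
            ≈⟨ +-cong (+-cong (+-congˡ (-‿cong (*-congˡ (sym relation₂)))) (*-congʳ (ε-exchange 3F))) (-‿cong (sym relation₀)) ⟩
          (ε 4F * g 3F - ε 1F * (g 1F + ε 2F * g 3F - g 4F)) + (ε 1F + 1#) * g 1F - (g 1F - g 3F + ε 1F * g 4F)
            ≈⟨ solve 6 (λ g₁ g₃ g₄ q₁ q₂ q₄ → (q₄ :* g₃ :- q₁ :* (g₁ :+ q₂ :* g₃ :- g₄)) :+ (q₁ :+ con 1ℤ) :* g₁ :- (g₁ :- g₃ :+ q₁ :* g₄) :=
                 ((q₄ :+ con 1ℤ) :- q₁ :* q₂) :* g₃) refl (g 1F) (g 3F) (g 4F) (ε 1F) (ε 2F) (ε 4F) ⟩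
          ((ε 4F + 1#) - ε 1F * ε 2F) * g 3F  ≈⟨ *-congʳ (trans (+-congʳ (sym (ε-exchange 1F))) (-‿inverseʳ _)) ⟩
          0# * g 3F                           ≈⟨ zeroˡ _ ⟩
          0#                                  ∎)

    -- e i = conic / (g (i + 1) g (i + 3)) solves the exchange relation.
    reconstruct : ∀ {C p q r t p⁻¹ q⁻¹ r⁻¹ t⁻¹ x y s} → p * p⁻¹ ≈ 1# → q * q⁻¹ ≈ 1# → r * r⁻¹ ≈ 1# → t * t⁻¹ ≈ 1# →
      C ≈ r * q - x * (r * p) - y * (t * q) → x * y ≈ s + 1# →
      (x + C * (p⁻¹ * r⁻¹)) * (y + C * (q⁻¹ * t⁻¹)) ≈ (s + C * (t⁻¹ * p⁻¹)) + 1#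
    reconstruct {C} {p} {q} {r} {t} {p⁻¹} {q⁻¹} {r⁻¹} {t⁻¹} {x} {y} {s} pp qq rr tt C≈ xy = begin
      (x + C * (p⁻¹ * r⁻¹)) * (y + C * (q⁻¹ * t⁻¹))
        ≈⟨ solve 7 (λ x y C a b d e → (x :+ C :* (a :* d)) :* (y :+ C :* (b :* e)) :=
             x :* y :+ C :* (x :* (b :* e) :+ y :* (a :* d) :+ C :* ((a :* d) :* (b :* e)))) refl x y C p⁻¹ q⁻¹ r⁻¹ t⁻¹ ⟩
      x * y + C * (x * (q⁻¹ * t⁻¹) + y * (p⁻¹ * r⁻¹) + C * ((p⁻¹ * r⁻¹) * (q⁻¹ * t⁻¹)))
        ≈⟨ +-cong xy (*-congˡ (+-cong (+-cong x-term y-term) (*-congʳ C≈))) ⟩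
      (s + 1#) + C * (x * (r * p) * N + y * (t * q) * N + (r * q - x * (r * p) - y * (t * q)) * N)
        ≈⟨ +-congˡ (*-congˡ (solve 4 (λ a b d N → a :* N :+ b :* N :+ (d :- a :- b) :* N := d :* N) refl (x * (r * p)) (y * (t * q)) (r * q) N)) ⟩
      (s + 1#) + C * ((r * q) * N)
        ≈⟨ +-congˡ (*-congˡ (trans (solve 6 (λ q r a b d e → (r :* q) :* ((a :* d) :* (b :* e)) := (r :* d) :* (q :* b) :* (e :* a)) refl q r p⁻¹ q⁻¹ r⁻¹ t⁻¹)
             (trans (*-congʳ (trans (*-cong rr qq) (*-identityʳ 1#))) (*-identityˡ _)))) ⟩
      (s + 1#) + C * (t⁻¹ * p⁻¹)
        ≈⟨ solve 2 (λ s a → (s :+ con 1ℤ) :+ a := (s :+ a) :+ con 1ℤ) refl s (C * (t⁻¹ * p⁻¹)) ⟩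
      (s + C * (t⁻¹ * p⁻¹)) + 1# ∎
      where
      N : Carrier
      N = (p⁻¹ * r⁻¹) * (q⁻¹ * t⁻¹)
      x-term : x * (q⁻¹ * t⁻¹) ≈ x * (r * p) * N
      x-term = sym (trans (solve 7 (λ x p r a b d e → x :* (r :* p) :* ((a :* d) :* (b :* e)) := x :* (b :* e) :* ((r :* d) :* (p :* a))) refl x p r p⁻¹ q⁻¹ r⁻¹ t⁻¹)
        (trans (*-congˡ (trans (*-cong rr pp) (*-identityʳ 1#))) (*-identityʳ _)))
      y-term : y * (p⁻¹ * r⁻¹) ≈ y * (t * q) * N
      y-term = sym (trans (solve 7 (λ y q t a b d e → y :* (t :* q) :* ((a :* d) :* (b :* e)) := y :* (a :* d) :* ((t :* e) :* (q :* b))) refl y q t p⁻¹ q⁻¹ r⁻¹ t⁻¹)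
        (trans (*-congˡ (trans (*-cong tt qq) (*-identityʳ 1#))) (*-identityʳ _)))

-- Five forms: the parametrization and its integral points.

module Configuration {c ℓ₁ ℓ₂ : Level} (em : ExcludedMiddle (c ⊔ ℓ₁ ⊔ ℓ₂)) (k : NumberField c ℓ₁ ℓ₂) where
  open import Data.Vec.Functional using ([]; _∷_)
  open NumberField k hiding (zero)
  open IntegerSolver commutativeRing
  open Field em k
  open Places em k
  open Support em k
  open Density em k
  open LinearForms em k
  open Ideals em k
  open Pentagon em k
  open Relation.Binary.Reasoning.Setoid setoid

  module FiveForms (F : Vector (LinearForm k) 5) (position : GeneralPosition k F) where

    dual : ∀ {a b c} → a ≢ b → a ≢ c → b ≢ c → Dual (F a) (F b) (F c)
    dual = distinct⇒dual F position

    D : ∀ i → Dual (F (prev i)) (F i) (F (next i))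
    D 0F = dual (λ ()) (λ ()) (λ ())
    D 1F = dual (λ ()) (λ ()) (λ ())
    D 2F = dual (λ ()) (λ ()) (λ ())
    D 3F = dual (λ ()) (λ ()) (λ ())
    D 4F = dual (λ ()) (λ ()) (λ ())

    B : Dual (F 1F) (F 3F) (F 4F)
    B = dual (λ ()) (λ ()) (λ ())

    open Consecutive F D
    open Dual B

    value : Fin 5 → Point k → Carrier
    value i = apply k (F i)

    α₁ α₃ α₄ β₁ β₃ β₄ : Carrier
    α₁ = value 0F u
    α₃ = value 0F v
    α₄ = value 0F w
    β₁ = value 2F u
    β₃ = value 2F v
    β₄ = value 2F w

    -- κ and ε are chosen so that F i = κ i · (Λ e i e (i + 1)) is solvable.
    module Parametrized (κ ε : Vector Carrier 5) (κ#0 : ∀ i → κ i # 0#) (ε#0 : ∀ i → ε i # 0#)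
      (ε-exchange : ∀ i → Exchange ε i) (α₁#0 : α₁ # 0#) (β₁#0 : β₁ # 0#)
      (κ₁≈ : κ 1F ≈ 1#) (κ₀≈ : κ 0F ≈ ε 4F * α₁) (κ₂≈ : κ 2F ≈ ε 4F * β₁)
      (α₃κ₃≈ : α₃ * κ 3F ≈ - α₁) (α₄κ₄≈ : α₄ * κ 4F ≈ α₁ * ε 1F)
      (β₃κ₃≈ : β₃ * κ 3F ≈ β₁ * ε 2F) (β₄κ₄≈ : β₄ * κ 4F ≈ - β₁) where

      open Centred ε

      -- The conditions on `κ` turn the expansion of `F 0F` in the forms 1, 3 and 4 into a multiple
      -- of the left side of `linear-relation₀`, so that prescribing these three values fixes the
      -- remaining ones correctly.
      value₀ : ∀ {x} {l : Vector Carrier 5} → value 1F x ≈ κ 1F * l 1F → value 3F x ≈ κ 3F * l 3F → value 4F x ≈ κ 4F * l 4F →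
               value 0F x ≈ α₁ * (l 1F - l 3F + ε 1F * l 4F)
      value₀ {x} {l} x₁ x₃ x₄ = begin
        value 0F x                                                 ≈⟨ expand B (F 0F) x ⟩
        α₁ * value 1F x + α₃ * value 3F x + α₄ * value 4F x        ≈⟨ +-cong (+-cong (*-congˡ x₁) (*-congˡ x₃)) (*-congˡ x₄) ⟩
        α₁ * (κ 1F * l 1F) + α₃ * (κ 3F * l 3F) + α₄ * (κ 4F * l 4F)
          ≈⟨ +-cong (+-cong (*-congˡ (trans (*-congʳ κ₁≈) (*-identityˡ _))) (trans (sym (*-assoc _ _ _)) (*-congʳ α₃κ₃≈)))
               (trans (sym (*-assoc _ _ _)) (*-congʳ α₄κ₄≈)) ⟩
        α₁ * l 1F + - α₁ * l 3F + α₁ * ε 1F * l 4F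
          ≈⟨ solve 5 (λ a q x y z → a :* x :+ (:- a) :* y :+ a :* q :* z := a :* (x :- y :+ q :* z)) refl α₁ (ε 1F) (l 1F) (l 3F) (l 4F) ⟩
        α₁ * (l 1F - l 3F + ε 1F * l 4F)                           ∎

      value₂ : ∀ {x} {l : Vector Carrier 5} → value 1F x ≈ κ 1F * l 1F → value 3F x ≈ κ 3F * l 3F → value 4F x ≈ κ 4F * l 4F →
               value 2F x ≈ β₁ * (l 1F + ε 2F * l 3F - l 4F)
      value₂ {x} {l} x₁ x₃ x₄ = begin
        value 2F x                                                 ≈⟨ expand B (F 2F) x ⟩
        β₁ * value 1F x + β₃ * value 3F x + β₄ * value 4F x        ≈⟨ +-cong (+-cong (*-congˡ x₁) (*-congˡ x₃)) (*-congˡ x₄) ⟩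
        β₁ * (κ 1F * l 1F) + β₃ * (κ 3F * l 3F) + β₄ * (κ 4F * l 4F)
          ≈⟨ +-cong (+-cong (*-congˡ (trans (*-congʳ κ₁≈) (*-identityˡ _))) (trans (sym (*-assoc _ _ _)) (*-congʳ β₃κ₃≈)))
               (trans (sym (*-assoc _ _ _)) (*-congʳ β₄κ₄≈)) ⟩
        β₁ * l 1F + β₁ * ε 2F * l 3F + - β₁ * l 4F
          ≈⟨ solve 5 (λ a q x y z → a :* x :+ a :* q :* y :+ (:- a) :* z := a :* (x :+ q :* y :- z)) refl β₁ (ε 2F) (l 1F) (l 3F) (l 4F) ⟩
        β₁ * (l 1F + ε 2F * l 3F - l 4F)                           ∎

      family : Carrier → Carrier → Carrier → Point k
      family s a b = point B (s * (κ 1F * form a b 1F)) (s * (κ 3F * form a b 3F)) (s * (κ 4F * form a b 4F))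

      poly-cleared₁ : ∀ b i → Poly (λ a → cleared a b i)
      poly-cleared₁ b 0F = poly-* poly-id (poly-+ poly-id (poly-const 1#))
      poly-cleared₁ b 1F = poly-const _
      poly-cleared₁ b 2F = poly-* (poly-* poly-id poly-id) (poly-const b)
      poly-cleared₁ b 3F = poly-+ (poly-+ poly-id (poly-const b)) (poly-const 1#)
      poly-cleared₁ b 4F = poly-* (poly-* poly-id (poly-const b)) (poly-const b)

      poly-cleared₂ : ∀ a i → Poly (λ b → cleared a b i)
      poly-cleared₂ a 0F = poly-const _
      poly-cleared₂ a 1F = poly-* poly-id (poly-+ poly-id (poly-const 1#))
      poly-cleared₂ a 2F = poly-* (poly-const (a * a)) poly-id
      poly-cleared₂ a 3F = poly-+ (poly-+ (poly-const a) poly-id) (poly-const 1#)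
      poly-cleared₂ a 4F = poly-* (poly-* (poly-const a) poly-id) poly-id

      poly-linear : ∀ (e : Carrier → Vector Carrier 5) → (∀ i → Poly (λ t → e t i)) → ∀ i → Poly (λ t → linear (e t) i)
      poly-linear e e-poly i = poly-+ (poly-+ (e-poly (prev (prev i))) (poly-neg (poly-* (poly-const (ε (next i))) (e-poly i))))
        (poly-neg (poly-* (poly-const (ε i)) (e-poly (next i))))

      poly-form₁ : ∀ b i → Poly (λ a → form a b i)
      poly-form₁ b = poly-linear (λ a i → cleared a b i - ε i * (a * b)) (λ i →
        poly-+ (poly-cleared₁ b i) (poly-neg (poly-* (poly-const (ε i)) (poly-* poly-id (poly-const b)))))

      poly-form₂ : ∀ a i → Poly (λ b → form a b i)
      poly-form₂ a = poly-linear (λ b i → cleared a b i - ε i * (a * b)) (λ i →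
        poly-+ (poly-cleared₂ a i) (poly-neg (poly-* (poly-const (ε i)) (poly-* (poly-const a) poly-id))))

      poly-point : ∀ {f₁ f₃ f₄ : Carrier → Carrier} → Poly f₁ → Poly f₃ → Poly f₄ → PolyFamily (λ t → point B (f₁ t) (f₃ t) (f₄ t))
      poly-point p₁ p₃ p₄ j = poly-+ (poly-+ (poly-* (poly-const (u j)) p₁) (poly-* (poly-const (v j)) p₃)) (poly-* (poly-const (w j)) p₄)

      g : Point k → Vector Carrier 5
      g x i = value i x * κ i ⁻¹

      κg≈value : ∀ i x → κ i * g x i ≈ value i x
      κg≈value i x = cancel-inverse (κ#0 i)

      g-zero : ∀ {i x} → value i x ≈ 0# → g x i ≈ 0#
      g-zero eq = trans (*-congʳ eq) (zeroˡ _)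

      g-nonzero : ∀ {i x} → value i x # 0# → g x i # 0#
      g-nonzero {i} v#0 = *-nonzero v#0 (⁻¹-nonzero (κ#0 i))

      g-relation₀ : ∀ x → g x 1F - g x 3F + ε 1F * g x 4F ≈ ε 4F * g x 0F
      g-relation₀ x = *-cancelˡ-nonzero α₁#0 (begin
        α₁ * (g x 1F - g x 3F + ε 1F * g x 4F)  ≈⟨ value₀ {x} {g x} (sym (κg≈value 1F x)) (sym (κg≈value 3F x)) (sym (κg≈value 4F x)) ⟨
        value 0F x                              ≈⟨ κg≈value 0F x ⟨
        κ 0F * g x 0F                           ≈⟨ *-congʳ κ₀≈ ⟩
        ε 4F * α₁ * g x 0F                      ≈⟨ solve 3 (λ e a y → e :* a :* y := a :* (e :* y)) refl (ε 4F) α₁ (g x 0F) ⟩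
        α₁ * (ε 4F * g x 0F)                    ∎)

      g-relation₂ : ∀ x → g x 1F + ε 2F * g x 3F - g x 4F ≈ ε 4F * g x 2F
      g-relation₂ x = *-cancelˡ-nonzero β₁#0 (begin
        β₁ * (g x 1F + ε 2F * g x 3F - g x 4F)  ≈⟨ value₂ {x} {g x} (sym (κg≈value 1F x)) (sym (κg≈value 3F x)) (sym (κg≈value 4F x)) ⟨
        value 2F x                              ≈⟨ κg≈value 2F x ⟨
        κ 2F * g x 2F                           ≈⟨ *-congʳ κ₂≈ ⟩
        ε 4F * β₁ * g x 2F                      ≈⟨ solve 3 (λ e a y → e :* a :* y := a :* (e :* y)) refl (ε 4F) β₁ (g x 2F) ⟩
        β₁ * (ε 4F * g x 2F)                    ∎)

      C : Point k → Carrier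
      C x = conic (g x) 2F

      -- The numerators of the entries 2 and 4 of the reconstructed solution. The product `locus`
      -- collects everything by which the inverse map divides.
      z₂-numerator z₄-numerator locus : Point k → Carrier
      z₂-numerator x = ε 2F * (g x 3F * g x 0F) + C x
      z₄-numerator x = ε 4F * (g x 0F * g x 2F) + C x
      locus x = (g x 0F * (g x 1F * (g x 2F * (g x 3F * g x 4F)))) * (C x * (z₂-numerator x * z₄-numerator x))

      regular-g : ∀ i → Regular (λ x → g x i)
      regular-g i = regular-* (regular-apply (F i)) (regular-const (κ i ⁻¹))

      generic-g : ∀ i → Generic (λ x → g x i)
      generic-g i = regular-g i , Dual.v (D i) , g-nonzero {i} {Dual.v (D i)} (nonzero-cong (sym (Dual.gv≈1 (D i))) 1-nonzero)

      regular-C : Regular C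
      regular-C = regular-+ (regular-+ (regular-* (regular-g 2F) (regular-g 1F))
          (regular-neg (regular-* (regular-const (ε 4F)) (regular-* (regular-g 2F) (regular-g 0F)))))
        (regular-neg (regular-* (regular-const (ε 0F)) (regular-* (regular-g 3F) (regular-g 1F))))

      x₀₃ x₀₂ : Point k
      x₀₃ = Dual.w (dual {3F} {0F} {1F} (λ ()) (λ ()) (λ ()))
      x₀₂ = Dual.w (dual {0F} {2F} {1F} (λ ()) (λ ()) (λ ()))

      C-x₀₃ : C x₀₃ ≈ g x₀₃ 2F * g x₀₃ 1F
      C-x₀₃ = trans (+-cong (+-congˡ (-‿cong (*-congˡ (*-congˡ (g-zero {0F} {x₀₃} (Dual.gw≈0 (dual {3F} {0F} {1F} (λ ()) (λ ()) (λ ()))))))))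
          (-‿cong (*-congˡ (*-congʳ (g-zero {3F} {x₀₃} (Dual.fw≈0 (dual {3F} {0F} {1F} (λ ()) (λ ()) (λ ()))))))))
        (solve 4 (λ a b p q → a :* b :- p :* (a :* con 0ℤ) :- q :* (con 0ℤ :* b) := a :* b) refl (g x₀₃ 2F) (g x₀₃ 1F) (ε 4F) (ε 0F))

      C-x₀₃#0 : C x₀₃ # 0#
      C-x₀₃#0 = nonzero-cong (sym C-x₀₃) (*-nonzero
        (g-nonzero {2F} {x₀₃} (nonzero-on-meet (dual {2F} {3F} {0F} (λ ()) (λ ()) (λ ())) (F 1F) x₀₃ (Dual.fw≈0 E) (Dual.gw≈0 E) F₁#0))
        (g-nonzero {1F} {x₀₃} F₁#0))
        where
        E : Dual (F 3F) (F 0F) (F 1F)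
        E = dual {3F} {0F} {1F} (λ ()) (λ ()) (λ ())
        F₁#0 : value 1F x₀₃ # 0#
        F₁#0 = nonzero-cong (sym (Dual.hw≈1 E)) 1-nonzero

      C-x₀₂ : C x₀₂ ≈ - (ε 0F * (g x₀₂ 3F * g x₀₂ 1F))
      C-x₀₂ = trans (+-congʳ (+-cong (*-congʳ g₂≈0) (-‿cong (*-congˡ (*-congʳ g₂≈0)))))
        (solve 4 (λ a b p q → con 0ℤ :* a :- p :* (con 0ℤ :* b) :- q := :- q) refl (g x₀₂ 1F) (g x₀₂ 0F) (ε 4F) (ε 0F * (g x₀₂ 3F * g x₀₂ 1F)))
        where
        g₂≈0 : g x₀₂ 2F ≈ 0#
        g₂≈0 = g-zero {2F} {x₀₂} (Dual.gw≈0 (dual {0F} {2F} {1F} (λ ()) (λ ()) (λ ())))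

      C-x₀₂#0 : C x₀₂ # 0#
      C-x₀₂#0 = nonzero-cong (sym C-x₀₂) (neg-nonzero (*-nonzero (ε#0 0F) (*-nonzero
        (g-nonzero {3F} {x₀₂} (nonzero-on-meet (dual {3F} {0F} {2F} (λ ()) (λ ()) (λ ())) (F 1F) x₀₂ (Dual.fw≈0 E) (Dual.gw≈0 E) F₁#0))
        (g-nonzero {1F} {x₀₂} F₁#0))))
        where
        E : Dual (F 0F) (F 2F) (F 1F)
        E = dual {0F} {2F} {1F} (λ ()) (λ ()) (λ ())
        F₁#0 : value 1F x₀₂ # 0#
        F₁#0 = nonzero-cong (sym (Dual.hw≈1 E)) 1-nonzero

      generic-z₂ : Generic z₂-numerator
      generic-z₂ = regular-+ (regular-* (regular-const (ε 2F)) (regular-* (regular-g 3F) (regular-g 0F))) regular-C , x₀₃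
        , nonzero-cong (sym (trans (+-congʳ (trans (*-congˡ (trans (*-congʳ (g-zero {3F} {x₀₃} (Dual.fw≈0 (dual {3F} {0F} {1F} (λ ()) (λ ()) (λ ())))))
            (zeroˡ _))) (zeroʳ _))) (+-identityˡ _))) C-x₀₃#0

      generic-z₄ : Generic z₄-numerator
      generic-z₄ = regular-+ (regular-* (regular-const (ε 4F)) (regular-* (regular-g 0F) (regular-g 2F))) regular-C , x₀₂
        , nonzero-cong (sym (trans (+-congʳ (trans (*-congˡ (trans (*-congʳ (g-zero {0F} {x₀₂} (Dual.fw≈0 (dual {0F} {2F} {1F} (λ ()) (λ ()) (λ ())))))
            (zeroˡ _))) (zeroʳ _))) (+-identityˡ _))) C-x₀₂#0

      generic-locus : Generic locus
      generic-locus = generic-* (generic-* (generic-g 0F) (generic-* (generic-g 1F) (generic-* (generic-g 2F) (generic-* (generic-g 3F) (generic-g 4F)))))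
        (generic-* (regular-C , x₀₃ , C-x₀₃#0) (generic-* generic-z₂ generic-z₄))

      module Preimage (x : Point k) (locus#0 : locus x # 0#) where

        y : Vector Carrier 5
        y = g x

        P : Carrier
        P = y 0F * (y 1F * (y 2F * (y 3F * y 4F)))

        P#0 : P # 0#
        P#0 = *-nonzeroˡ locus#0

        y#0 : ∀ i → y i # 0#
        y#0 0F = *-nonzeroˡ P#0
        y#0 1F = *-nonzeroˡ (*-nonzeroʳ P#0)
        y#0 2F = *-nonzeroˡ (*-nonzeroʳ (*-nonzeroʳ P#0))
        y#0 3F = *-nonzeroˡ (*-nonzeroʳ (*-nonzeroʳ (*-nonzeroʳ P#0)))
        y#0 4F = *-nonzeroʳ (*-nonzeroʳ (*-nonzeroʳ (*-nonzeroʳ P#0)))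

        i : Vector Carrier 5
        i l = y l ⁻¹

        yi≈1 : ∀ l → y l * i l ≈ 1#
        yi≈1 l = *-inverseʳ (y#0 l)

        Q : Carrier
        Q = C x

        Q#0 : Q # 0#
        Q#0 = *-nonzeroˡ (*-nonzeroʳ locus#0)

        z e : Vector Carrier 5
        e l = Q * (i (next l) * i (prev (prev l)))
        z l = ε l + e l

        conic-1≈Q : conic y 1F ≈ Q
        conic-1≈Q = conic-1≈2 {y} ε-exchange (ε#0 4F) (g-relation₀ x) (g-relation₂ x)

        conic-4≈Q : conic y 4F ≈ Q
        conic-4≈Q = trans (conic-4≈1 {y} ε-exchange (ε#0 4F) (g-relation₀ x) (g-relation₂ x)) conic-1≈Q

        exchange₁ : Exchange z 1F
        exchange₁ = reconstruct (yi≈1 2F) (yi≈1 3F) (yi≈1 4F) (yi≈1 0F) (sym conic-4≈Q) (ε-exchange 1F)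

        exchange₃ : Exchange z 3F
        exchange₃ = reconstruct (yi≈1 4F) (yi≈1 0F) (yi≈1 1F) (yi≈1 2F) (sym conic-1≈Q) (ε-exchange 3F)

        exchange₄ : Exchange z 4F
        exchange₄ = reconstruct (yi≈1 0F) (yi≈1 1F) (yi≈1 2F) (yi≈1 3F) refl (ε-exchange 4F)

        numerator : ∀ {q a b i j} → a * i ≈ 1# → b * j ≈ 1# → q * (a * b) + Q # 0# → q + Q * (i * j) # 0#
        numerator {q} {a} {b} {i} {j} ai bj n#0 = *-nonzeroʳ (nonzero-cong (sym (begin
          (a * b) * (q + Q * (i * j))              ≈⟨ solve 6 (λ q Q a b i j → (a :* b) :* (q :+ Q :* (i :* j)) := q :* (a :* b) :+ Q :* ((a :* i) :* (b :* j))) refl q Q a b i j ⟩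
          q * (a * b) + Q * ((a * i) * (b * j))    ≈⟨ +-congˡ (trans (*-congˡ (trans (*-cong ai bj) (*-identityʳ 1#))) (*-identityʳ Q)) ⟩
          q * (a * b) + Q                          ∎)) n#0)

        z₂#0 : z 2F # 0#
        z₂#0 = numerator (yi≈1 3F) (yi≈1 0F) (*-nonzeroˡ (*-nonzeroʳ (*-nonzeroʳ locus#0)))

        z₄#0 : z 4F # 0#
        z₄#0 = numerator (yi≈1 0F) (yi≈1 2F) (*-nonzeroʳ (*-nonzeroʳ (*-nonzeroʳ locus#0)))

        -- The product `e l * e (next l)` is Q² over the product of all `y j` except `y l`, so `Λ`
        -- turns it into `y l`. Dividing by `z 2F * z 4F` undoes the clearing of denominators in
        -- `form`.
        Λ s : Carrier
        Λ = P * (Q ⁻¹ * Q ⁻¹)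
        s = Λ * (z 2F * z 4F) ⁻¹

        Λee : ∀ {l p q r t i j m n} → p * i ≈ 1# → q * j ≈ 1# → r * m ≈ 1# → t * n ≈ 1# → P ≈ l * ((p * q) * (r * t)) →
              Λ * ((Q * (i * m)) * (Q * (j * n))) ≈ l
        Λee {l} {p} {q} {r} {t} {i} {j} {m} {n} pi qj rm tn P≈ = begin
          P * (Q ⁻¹ * Q ⁻¹) * ((Q * (i * m)) * (Q * (j * n)))
            ≈⟨ solve 7 (λ P Q R i j m n → P :* (R :* R) :* ((Q :* (i :* m)) :* (Q :* (j :* n))) := P :* ((i :* j) :* (m :* n)) :* ((Q :* R) :* (Q :* R)))
                 refl P Q (Q ⁻¹) i j m n ⟩
          P * ((i * j) * (m * n)) * ((Q * Q ⁻¹) * (Q * Q ⁻¹))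
            ≈⟨ *-cong (*-congʳ P≈) (trans (*-cong (*-inverseʳ Q#0) (*-inverseʳ Q#0)) (*-identityʳ 1#)) ⟩
          l * ((p * q) * (r * t)) * ((i * j) * (m * n)) * 1#
            ≈⟨ solve 9 (λ l p q r t i j m n → l :* ((p :* q) :* (r :* t)) :* ((i :* j) :* (m :* n)) :* con 1ℤ := l :* (((p :* i) :* (q :* j)) :* ((r :* m) :* (t :* n))))
                 refl l p q r t i j m n ⟩
          l * (((p * i) * (q * j)) * ((r * m) * (t * n)))
            ≈⟨ *-congˡ (trans (*-cong (trans (*-cong pi qj) (*-identityʳ 1#)) (trans (*-cong rm tn) (*-identityʳ 1#))) (*-identityʳ 1#)) ⟩
          l * 1#   ≈⟨ *-identityʳ l ⟩
          l        ∎

        offset≈e : ∀ l → offset z l ≈ e l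
        offset≈e l = solve 2 (λ a b → a :+ b :- a := b) refl (ε l) (e l)

        coordinate : ∀ l → Exchange z l → Λ * (e l * e (next l)) ≈ y l → s * (κ l * form (z 2F) (z 4F) l) ≈ value l x
        coordinate l exchange Λee≈y = begin
          s * (κ l * form (z 2F) (z 4F) l)
            ≈⟨ *-congˡ (*-congˡ (trans (form≈ {z} exchange₁ exchange₃ exchange₄ l exchange (ε-exchange l)) (*-congˡ (*-cong (offset≈e l) (offset≈e (next l)))))) ⟩
          (Λ * (z 2F * z 4F) ⁻¹) * (κ l * ((z 2F * z 4F) * (e l * e (next l))))
            ≈⟨ solve 5 (λ L d i q ee → (L :* i) :* (q :* (d :* ee)) := (d :* i) :* (q :* (L :* ee))) refl Λ (z 2F * z 4F) ((z 2F * z 4F) ⁻¹) (κ l) (e l * e (next l)) ⟩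
          ((z 2F * z 4F) * (z 2F * z 4F) ⁻¹) * (κ l * (Λ * (e l * e (next l))))
            ≈⟨ *-cong (*-inverseʳ (*-nonzero z₂#0 z₄#0)) (*-congˡ Λee≈y) ⟩
          1# * (κ l * y l)   ≈⟨ trans (*-identityˡ _) (κg≈value l x) ⟩
          value l x          ∎

        family≈x : family s (z 2F) (z 4F) ≈ᵥ x
        family≈x j = trans (+-cong (+-cong
            (*-congˡ (coordinate 1F exchange₁ (Λee (yi≈1 2F) (yi≈1 3F) (yi≈1 4F) (yi≈1 0F)
              (solve 5 (λ a b d e f → a :* (b :* (d :* (e :* f))) := b :* ((d :* e) :* (f :* a))) refl (y 0F) (y 1F) (y 2F) (y 3F) (y 4F)))))
            (*-congˡ (coordinate 3F exchange₃ (Λee (yi≈1 4F) (yi≈1 0F) (yi≈1 1F) (yi≈1 2F)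
              (solve 5 (λ a b d e f → a :* (b :* (d :* (e :* f))) := e :* ((f :* a) :* (b :* d))) refl (y 0F) (y 1F) (y 2F) (y 3F) (y 4F))))))
            (*-congˡ (coordinate 4F exchange₄ (Λee (yi≈1 0F) (yi≈1 1F) (yi≈1 2F) (yi≈1 3F)
              (solve 5 (λ a b d e f → a :* (b :* (d :* (e :* f))) := f :* ((a :* b) :* (d :* e))) refl (y 0F) (y 1F) (y 2F) (y 3F) (y 4F))))))
          (sym (decompose x j))

      dominant : Dominant family
      dominant = record
        { poly₁ = λ a b → poly-point (poly-* poly-id (poly-const (κ 1F * form a b 1F))) (poly-* poly-id (poly-const (κ 3F * form a b 3F)))
            (poly-* poly-id (poly-const (κ 4F * form a b 4F)))
        ; poly₂ = λ s b → poly-point (scaled-form₁ s b 1F) (scaled-form₁ s b 3F) (scaled-form₁ s b 4F)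
        ; poly₃ = λ s a → poly-point (scaled-form₂ s a 1F) (scaled-form₂ s a 3F) (scaled-form₂ s a 4F)
        ; locus = locus
        ; locus-generic = generic-locus
        ; preimage = λ x locus#0 → let open Preimage x locus#0 in s , z 2F , z 4F , family≈x }
        where
        scaled-form₁ : ∀ s b i → Poly (λ a → s * (κ i * form a b i))
        scaled-form₁ s b i = poly-* (poly-const s) (poly-* (poly-const (κ i)) (poly-form₁ b i))
        scaled-form₂ : ∀ s a i → Poly (λ b → s * (κ i * form a b i))
        scaled-form₂ s a i = poly-* (poly-const s) (poly-* (poly-const (κ i)) (poly-form₂ a i))

      module Solution (S : List Place) (good : Good S) (B∈ : IntegralDual B S)
        (κ-unit : ∀ i → IsUnit S (κ i)) (ε-unit : ∀ i → IsUnit S (ε i))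
        {s a b : Carrier} (s-unit : IsUnit S s) (a-unit : IsUnit S a) (b-unit : IsUnit S b) where

        F∈ : ∀ i → IntegralPoint S (F i)
        F∈ = proj₁ good

        p : Point k
        p = family s a b

        cleared∈ : ∀ i → cleared a b i ∈ 𝒪 k S
        cleared∈ 0F = 𝒪-* {S} (proj₁ a-unit) (𝒪-+ {S} (proj₁ a-unit) (𝒪-1 {S}))
        cleared∈ 1F = 𝒪-* {S} (proj₁ b-unit) (𝒪-+ {S} (proj₁ b-unit) (𝒪-1 {S}))
        cleared∈ 2F = 𝒪-* {S} (𝒪-* {S} (proj₁ a-unit) (proj₁ a-unit)) (proj₁ b-unit)
        cleared∈ 3F = 𝒪-+ {S} (𝒪-+ {S} (proj₁ a-unit) (proj₁ b-unit)) (𝒪-1 {S})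
        cleared∈ 4F = 𝒪-* {S} (𝒪-* {S} (proj₁ a-unit) (proj₁ b-unit)) (proj₁ b-unit)

        linear∈ : ∀ {e} → (∀ i → e i ∈ 𝒪 k S) → ∀ i → linear e i ∈ 𝒪 k S
        linear∈ e∈ i = 𝒪-+ {S} (𝒪-+ {S} (e∈ (prev (prev i))) (𝒪-neg {S} (𝒪-* {S} (proj₁ (ε-unit (next i))) (e∈ i))))
          (𝒪-neg {S} (𝒪-* {S} (proj₁ (ε-unit i)) (e∈ (next i))))

        form∈ : ∀ i → form a b i ∈ 𝒪 k S
        form∈ = linear∈ (λ i → 𝒪-+ {S} (cleared∈ i) (𝒪-neg {S} (𝒪-* {S} (proj₁ (ε-unit i)) (𝒪-* {S} (proj₁ a-unit) (proj₁ b-unit)))))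

        p∈ : IntegralPoint S p
        p∈ = 𝒪-point {S} B B∈ (entry 1F) (entry 3F) (entry 4F)
          where
          entry : ∀ i → s * (κ i * form a b i) ∈ 𝒪 k S
          entry i = 𝒪-* {S} (proj₁ s-unit) (𝒪-* {S} (proj₁ (κ-unit i)) (form∈ i))

        a⁻¹ b⁻¹ : Carrier
        a⁻¹ = proj₁ (proj₂ a-unit)
        b⁻¹ = proj₁ (proj₂ b-unit)

        a⁻¹∈ : a⁻¹ ∈ 𝒪 k S
        a⁻¹∈ = proj₁ (proj₂ (proj₂ a-unit))

        b⁻¹∈ : b⁻¹ ∈ 𝒪 k S
        b⁻¹∈ = proj₁ (proj₂ (proj₂ b-unit))

        aa⁻¹≈1 : a * a⁻¹ ≈ 1#
        aa⁻¹≈1 = proj₂ (proj₂ (proj₂ a-unit))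

        bb⁻¹≈1 : b * b⁻¹ ≈ 1#
        bb⁻¹≈1 = proj₂ (proj₂ (proj₂ b-unit))

        -- The solution of the exchange relations with entries 2 and 4 equal to `a` and `b`. By the
        -- Laurent phenomenon it is integral as soon as these two are units.
        z : Vector Carrier 5
        z = (a + 1#) * b⁻¹ ∷ (b + 1#) * a⁻¹ ∷ a ∷ (a + b + 1#) * (a⁻¹ * b⁻¹) ∷ b ∷ []

        z∈ : ∀ i → z i ∈ 𝒪 k S
        z∈ 0F = 𝒪-* {S} (𝒪-+ {S} (proj₁ a-unit) (𝒪-1 {S})) b⁻¹∈
        z∈ 1F = 𝒪-* {S} (𝒪-+ {S} (proj₁ b-unit) (𝒪-1 {S})) a⁻¹∈
        z∈ 2F = proj₁ a-unit
        z∈ 3F = 𝒪-* {S} (cleared∈ 3F) (𝒪-* {S} a⁻¹∈ b⁻¹∈)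
        z∈ 4F = proj₁ b-unit

        z-exchange : ∀ i → Exchange z i
        z-exchange 0F = begin
          (a + 1#) * b⁻¹ * ((b + 1#) * a⁻¹)
            ≈⟨ solve 4 (λ a b i j → (a :+ con 1ℤ) :* j :* ((b :+ con 1ℤ) :* i) := (a :+ b :+ con 1ℤ) :* (i :* j) :+ (a :* i) :* (b :* j)) refl a b a⁻¹ b⁻¹ ⟩
          (a + b + 1#) * (a⁻¹ * b⁻¹) + (a * a⁻¹) * (b * b⁻¹) ≈⟨ +-congˡ (trans (*-cong aa⁻¹≈1 bb⁻¹≈1) (*-identityʳ 1#)) ⟩
          (a + b + 1#) * (a⁻¹ * b⁻¹) + 1#                    ∎
        z-exchange 1F = trans (solve 3 (λ a b i → (b :+ con 1ℤ) :* i :* a := (a :* i) :* (b :+ con 1ℤ)) refl a b a⁻¹) (trans (*-congʳ aa⁻¹≈1) (*-identityˡ _))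
        z-exchange 2F = begin
          a * ((a + b + 1#) * (a⁻¹ * b⁻¹))
            ≈⟨ solve 4 (λ a b i j → a :* ((a :+ b :+ con 1ℤ) :* (i :* j)) := (a :* i) :* ((a :+ con 1ℤ) :* j :+ b :* j)) refl a b a⁻¹ b⁻¹ ⟩
          (a * a⁻¹) * ((a + 1#) * b⁻¹ + b * b⁻¹)  ≈⟨ trans (*-cong aa⁻¹≈1 (+-congˡ bb⁻¹≈1)) (*-identityˡ _) ⟩
          (a + 1#) * b⁻¹ + 1#                      ∎
        z-exchange 3F = begin
          (a + b + 1#) * (a⁻¹ * b⁻¹) * b
            ≈⟨ solve 4 (λ a b i j → (a :+ b :+ con 1ℤ) :* (i :* j) :* b := (b :* j) :* ((b :+ con 1ℤ) :* i :+ a :* i)) refl a b a⁻¹ b⁻¹ ⟩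
          (b * b⁻¹) * ((b + 1#) * a⁻¹ + a * a⁻¹)  ≈⟨ trans (*-cong bb⁻¹≈1 (+-congˡ aa⁻¹≈1)) (*-identityˡ _) ⟩
          (b + 1#) * a⁻¹ + 1#                      ∎
        z-exchange 4F = trans (solve 3 (λ a b j → b :* ((a :+ con 1ℤ) :* j) := (b :* j) :* (a :+ con 1ℤ)) refl a b b⁻¹) (trans (*-congʳ bb⁻¹≈1) (*-identityˡ _))

        e : Vector Carrier 5
        e = offset z

        Λ : Carrier
        Λ = s * (a * b)

        l : Vector Carrier 5
        l i = Λ * linear e i

        form-value : ∀ i → s * (κ i * form a b i) ≈ κ i * l i
        form-value i = trans (*-congˡ (*-congˡ (trans (form≈ {z} (z-exchange 1F) (z-exchange 3F) (z-exchange 4F) i (z-exchange i) (ε-exchange i))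
            (*-congˡ (product≈linear {z} i (z-exchange i) (ε-exchange i))))))
          (solve 4 (λ s q d x → s :* (q :* (d :* x)) := q :* ((s :* d) :* x)) refl s (κ i) (a * b) (linear e i))

        value₁ : value 1F p ≈ κ 1F * l 1F
        value₁ = trans (f-point B _ _ _) (form-value 1F)

        value₃ : value 3F p ≈ κ 3F * l 3F
        value₃ = trans (g-point B _ _ _) (form-value 3F)

        value₄ : value 4F p ≈ κ 4F * l 4F
        value₄ = trans (h-point B _ _ _) (form-value 4F)

        values : ∀ i → value i p ≈ κ i * l i
        values 0F = begin
          value 0F p                           ≈⟨ value₀ {p} {l} value₁ value₃ value₄ ⟩
          α₁ * (l 1F - l 3F + ε 1F * l 4F)
            ≈⟨ solve 6 (λ a L x y z q → a :* (L :* x :- L :* y :+ q :* (L :* z)) := a :* (L :* (x :- y :+ q :* z))) refl α₁ Λ (linear e 1F) (linear e 3F) (linear e 4F) (ε 1F) ⟩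
          α₁ * (Λ * (linear e 1F - linear e 3F + ε 1F * linear e 4F))  ≈⟨ *-congˡ (*-congˡ (linear-relation₀ {e} ε-exchange)) ⟩
          α₁ * (Λ * (ε 4F * linear e 0F))      ≈⟨ solve 4 (λ a L q x → a :* (L :* (q :* x)) := (q :* a) :* (L :* x)) refl α₁ Λ (ε 4F) (linear e 0F) ⟩
          (ε 4F * α₁) * l 0F                   ≈⟨ *-congʳ κ₀≈ ⟨
          κ 0F * l 0F                          ∎
        values 1F = value₁
        values 2F = begin
          value 2F p                           ≈⟨ value₂ {p} {l} value₁ value₃ value₄ ⟩
          β₁ * (l 1F + ε 2F * l 3F - l 4F)
            ≈⟨ solve 6 (λ a L x y z q → a :* (L :* x :+ q :* (L :* y) :- L :* z) := a :* (L :* (x :+ q :* y :- z))) refl β₁ Λ (linear e 1F) (linear e 3F) (linear e 4F) (ε 2F) ⟩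
          β₁ * (Λ * (linear e 1F + ε 2F * linear e 3F - linear e 4F))  ≈⟨ *-congˡ (*-congˡ (linear-relation₂ {e} ε-exchange)) ⟩
          β₁ * (Λ * (ε 4F * linear e 2F))      ≈⟨ solve 4 (λ a L q x → a :* (L :* (q :* x)) := (q :* a) :* (L :* x)) refl β₁ Λ (ε 4F) (linear e 2F) ⟩
          (ε 4F * β₁) * l 2F                   ≈⟨ *-congʳ κ₂≈ ⟨
          κ 2F * l 2F                          ∎
        values 3F = value₃
        values 4F = value₄

        κ⁻¹ : Fin 5 → Carrier
        κ⁻¹ i = proj₁ (proj₂ (κ-unit i))

        κκ⁻¹≈1 : ∀ i → κ i * κ⁻¹ i ≈ 1#
        κκ⁻¹≈1 i = proj₂ (proj₂ (proj₂ (κ-unit i)))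

        κ⁻¹∈ : ∀ i → κ⁻¹ i ∈ 𝒪 k S
        κ⁻¹∈ i = proj₁ (proj₂ (proj₂ (κ-unit i)))

        product : Fin 5 → Carrier
        product i = Λ * (e i * e (next i))

        values′ : ∀ i → value i p ≈ κ i * product i
        values′ i = trans (values i) (*-congˡ (*-congˡ (sym (product≈linear {z} i (z-exchange i) (ε-exchange i)))))

        product∈ : ∀ i → product i ∈ generated k S p
        product∈ i = gen-cong {S} p (trans (*-congˡ (values′ i)) (trans (solve 3 (λ i q x → i :* (q :* x) := (q :* i) :* x) refl (κ⁻¹ i) (κ i) (product i))
          (trans (*-congʳ (κκ⁻¹≈1 i)) (*-identityˡ _)))) (gen-* {S} p (κ⁻¹∈ i) (gen-apply (F i) p (F∈ i)))

        e∈ : ∀ i → e i ∈ 𝒪 k S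
        e∈ i = 𝒪-+ {S} (z∈ i) (𝒪-neg {S} (proj₁ (ε-unit i)))

        -- m, i, r, r′, m′ stand for i − 1, i, i + 1, i + 2, i + 3.
        quotient : ∀ m i r r′ m′ → next m ≡ i → next i ≡ r → next r ≡ r′ → next m′ ≡ m →
          z m * z i ≈ z r′ + 1# → ε m * ε i ≈ ε r′ + 1# →
          z m′ * z m ≈ z r + 1# → ε m′ * ε m ≈ ε r + 1# →
          z r * z r′ ≈ z m + 1# → ε r * ε r′ ≈ ε m + 1# →
          ε r′ * ε m′ ≈ ε i + 1# →
          ∃[ g ] g ∈ generated k S p × value m p * value r p ≈ value i p * g
        quotient m i r r′ m′ ≡.refl ≡.refl ≡.refl ≡.refl zz₁ εε₁ zz₂ εε₂ zz₃ εε₃ εε₄ =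
          κ m * κ r * κ⁻¹ i * G
          , gen-* {S} p (𝒪-* {S} (𝒪-* {S} (proj₁ (κ-unit m)) (proj₁ (κ-unit r))) (κ⁻¹∈ i)) G∈
          , (begin
            value m p * value r p
              ≈⟨ *-cong (values′ m) (values′ r) ⟩
            (κ m * product m) * (κ r * product r)
              -- The inner factors `e i` and `e r` make up `product i`; the outer pair `e m`, `e r′`
              -- is left for `G`.
              ≈⟨ solve 7 (λ a b L e₁ e₂ e₃ e₄ → (a :* (L :* (e₁ :* e₂))) :* (b :* (L :* (e₃ :* e₄))) := (a :* b) :* ((L :* (e₂ :* e₃)) :* (L :* (e₁ :* e₄))))
                   refl (κ m) (κ r) Λ (e m) (e i) (e r) (e r′) ⟩
            (κ m * κ r) * (product i * (Λ * (e m * e r′)))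
              ≈⟨ *-congˡ (*-congˡ (sym G≈)) ⟩
            (κ m * κ r) * (product i * G)
              ≈⟨ trans (sym (*-identityˡ _)) (*-congʳ (sym (κκ⁻¹≈1 i))) ⟩
            (κ i * κ⁻¹ i) * ((κ m * κ r) * (product i * G))
              ≈⟨ solve 6 (λ a j b d x G → (a :* j) :* ((b :* d) :* (x :* G)) := (a :* x) :* (b :* d :* j :* G)) refl (κ i) (κ⁻¹ i) (κ m) (κ r) (product i) G ⟩
            (κ i * product i) * (κ m * κ r * κ⁻¹ i * G)
              ≈⟨ *-congʳ (values′ i) ⟨
            value i p * (κ m * κ r * κ⁻¹ i * G) ∎)
          where
          η η′ : Carrier
          η = proj₁ (proj₂ (ε-unit m))
          η′ = proj₁ (proj₂ (ε-unit m′))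
          combination : Carrier → Carrier → Carrier → Carrier
          combination x y w = (ε m * ε m′ * z m - ε r * z m) * x - (ε r′ * z m) * y - e m * w
          -- This is `Λ * (e m * e r′)`, written so that membership in the ideal is visible; `η` and
          -- `η′` cancel the factor `ε m * ε m′` that `neighbours` puts in front.
          G : Carrier
          G = (η * η′) * combination (product m) (product m′) (product r)
          ε∈ : ∀ i → ε i ∈ 𝒪 k S
          ε∈ i = proj₁ (ε-unit i)
          gen-neg : ∀ {r x} → r ∈ 𝒪 k S → x ∈ generated k S p → - (r * x) ∈ generated k S p
          gen-neg {r} {x} r∈ x∈ = gen-cong {S} p (solve 2 (λ r x → (:- r) :* x := :- (r :* x)) refl r x) (gen-* {S} p (𝒪-neg {S} r∈) x∈)
          G∈ : G ∈ generated k S p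
          G∈ = gen-* {S} p (𝒪-* {S} (proj₁ (proj₂ (proj₂ (ε-unit m)))) (proj₁ (proj₂ (proj₂ (ε-unit m′)))))
            (gen-+ {S} p (gen-+ {S} p
              (gen-* {S} p (𝒪-+ {S} (𝒪-* {S} (𝒪-* {S} (ε∈ m) (ε∈ m′)) (z∈ m)) (𝒪-neg {S} (𝒪-* {S} (ε∈ r) (z∈ m)))) (product∈ m))
              (gen-neg (𝒪-* {S} (ε∈ r′) (z∈ m)) (product∈ m′)))
              (gen-neg (e∈ m) (product∈ r)))
          neighbour-product : (ε m * ε m′) * (e m * e r′) ≈ combination (e m * e i) (e m′ * e m) (e r * e r′)
          -- In the order of the A₂ recursion starting from `m`, the indices are `m`, `r′`, `i`,
          -- `m′`, `r`.
          neighbour-product = neighbours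
            (product-difference zz₁ εε₁)
            (product-difference (trans (*-comm (z m) (z m′)) zz₂) (trans (*-comm (ε m) (ε m′)) εε₂))
            (product-difference′ zz₃ εε₃)
            εε₂ εε₄
          G≈ : G ≈ Λ * (e m * e r′)
          G≈ = begin
            (η * η′) * combination (Λ * (e m * e i)) (Λ * (e m′ * e m)) (Λ * (e r * e r′))
              ≈⟨ *-congˡ (solve 7 (λ L a b d x y w → a :* (L :* x) :- b :* (L :* y) :- d :* (L :* w) := L :* (a :* x :- b :* y :- d :* w)) refl
                   Λ (ε m * ε m′ * z m - ε r * z m) (ε r′ * z m) (e m) (e m * e i) (e m′ * e m) (e r * e r′)) ⟩
            (η * η′) * (Λ * combination (e m * e i) (e m′ * e m) (e r * e r′))  ≈⟨ *-congˡ (*-congˡ neighbour-product) ⟨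
            (η * η′) * (Λ * ((ε m * ε m′) * (e m * e r′)))
              ≈⟨ solve 6 (λ n n′ L q q′ x → (n :* n′) :* (L :* ((q :* q′) :* x)) := ((q :* n) :* (q′ :* n′)) :* (L :* x)) refl η η′ Λ (ε m) (ε m′) (e m * e r′) ⟩
            ((ε m * η) * (ε m′ * η′)) * (Λ * (e m * e r′))
              ≈⟨ trans (*-congʳ (trans (*-cong (proj₂ (proj₂ (proj₂ (ε-unit m)))) (proj₂ (proj₂ (proj₂ (ε-unit m′))))) (*-identityʳ 1#))) (*-identityˡ _) ⟩
            Λ * (e m * e r′) ∎

        p∈Solutions : p ∈ Solutions k F S
        p∈Solutions = solution {S} {p} good p∈ λ
          { 0F → quotient 4F 0F 1F 2F 3F ≡.refl ≡.refl ≡.refl ≡.refl (z-exchange 4F) (ε-exchange 4F) (z-exchange 3F) (ε-exchange 3F) (z-exchange 1F) (ε-exchange 1F) (ε-exchange 2F)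
          ; 1F → quotient 0F 1F 2F 3F 4F ≡.refl ≡.refl ≡.refl ≡.refl (z-exchange 0F) (ε-exchange 0F) (z-exchange 4F) (ε-exchange 4F) (z-exchange 2F) (ε-exchange 2F) (ε-exchange 3F)
          ; 2F → quotient 1F 2F 3F 4F 0F ≡.refl ≡.refl ≡.refl ≡.refl (z-exchange 1F) (ε-exchange 1F) (z-exchange 0F) (ε-exchange 0F) (z-exchange 3F) (ε-exchange 3F) (ε-exchange 4F)
          ; 3F → quotient 2F 3F 4F 0F 1F ≡.refl ≡.refl ≡.refl ≡.refl (z-exchange 2F) (ε-exchange 2F) (z-exchange 1F) (ε-exchange 1F) (z-exchange 4F) (ε-exchange 4F) (ε-exchange 0F)
          ; 4F → quotient 3F 4F 0F 1F 2F ≡.refl ≡.refl ≡.refl ≡.refl (z-exchange 3F) (ε-exchange 3F) (z-exchange 2F) (ε-exchange 2F) (z-exchange 0F) (ε-exchange 0F) (ε-exchange 1F) }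

      conclusion : Conclusion F
      conclusion = conclude F family dominant (eventually-map
        (λ S (good , B∈ , κ-unit , ε-unit , 2-unit) a b c → Solution.p∈Solutions S good B∈ κ-unit ε-unit
          (isUnit-^ {S} 2-unit a) (isUnit-^ {S} 2-unit b) (isUnit-^ {S} 2-unit c))
        (eventually-× eventually-good (eventually-× (eventually-integralDual B)
          (eventually-× (eventually-∀ (λ i → eventually-unit (κ#0 i))) (eventually-× (eventually-∀ (λ i → eventually-unit (ε#0 i))) (eventually-unit two-nonzero))))))

-- The constants attached to five lines.

module Constants {c ℓ₁ ℓ₂ : Level} (em : ExcludedMiddle (c ⊔ ℓ₁ ⊔ ℓ₂)) (k : NumberField c ℓ₁ ℓ₂) where
  open import Data.Vec.Functional using ([]; _∷_)
  open NumberField k hiding (zero)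
  open IntegerSolver commutativeRing
  open Field em k
  open LinearForms em k
  open Ideals em k
  open Pentagon em k
  open Relation.Binary.Reasoning.Setoid setoid

  module _ (F : Vector (LinearForm k) 5) (position : GeneralPosition k F) where
    open Configuration.FiveForms em k F position
    open Dual B

    1#0 : ∀ {x} → x ≈ 1# → x # 0#
    1#0 x≈1 = nonzero-cong (sym x≈1) 1-nonzero

    α₁#0 : α₁ # 0#
    α₁#0 = nonzero-on-meet (dual {0F} {3F} {4F} (λ ()) (λ ()) (λ ())) (F 1F) u gu≈0 hu≈0 (1#0 fu≈1)

    α₃#0 : α₃ # 0#
    α₃#0 = nonzero-on-meet (dual {0F} {1F} {4F} (λ ()) (λ ()) (λ ())) (F 3F) v fv≈0 hv≈0 (1#0 gv≈1)

    α₄#0 : α₄ # 0#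
    α₄#0 = nonzero-on-meet (dual {0F} {1F} {3F} (λ ()) (λ ()) (λ ())) (F 4F) w fw≈0 gw≈0 (1#0 hw≈1)

    β₁#0 : β₁ # 0#
    β₁#0 = nonzero-on-meet (dual {2F} {3F} {4F} (λ ()) (λ ()) (λ ())) (F 1F) u gu≈0 hu≈0 (1#0 fu≈1)

    β₃#0 : β₃ # 0#
    β₃#0 = nonzero-on-meet (dual {2F} {1F} {4F} (λ ()) (λ ()) (λ ())) (F 3F) v fv≈0 hv≈0 (1#0 gv≈1)

    β₄#0 : β₄ # 0#
    β₄#0 = nonzero-on-meet (dual {2F} {1F} {3F} (λ ()) (λ ()) (λ ())) (F 4F) w fw≈0 gw≈0 (1#0 hw≈1)

    -- Each minor is the value of F 0 at the meet of F 2 with one of the forms 1, 3, 4.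
    minor₃₄ : α₃ * β₄ - α₄ * β₃ # 0#
    minor₃₄ = nonzero-cong (trans (apply-point B (F 0F) 0# β₄ (- β₃))
        (solve 5 (λ a₁ a₃ a₄ b₃ b₄ → a₁ :* con 0ℤ :+ a₃ :* b₄ :+ a₄ :* (:- b₃) := a₃ :* b₄ :- a₄ :* b₃) refl α₁ α₃ α₄ β₃ β₄))
      (nonzero-on-meet (dual {0F} {1F} {2F} (λ ()) (λ ()) (λ ())) (F 3F) (point B 0# β₄ (- β₃)) (f-point B _ _ _)
        (trans (apply-point B (F 2F) 0# β₄ (- β₃)) (solve 3 (λ b₁ b₃ b₄ → b₁ :* con 0ℤ :+ b₃ :* b₄ :+ b₄ :* (:- b₃) := con 0ℤ) refl β₁ β₃ β₄))
        (nonzero-cong (sym (g-point B _ _ _)) β₄#0))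

    minor₁₃ : α₁ * β₃ - α₃ * β₁ # 0#
    minor₁₃ = nonzero-cong (trans (apply-point B (F 0F) β₃ (- β₁) 0#)
        (solve 5 (λ a₁ a₃ a₄ b₁ b₃ → a₁ :* b₃ :+ a₃ :* (:- b₁) :+ a₄ :* con 0ℤ := a₁ :* b₃ :- a₃ :* b₁) refl α₁ α₃ α₄ β₁ β₃))
      (nonzero-on-meet (dual {0F} {4F} {2F} (λ ()) (λ ()) (λ ())) (F 1F) (point B β₃ (- β₁) 0#) (h-point B _ _ _)
        (trans (apply-point B (F 2F) β₃ (- β₁) 0#) (solve 3 (λ b₁ b₃ b₄ → b₁ :* b₃ :+ b₃ :* (:- b₁) :+ b₄ :* con 0ℤ := con 0ℤ) refl β₁ β₃ β₄))
        (nonzero-cong (sym (f-point B _ _ _)) β₃#0))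

    minor₁₄ : α₁ * β₄ - α₄ * β₁ # 0#
    minor₁₄ = nonzero-cong (trans (apply-point B (F 0F) β₄ 0# (- β₁))
        (solve 5 (λ a₁ a₃ a₄ b₁ b₄ → a₁ :* b₄ :+ a₃ :* con 0ℤ :+ a₄ :* (:- b₁) := a₁ :* b₄ :- a₄ :* b₁) refl α₁ α₃ α₄ β₁ β₄))
      (nonzero-on-meet (dual {0F} {3F} {2F} (λ ()) (λ ()) (λ ())) (F 1F) (point B β₄ 0# (- β₁)) (g-point B _ _ _)
        (trans (apply-point B (F 2F) β₄ 0# (- β₁)) (solve 3 (λ b₁ b₃ b₄ → b₁ :* b₄ :+ b₃ :* con 0ℤ :+ b₄ :* (:- b₁) := con 0ℤ) refl β₁ β₃ β₄))
        (nonzero-cong (sym (f-point B _ _ _)) β₄#0))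

    -- The conditions involving α₃, β₄, α₄ and β₃ determine κ₃, κ₄, ε₁ and ε₂ in turn. The exchange
    -- relations 1, 4 and 3 then force ε₄, ε₀ and ε₃.
    κ₃ κ₄ ε₀ ε₁ ε₂ ε₃ ε₄ : Carrier
    κ₃ = - (α₁ * α₃ ⁻¹)
    κ₄ = - (β₁ * β₄ ⁻¹)
    ε₁ = α₄ * κ₄ * α₁ ⁻¹
    ε₂ = β₃ * κ₃ * β₁ ⁻¹
    ε₄ = ε₁ * ε₂ - 1#
    ε₀ = (ε₂ + 1#) * ε₄ ⁻¹
    ε₃ = (ε₁ + 1#) * ε₄ ⁻¹

    cancel-neg : ∀ {x y} → x # 0# → x * - (y * x ⁻¹) ≈ - y
    cancel-neg {x} {y} x#0 = trans (solve 3 (λ x y z → x :* (:- (y :* z)) := :- (x :* (y :* z))) refl x y (x ⁻¹)) (-‿cong (cancel-inverse x#0))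

    α₃κ₃ : α₃ * κ₃ ≈ - α₁
    α₃κ₃ = cancel-neg α₃#0

    β₄κ₄ : β₄ * κ₄ ≈ - β₁
    β₄κ₄ = cancel-neg β₄#0

    α₁ε₁ : α₁ * ε₁ ≈ α₄ * κ₄
    α₁ε₁ = cancel-inverse α₁#0

    β₁ε₂ : β₁ * ε₂ ≈ β₃ * κ₃
    β₁ε₂ = cancel-inverse β₁#0

    neg-swap : ∀ {x y} → y - x # 0# → x - y # 0#
    neg-swap {x} {y} y-x#0 = nonzero-cong (solve 2 (λ x y → :- (y :- x) := x :- y) refl x y) (neg-nonzero y-x#0)

    -- Clearing denominators gives a minor of the coefficients of `F 0F` and `F 2F`; the same
    -- happens for `ε₂ + 1#` and, up to a further nonzero factor, for `ε₄`. General position thus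
    -- keeps `ε` off the five lines of the surface on which a coordinate vanishes.
    ε₁+1#0 : ε₁ + 1# # 0#
    ε₁+1#0 = *-nonzeroʳ {α₁ * β₄} (nonzero-cong (sym (begin
      (α₁ * β₄) * (ε₁ + 1#)        ≈⟨ solve 3 (λ a b e → (a :* b) :* (e :+ con 1ℤ) := (a :* e) :* b :+ a :* b) refl α₁ β₄ ε₁ ⟩
      (α₁ * ε₁) * β₄ + α₁ * β₄     ≈⟨ +-congʳ (*-congʳ α₁ε₁) ⟩
      (α₄ * κ₄) * β₄ + α₁ * β₄     ≈⟨ +-congʳ (solve 3 (λ a x b → (a :* x) :* b := a :* (b :* x)) refl α₄ κ₄ β₄) ⟩
      α₄ * (β₄ * κ₄) + α₁ * β₄     ≈⟨ +-congʳ (*-congˡ β₄κ₄) ⟩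
      α₄ * - β₁ + α₁ * β₄          ≈⟨ solve 4 (λ a b a′ b′ → a′ :* (:- b) :+ a :* b′ := a :* b′ :- a′ :* b) refl α₁ β₁ α₄ β₄ ⟩
      α₁ * β₄ - α₄ * β₁            ∎)) minor₁₄)

    ε₂+1#0 : ε₂ + 1# # 0#
    ε₂+1#0 = *-nonzeroʳ {β₁ * α₃} (nonzero-cong (sym (begin
      (β₁ * α₃) * (ε₂ + 1#)        ≈⟨ solve 3 (λ a b e → (a :* b) :* (e :+ con 1ℤ) := (a :* e) :* b :+ a :* b) refl β₁ α₃ ε₂ ⟩
      (β₁ * ε₂) * α₃ + β₁ * α₃     ≈⟨ +-congʳ (*-congʳ β₁ε₂) ⟩
      (β₃ * κ₃) * α₃ + β₁ * α₃     ≈⟨ +-congʳ (solve 3 (λ a x b → (a :* x) :* b := a :* (b :* x)) refl β₃ κ₃ α₃) ⟩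
      β₃ * (α₃ * κ₃) + β₁ * α₃     ≈⟨ +-congʳ (*-congˡ α₃κ₃) ⟩
      β₃ * - α₁ + β₁ * α₃          ≈⟨ solve 4 (λ a b a′ b′ → b′ :* (:- a) :+ b :* a′ := a′ :* b :- a :* b′) refl α₁ β₁ α₃ β₃ ⟩
      α₃ * β₁ - α₁ * β₃            ∎)) (neg-swap minor₁₃))

    ε₄#0 : ε₄ # 0#
    ε₄#0 = *-nonzeroʳ {(α₁ * β₁) * (α₃ * β₄)} (nonzero-cong (sym (begin
      (α₁ * β₁) * (α₃ * β₄) * (ε₁ * ε₂ - 1#)
        ≈⟨ solve 6 (λ a b a′ b′ e f → (a :* b) :* (a′ :* b′) :* (e :* f :- con 1ℤ) := ((a :* e) :* (b :* f)) :* (a′ :* b′) :- (a :* b) :* (a′ :* b′))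
             refl α₁ β₁ α₃ β₄ ε₁ ε₂ ⟩
      ((α₁ * ε₁) * (β₁ * ε₂)) * (α₃ * β₄) - (α₁ * β₁) * (α₃ * β₄)   ≈⟨ +-congʳ (*-congʳ (*-cong α₁ε₁ β₁ε₂)) ⟩
      ((α₄ * κ₄) * (β₃ * κ₃)) * (α₃ * β₄) - (α₁ * β₁) * (α₃ * β₄)
        ≈⟨ +-congʳ (solve 6 (λ a x b y a′ b′ → ((a :* x) :* (b :* y)) :* (a′ :* b′) := (a :* b) :* ((a′ :* y) :* (b′ :* x))) refl α₄ κ₄ β₃ κ₃ α₃ β₄) ⟩
      (α₄ * β₃) * ((α₃ * κ₃) * (β₄ * κ₄)) - (α₁ * β₁) * (α₃ * β₄)   ≈⟨ +-congʳ (*-congˡ (*-cong α₃κ₃ β₄κ₄)) ⟩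
      (α₄ * β₃) * (- α₁ * - β₁) - (α₁ * β₁) * (α₃ * β₄)
        ≈⟨ solve 6 (λ a b a₃ b₃ a₄ b₄ → (a₄ :* b₃) :* ((:- a) :* (:- b)) :- (a :* b) :* (a₃ :* b₄) := (a :* b) :* (a₄ :* b₃ :- a₃ :* b₄))
             refl α₁ β₁ α₃ β₃ α₄ β₄ ⟩
      (α₁ * β₁) * (α₄ * β₃ - α₃ * β₄)                                ∎)) (*-nonzero (*-nonzero α₁#0 β₁#0) (neg-swap minor₃₄)))

    ε κ : Vector Carrier 5
    ε = ε₀ ∷ ε₁ ∷ ε₂ ∷ ε₃ ∷ ε₄ ∷ []
    κ = ε₄ * α₁ ∷ 1# ∷ ε₄ * β₁ ∷ κ₃ ∷ κ₄ ∷ []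

    κ₃#0 : κ₃ # 0#
    κ₃#0 = neg-nonzero (*-nonzero α₁#0 (⁻¹-nonzero α₃#0))

    κ₄#0 : κ₄ # 0#
    κ₄#0 = neg-nonzero (*-nonzero β₁#0 (⁻¹-nonzero β₄#0))

    κ#0 : ∀ i → κ i # 0#
    κ#0 0F = *-nonzero ε₄#0 α₁#0
    κ#0 1F = 1-nonzero
    κ#0 2F = *-nonzero ε₄#0 β₁#0
    κ#0 3F = κ₃#0
    κ#0 4F = κ₄#0

    ε#0 : ∀ i → ε i # 0#
    ε#0 0F = *-nonzero ε₂+1#0 (⁻¹-nonzero ε₄#0)
    ε#0 1F = *-nonzero (*-nonzero α₄#0 κ₄#0) (⁻¹-nonzero α₁#0)
    ε#0 2F = *-nonzero (*-nonzero β₃#0 κ₃#0) (⁻¹-nonzero β₁#0)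
    ε#0 3F = *-nonzero ε₁+1#0 (⁻¹-nonzero ε₄#0)
    ε#0 4F = ε₄#0

    -- The relations 1, 3 and 4 hold by the choice of ε₄, ε₃ and ε₀. The relations 0 and 2 then
    -- follow: this is the period five of the A₂ recursion.
    ε-exchange : ∀ i → Exchange ε i
    ε-exchange 0F = *-cancelˡ-nonzero ε₄#0 (begin
      ε₄ * ((ε₂ + 1#) * ε₄ ⁻¹ * ε₁)
        ≈⟨ solve 4 (λ x y z w → w :* ((y :+ con 1ℤ) :* z :* x) := (w :* z) :* (x :* y :+ x)) refl ε₁ ε₂ (ε₄ ⁻¹) ε₄ ⟩
      (ε₄ * ε₄ ⁻¹) * (ε₁ * ε₂ + ε₁)    ≈⟨ trans (*-congʳ (*-inverseʳ ε₄#0)) (*-identityˡ _) ⟩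
      ε₁ * ε₂ + ε₁                     ≈⟨ solve 2 (λ x y → x :* y :+ x := (x :+ con 1ℤ) :+ (x :* y :- con 1ℤ)) refl ε₁ ε₂ ⟩
      (ε₁ + 1#) + ε₄                   ≈⟨ +-congʳ (cancel-inverse ε₄#0) ⟨
      ε₄ * ε₃ + ε₄                     ≈⟨ solve 2 (λ x y → x :* y :+ x := x :* (y :+ con 1ℤ)) refl ε₄ ε₃ ⟩
      ε₄ * (ε₃ + 1#)                   ∎)
    ε-exchange 1F = solve 2 (λ x y → x :* y := (x :* y :- con 1ℤ) :+ con 1ℤ) refl ε₁ ε₂
    ε-exchange 2F = *-cancelˡ-nonzero ε₄#0 (begin
      ε₄ * (ε₂ * ((ε₁ + 1#) * ε₄ ⁻¹))
        ≈⟨ solve 4 (λ x y z w → w :* (y :* ((x :+ con 1ℤ) :* z)) := (w :* z) :* (x :* y :+ y)) refl ε₁ ε₂ (ε₄ ⁻¹) ε₄ ⟩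
      (ε₄ * ε₄ ⁻¹) * (ε₁ * ε₂ + ε₂)    ≈⟨ trans (*-congʳ (*-inverseʳ ε₄#0)) (*-identityˡ _) ⟩
      ε₁ * ε₂ + ε₂                     ≈⟨ solve 2 (λ x y → x :* y :+ y := (y :+ con 1ℤ) :+ (x :* y :- con 1ℤ)) refl ε₁ ε₂ ⟩
      (ε₂ + 1#) + ε₄                   ≈⟨ +-congʳ (cancel-inverse ε₄#0) ⟨
      ε₄ * ε₀ + ε₄                     ≈⟨ solve 2 (λ x y → x :* y :+ x := x :* (y :+ con 1ℤ)) refl ε₄ ε₀ ⟩
      ε₄ * (ε₀ + 1#)                   ∎)
    ε-exchange 3F = trans (*-comm ε₃ ε₄) (cancel-inverse ε₄#0)
    ε-exchange 4F = cancel-inverse ε₄#0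

    five-forms : Conclusion F
    five-forms = Parametrized.conclusion κ ε κ#0 ε#0 ε-exchange α₁#0 β₁#0 refl refl refl α₃κ₃ (sym α₁ε₁) (sym β₁ε₂) β₄κ₄

theorem9 : {c ℓ₁ ℓ₂ : Level} → ExcludedMiddle (c ⊔ ℓ₁ ⊔ ℓ₂) →
    (k : NumberField c ℓ₁ ℓ₂) (n : ℕ) .{{_ : NonZero n}} → n ≤ 5 →
    (F : Vector (LinearForm k) n) → GeneralPosition k F →
    Σ[ S ∈ List (FinitePlace k) ]
      DenseInℙ² k (Solutions k F S) × DenseIn𝔸³ k (Solutions k F S)
theorem9 em k 1 _ F position = UpToThree.one-form em k F position
theorem9 em k 2 _ F position = UpToThree.two-forms em k F position
theorem9 em k 3 _ F position = UpToThree.three-forms em k F position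
theorem9 em k 4 _ F position = Four.FourForms.conclusion em k F position
theorem9 em k 5 _ F position = Constants.five-forms em k F position
theorem9 em k (suc (suc (suc (suc (suc (suc n)))))) (ℕ.s≤s (ℕ.s≤s (ℕ.s≤s (ℕ.s≤s (ℕ.s≤s ()))))) F position
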